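{- Let $\mathcal{C}(K,\mathfrak{o}_p)$ be the Fréchet space of continuous functions $K\to\mathfrak{o}_p$, and let $\mathcal{D}(K,\mathfrak{o}_p)=\mathrm{Hom}^{\mathrm{cts}}_{\mathfrak{o}_p}(\mathcal{C}(K,\mathfrak{o}_p),\mathfrak{o}_p)$ be its continuous linear dual. Choose a compatible system of primitive $\ell$-power roots of unity $\zeta=(\zeta_n)_{n\ge 0}\in\varprojlim_n \mu_{\ell^n}$ in $\mathfrak{o}_p$. Then the map $$\mathcal{D}(K,\mathfrak{o}_p)\hookrightarrow \mathcal{C}(K,\mathfrak{o}_p),\qquad \mu\mapsto\hat\mu_\zeta,$$ is an embedding, which identifies $\mathcal{D}(K,\mathfrak{o}_p)$ with the uniformly continuous functions $K\to\mathfrak{o}_p$. Furthermore, let $dx$ denote the linear functional on compactly supported locally constant functions on $K$ defined by $dx(\mathbf{1}_{a+\mathfrak{l}^n})=q^{ -\delta/2-n}$ for $a\in K$, $n\in\mathbf{Z}$. Then for any $f\in\mathcal{C}(K,\mathfrak{o}_p)$ such that $\lim_{x\to\infty}f(x)=0$, we have $f\,dx\in\mathcal{D}(K,\mathfrak{o}_p)$, and for all $\xi\in K$ $$(f\,dx)^\wedge_\zeta(\xi)=\int_K f(x)\,\zeta^{\mathrm{tr}(x\xi)}\,dx .$$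
   Context: $\ell\neq p$ are primes; $K$ is a finite extension of $\mathbf{Q}_\ell$ with valuation ring $\mathfrak{o}_K$, maximal ideal $\mathfrak{l}=(\pi)$, residue cardinality $q=\#\mathfrak{o}_K/(\pi)$; $\mathfrak{d}=(\pi^\delta)$ is the different of $\mathfrak{o}_K/\mathbf{Z}_\ell$; $\mathrm{tr}:K\to\mathbf{Q}_\ell$ is the trace. $\mathbf{C}_p$ is the completion of an algebraic closure of $\mathbf{Q}_p$, with absolute value $|\cdot|_p$, $|p|_p=1/p$, and $\mathfrak{o}_p$ is its ring of integers. A square root $q^{1/2}$ of $q$ in $\mathbf{C}_p$ is fixed and $q^{ -\delta/2}=(q^{1/2})^{ -\delta}$. $\mathbf{1}_E$ is the characteristic function of $E\subset K$. Topology of $\mathcal{C}(K,\mathfrak{o}_p)$: defined by the seminorms $\|f\|_U=\sup_{x\in U}|f(x)|_p$, $U$ ranging over compact open subsets of $K$. Roots of unity: $\zeta_n$ is a primitive $\ell^n$-th root of unity in $\mathfrak{o}_p$ and $\zeta_{n+1}^\ell=\zeta_n$. For $x\in\mathbf{Q}_\ell$, write $x=\ell^t u$ with $u\in\mathbf{Z}_\ell$ and set $\zeta^x=\zeta_{ -t}^u$, where $\zeta_n=1$ for $n<0$. For $\mu\in\mathcal{D}(K,\mathfrak{o}_p)$, the function $\hat\mu_\zeta:K\to\mathfrak{o}_p$ is $\hat\mu_\zeta(r)=\int_K\zeta^{\mathrm{tr}(rx)}\mu(x)$, i.e. the value of $\mu$ at the continuous function $x\mapsto\zeta^{\mathrm{tr}(rx)}$.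 Integration against $dx$: for continuous $f:K\to\mathfrak{o}_p$ with $\lim_{x\to\infty}f(x)=0$, $\int_K f(x)\,dx$ is the value at $f$ of the extension of $dx$ by continuity for the sup norm (compactly supported locally constant functions are sup-norm dense among such $f$). For such $f$, $f\,dx$ denotes the functional $g\mapsto\int_K f(x)g(x)\,dx$ on $\mathcal{C}(K,\mathfrak{o}_p)$. -}

module Defs where

open import Level using (0ℓ) renaming (suc to lsuc)
open import Data.Bool.Base using (if_then_else_)
open import Data.Nat.Base as ℕ using (ℕ; zero; suc)
open import Data.Nat.Divisibility using (_∣_)
open import Data.Integer.Base as ℤ using (ℤ; +_; -[1+_])
open import Data.Rational.Base as ℚ using (ℚ; 0ℚ; 1ℚ)
import Data.Rational.Properties as ℚ
open import Data.Fin.Base using (Fin)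
open import Data.List.Base using (List; []; _++_)
open import Data.List.Relation.Unary.Any using (Any)
open import Data.List.Relation.Unary.Any.Properties using (++⁺ˡ; ++⁺ʳ)
open import Data.Vec.Base as Vec using (Vec; []; _∷_)
open import Data.Product.Base using (Σ; Σ-syntax; ∃; ∃-syntax; _×_; _,_; proj₁; proj₂)
open import Data.Product using (∃!)
open import Data.Sum.Base using (_⊎_; inj₁; inj₂; [_,_]′)
open import Algebra.Bundles using (CommutativeRing)
open import Algebra.Apartness.Bundles using (HeytingField; HeytingCommutativeRing)
open import Algebra.Morphism.Structures using (IsRingHomomorphism)
open import Algebra.Module.Bundles.Raw using (RawLeftModule)
open import Algebra.Module.Morphism.Structures using (IsLeftModuleHomomorphism)
open import Function.Base using (_∘_; _∋_)
open import Function.Bundles using (Func; _⇔_; mk⇔; Equivalence)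
open import Relation.Binary.PropositionalEquality as ≡ using (_≡_)
open import Relation.Nullary using (¬_; Dec; yes; no; does; contradiction)
open import Relation.Nullary.Decidable using (does-⇔; dec-true)
open import Relation.Nullary.Construct.Add.Supremum using (_⁺; ⊤⁺; [_])
open import Relation.Unary using (Pred; _∈_; _∉_; _⊆_; _∪_; ⋃; ∅)
import Relation.Binary.Construct.Add.Supremum.NonStrict as NonStrict
import Algebra.Properties.CommutativeSemigroup as CommutativeSemigroupProperties
import Algebra.Properties.Group as GroupProperties
import Algebra.Properties.Ring as RingProperties
import Algebra.Properties.Semiring.Exp as Exp
import Algebra.Properties.Semiring.Mult as Mult
import Algebra.Properties.Semiring.Sum as Sum
import Relation.Binary.Reasoning.Setoid as SetoidReasoning

-- The standard library has no real numbers, so a non-archimedean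
-- absolute value is recorded by the additive valuation v(x) = -log|x|,
-- with v(0) = ∞.  Rational values suffice: the value groups of ℚ_p, of
-- its finite extensions and of ℂ_p are contained in ℚ.  A bound
-- |x| ≤ c^(-r) reads [ r ] ≤∞ v x.

ℚ∞ : Set
ℚ∞ = ℚ ⁺

open NonStrict ℚ._≤_ public
  using ([_]; _≤⊤⁺)
  renaming (_≤⁺_ to infix 4 _≤∞_)

infixl 6 _+∞_
_+∞_ : ℚ∞ → ℚ∞ → ℚ∞
[ r ] +∞ [ s ] = [ r ℚ.+ s ]
[ r ] +∞ ⊤⁺    = ⊤⁺
⊤⁺    +∞ _     = ⊤⁺

0∞ : ℚ∞
0∞ = [ 0ℚ ]

_≤∞?_ : ∀ a b → Dec (a ≤∞ b)
_≤∞?_ = NonStrict.≤⁺-dec ℚ._≤_ ℚ._≤?_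

≤∞-refl : ∀ {a} → a ≤∞ a
≤∞-refl = NonStrict.≤⁺-reflexive-≡ ℚ._≤_ ℚ.≤-reflexive ≡.refl

≤∞-trans : ∀ {a b c} → a ≤∞ b → b ≤∞ c → a ≤∞ c
≤∞-trans = NonStrict.≤⁺-trans ℚ._≤_ ℚ.≤-trans

≤∞-total : ∀ a b → (a ≤∞ b) ⊎ (b ≤∞ a)
≤∞-total = NonStrict.≤⁺-total ℚ._≤_ ℚ.≤-total

≤∞-antisym : ∀ {a b} → a ≤∞ b → b ≤∞ a → a ≡ b
≤∞-antisym = NonStrict.≤⁺-antisym-≡ ℚ._≤_ ℚ.≤-antisym

+∞-mono : ∀ {a b c d} → a ≤∞ b → c ≤∞ d → a +∞ c ≤∞ b +∞ d
+∞-mono {[ _ ]} {[ _ ]} {[ _ ]} {[ _ ]} [ p ] [ q ] = [ ℚ.+-mono-≤ p q ]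
+∞-mono {d = ⊤⁺} [ p ] _       = _ ≤⊤⁺
+∞-mono (_ ≤⊤⁺) _              = _ ≤⊤⁺

≤∞-+ˡ : ∀ {a b} → 0∞ ≤∞ b → a ≤∞ a +∞ b
≤∞-+ˡ {[ r ]} {[ s ]} [ p ] =
  [ ≡.subst (ℚ._≤ r ℚ.+ s) (ℚ.+-identityʳ r) (ℚ.+-monoʳ-≤ r p) ]
≤∞-+ˡ {[ r ]} {⊤⁺} _ = _ ≤⊤⁺
≤∞-+ˡ {⊤⁺} _ = _ ≤⊤⁺

0≤a+b : ∀ {a b} → 0∞ ≤∞ a → 0∞ ≤∞ b → 0∞ ≤∞ a +∞ b
0≤a+b p q = ≤∞-trans p (≤∞-+ˡ q)

⊔-≤∞ˡ : ∀ {r s a} → [ r ℚ.⊔ s ] ≤∞ a → [ r ] ≤∞ a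
⊔-≤∞ˡ {r} {s} = ≤∞-trans [ ℚ.p≤p⊔q r s ]

⊔-≤∞ʳ : ∀ {r s a} → [ r ℚ.⊔ s ] ≤∞ a → [ s ] ≤∞ a
⊔-≤∞ʳ {r} {s} = ≤∞-trans [ ℚ.p≤q⊔p r s ]

a≤0⇒2a≤a : ∀ {a} → a ≤∞ 0∞ → a +∞ a ≤∞ a
a≤0⇒2a≤a {[ r ]} [ p ] =
  [ ≡.subst (r ℚ.+ r ℚ.≤_) (ℚ.+-identityʳ r) (ℚ.+-monoʳ-≤ r p) ]

2a≡a⇒0≤a : ∀ a → a +∞ a ≡ a → 0∞ ≤∞ a
2a≡a⇒0≤a ⊤⁺    _  = _ ≤⊤⁺
2a≡a⇒0≤a [ r ] eq = ≤∞-refl′ (≡.sym (identityʳ-unique r r ([]-injective eq)))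
  where
  open GroupProperties ℚ.+-0-group using (identityʳ-unique)
  []-injective : ∀ {a b : ℚ} → _≡_ {A = ℚ∞} [ a ] [ b ] → a ≡ b
  []-injective ≡.refl = ≡.refl
  ≤∞-refl′ : ∀ {a b : ℚ} → a ≡ b → [ a ] ≤∞ [ b ]
  ≤∞-refl′ ≡.refl = ≤∞-refl

radius : ∀ c → ∃[ s ] ∀ {a} → [ s ] ≤∞ a → 0∞ ≤∞ c +∞ a
radius ⊤⁺    = 0ℚ , λ _ → _ ≤⊤⁺
radius [ r ] = ℚ.- r , λ {a} p →
  ≡.subst (_≤∞ [ r ] +∞ a) (≡.cong (λ s → ℚ∞ ∋ [ s ]) (ℚ.+-inverseʳ r)) (+∞-mono (≤∞-refl {[ r ]}) p)

record Valuation (F : HeytingField 0ℓ 0ℓ 0ℓ) : Set where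
  open HeytingField F
  field
    v      : Carrier → ℚ∞
    v-cong : ∀ {x y} → x ≈ y → v x ≡ v y
    v≡∞    : ∀ x → v x ≡ ⊤⁺ ⇔ x ≈ 0#
    v-*    : ∀ x y → v (x * y) ≡ v x +∞ v y
    v-+    : ∀ x y → v x ≤∞ v y → v x ≤∞ v (x + y)

record ValuedField : Set₁ where
  field
    heytingField : HeytingField 0ℓ 0ℓ 0ℓ
    valuation    : Valuation heytingField

  open Valuation valuation public

  commutativeRing : CommutativeRing 0ℓ 0ℓ
  commutativeRing =
    HeytingCommutativeRing.commutativeRing (HeytingField.heytingCommutativeRing heytingField)

  open CommutativeRing commutativeRing public
  open RingProperties ring public
    using (-1*x≈-x; -‿involutive; x[y-z]≈xy-xz; x≈y⇒x∙y⁻¹≈ε; x∙y⁻¹≈ε⇒x≈y; ⁻¹-anti-homo‿-; -‿+-comm)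
  open CommutativeSemigroupProperties +-commutativeSemigroup public using (interchange)
  open Exp semiring public using (_^_)
  open Mult semiring public using () renaming (_×_ to _•_)
  open Sum semiring public
    using (sum; sum-cong-≋; ∑-distrib-+; *-distribˡ-sum)

  v-0 : v 0# ≡ ⊤⁺
  v-0 = Equivalence.from (v≡∞ 0#) refl

  v-+-min : ∀ {a} x y → a ≤∞ v x → a ≤∞ v y → a ≤∞ v (x + y)
  v-+-min x y p q with ≤∞-total (v x) (v y)
  ... | inj₁ le = ≤∞-trans p (v-+ x y le)
  ... | inj₂ le = ≤∞-trans q (≡.subst (v y ≤∞_) (v-cong (+-comm y x)) (v-+ y x le))

  Integral : Pred Carrier 0ℓ
  Integral x = 0∞ ≤∞ v x

  0-integral : Integral 0#
  0-integral = ≡.subst (0∞ ≤∞_) (≡.sym v-0) (_ ≤⊤⁺)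

  1-integral : Integral 1#
  1-integral = 2a≡a⇒0≤a (v 1#) (≡.trans (≡.sym (v-* 1# 1#)) (v-cong (*-identityˡ 1#)))

  v-*ˡ : ∀ {a} c x → Integral c → a ≤∞ v x → a ≤∞ v (c * x)
  v-*ˡ {a} c x 0≤c a≤x = ≡.subst (a ≤∞_) (≡.sym (≡.trans (v-cong (*-comm c x)) (v-* x c)))
    (≤∞-trans a≤x (≤∞-+ˡ 0≤c))

  -1-integral : Integral (- 1#)
  -1-integral with ≤∞-total 0∞ (v (- 1#))
  ... | inj₁ p = p
  ... | inj₂ p = ≤∞-trans 1-integral
    (≡.subst (_≤∞ v (- 1#)) (≡.trans (≡.sym (v-* _ _)) (v-cong -1²)) (a≤0⇒2a≤a p))
    where
    -1² : - 1# * - 1# ≈ 1#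
    -1² = trans (-1*x≈-x _) (-‿involutive 1#)

  v-neg : ∀ {a} x → a ≤∞ v x → a ≤∞ v (- x)
  v-neg {a} x p = ≡.subst (a ≤∞_) (v-cong (-1*x≈-x x)) (v-*ˡ _ x -1-integral p)

  v-swap : ∀ {a} x y → a ≤∞ v (x - y) → a ≤∞ v (y - x)
  v-swap {a} x y p = ≡.subst (a ≤∞_) (v-cong (⁻¹-anti-homo‿- x y)) (v-neg _ p)

  telescope : ∀ x y z → (x - y) + (y - z) ≈ x - z
  telescope x y z = begin
    (x - y) + (y - z)    ≈⟨ +-assoc x (- y) (y - z) ⟩
    x + (- y + (y - z))  ≈⟨ +-congˡ (+-assoc (- y) y (- z)) ⟨
    x + (- y + y - z)    ≈⟨ +-congˡ (+-congʳ (-‿inverseˡ y)) ⟩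
    x + (0# - z)         ≈⟨ +-congˡ (+-identityˡ (- z)) ⟩
    x - z                ∎
    where open SetoidReasoning setoid

  v-trans : ∀ {a} x y z → a ≤∞ v (x - y) → a ≤∞ v (y - z) → a ≤∞ v (x - z)
  v-trans {a} x y z p q =
    ≡.subst (a ≤∞_) (v-cong (telescope x y z)) (v-+-min (x - y) (y - z) p q)

  v-≈ : ∀ {a} x y → x ≈ y → a ≤∞ v (x - y)
  v-≈ x y x≈y = ≡.subst (_ ≤∞_)
    (≡.sym (≡.trans (v-cong (x≈y⇒x∙y⁻¹≈ε x≈y)) v-0)) (_ ≤⊤⁺)

  v-+-diff : ∀ {a} x y x′ y′ → a ≤∞ v (x - x′) → a ≤∞ v (y - y′) →
             a ≤∞ v ((x + y) - (x′ + y′))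
  v-+-diff {a} x y x′ y′ p q =
    ≡.subst (a ≤∞_) (v-cong eq) (v-+-min (x - x′) (y - y′) p q)
    where
    open SetoidReasoning setoid
    eq : (x - x′) + (y - y′) ≈ (x + y) - (x′ + y′)
    eq = begin
      (x - x′) + (y - y′)      ≈⟨ interchange x (- x′) y (- y′) ⟩
      (x + y) + (- x′ + - y′)  ≈⟨ +-congˡ (-‿+-comm x′ y′) ⟩
      (x + y) - (x′ + y′)      ∎

  v-neg-diff : ∀ {a} x y → a ≤∞ v (x - y) → a ≤∞ v (- x - - y)
  v-neg-diff {a} x y p = ≡.subst (a ≤∞_) (v-cong (sym (-‿+-comm x (- y)))) (v-neg (x - y) p)

  v-*-diff : ∀ {a} x y x′ y′ → Integral x → Integral y′ →
             a ≤∞ v (x - x′) → a ≤∞ v (y - y′) → a ≤∞ v (x * y - x′ * y′)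
  v-*-diff {a} x y x′ y′ 0≤x 0≤y′ p q = v-trans (x * y) (x * y′) (x′ * y′)
    (≡.subst (a ≤∞_) (v-cong (x[y-z]≈xy-xz x y y′)) (v-*ˡ x (y - y′) 0≤x q))
    (≡.subst (a ≤∞_) (v-cong (trans (x[y-z]≈xy-xz y′ x x′) (+-cong (*-comm y′ x) (-‿cong (*-comm y′ x′)))))
      (v-*ˡ y′ (x - x′) 0≤y′ p))

  +-integral : ∀ {x y} → Integral x → Integral y → Integral (x + y)
  +-integral {x} {y} = v-+-min x y

  *-integral : ∀ {x y} → Integral x → Integral y → Integral (x * y)
  *-integral {x} {y} = v-*ˡ x y

  -- The valuation ring, as a set of scalars.
  𝔬 : Set
  𝔬 = Σ Carrier Integral

  Cauchy : (ℕ → Carrier) → Set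
  Cauchy u = ∀ r → ∃[ N ] ∀ m n → N ℕ.≤ m → N ℕ.≤ n → [ r ] ≤∞ v (u m - u n)

  _⟶_ : (ℕ → Carrier) → Carrier → Set
  u ⟶ x = ∀ r → ∃[ N ] ∀ n → N ℕ.≤ n → [ r ] ≤∞ v (u n - x)

  Complete : Set
  Complete = ∀ u → Cauchy u → ∃[ x ] u ⟶ x

  -- monic (c₀ ∷ … ∷ cₙ₋₁ ∷ []) x = c₀ + c₁ x + … + cₙ₋₁ xⁿ⁻¹ + xⁿ
  monic : ∀ {n} → Vec Carrier n → Carrier → Carrier
  monic []       x = 1#
  monic (c ∷ cs) x = c + x * monic cs x

  AlgebraicallyClosed : Set
  AlgebraicallyClosed = ∀ {n} (cs : Vec Carrier (suc n)) → ∃[ x ] monic cs x ≈ 0#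

record IsEmbedding (F E : ValuedField) (ι : ValuedField.Carrier F → ValuedField.Carrier E) : Set where
  private
    module F = ValuedField F
    module E = ValuedField E
  field
    isRingHomomorphism : IsRingHomomorphism F.rawRing E.rawRing ι
    isometric          : ∀ x → E.v (ι x) ≡ F.v x

record IsCompletion (F E : ValuedField) (ι : ValuedField.Carrier F → ValuedField.Carrier E) : Set where
  private
    module F = ValuedField F
    module E = ValuedField E
  field
    isEmbedding : IsEmbedding F E ι
    dense       : ∀ y r → ∃[ x ] [ r ] ≤∞ E.v (y E.- ι x)
    complete    : E.Complete

-- The p-adic valuation of ℚ, normalised by v(p) = 1.
record PAdicValuation (p : ℕ) : Set where
  field
    valuation : Valuation ℚ.heytingField

  valuedField : ValuedField
  valuedField = record { heytingField = ℚ.heytingField ; valuation = valuation }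

  open ValuedField valuedField
  field
    -- With multiplicativity, this is v(p^k a/b) = k for a, b prime to p.
    v-p    : v (p • 1#) ≡ [ 1ℚ ]
    v-unit : ∀ n → ¬ p ∣ n → v (n • 1#) ≡ 0∞

record PAdicNumbers (p : ℕ) : Set₁ where
  field
    rationals    : PAdicValuation p
    valuedField  : ValuedField
    ι            : ℚ → ValuedField.Carrier valuedField
    isCompletion : IsCompletion (PAdicValuation.valuedField rationals) valuedField ι

-- A finite extension of a complete field F; its valuation is the unique
-- one extending that of F.
record FiniteExtension (F : ValuedField) : Set₁ where
  private module F = ValuedField F
  field
    valuedField : ValuedField
  open ValuedField valuedField
  field
    ι           : F.Carrier → Carrier
    isEmbedding : IsEmbedding F valuedField ι
    degree      : ℕ
    basis       : Fin degree → Carrier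
    coord       : Carrier → Fin degree → F.Carrier
    spans       : ∀ x → x ≈ sum (λ i → ι (coord x i) * basis i)
    independent : (c : Fin degree → F.Carrier) → sum (λ i → ι (c i) * basis i) ≈ 0# → ∀ i → c i F.≈ F.0#

  -- The trace of the matrix of multiplication by x.
  tr : Carrier → F.Carrier
  tr x = F.sum (λ i → coord (x * basis i) i)

  private
    open IsEmbedding isEmbedding
    open IsRingHomomorphism isRingHomomorphism

    sum-neg : ∀ {n} (f : Fin n → Carrier) → sum (λ i → - f i) ≈ - sum f
    sum-neg {n} f = begin
      sum (λ i → - f i)        ≈⟨ sum-cong-≋ (λ i → sym (-1*x≈-x (f i))) ⟩
      sum (λ i → - 1# * f i)   ≈⟨ *-distribˡ-sum (- 1#) f ⟨
      - 1# * sum f             ≈⟨ -1*x≈-x _ ⟩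
      - sum f                  ∎
      where open SetoidReasoning setoid

  coord-- : ∀ x y i → coord (x - y) i F.≈ coord x i F.- coord y i
  coord-- x y i = F.x∙y⁻¹≈ε⇒x≈y (a i) (b i) (independent c eq i)
    where
    open SetoidReasoning setoid
    a b c : Fin degree → F.Carrier
    a = coord (x - y)
    b j = coord x j F.- coord y j
    c j = a j F.- b j
    comb : (Fin degree → F.Carrier) → Fin degree → Carrier
    comb k j = ι (k j) * basis j
    comb-- : ∀ k l j → comb (λ j → k j F.- l j) j ≈ comb k j - comb l j
    comb-- k l j = begin
      ι (k j F.- l j) * basis j            ≈⟨ *-congʳ (+-homo _ _) ⟩
      (ι (k j) + ι (F.- l j)) * basis j    ≈⟨ *-congʳ (+-congˡ (-‿homo _)) ⟩
      (ι (k j) - ι (l j)) * basis j        ≈⟨ *-comm _ _ ⟩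
      basis j * (ι (k j) - ι (l j))        ≈⟨ x[y-z]≈xy-xz _ _ _ ⟩
      basis j * ι (k j) - basis j * ι (l j) ≈⟨ +-cong (*-comm _ _) (-‿cong (*-comm _ _)) ⟩
      comb k j - comb l j                  ∎
    sum-comb-- : ∀ k l → sum (comb (λ j → k j F.- l j)) ≈ sum (comb k) - sum (comb l)
    sum-comb-- k l = begin
      sum (comb (λ j → k j F.- l j))               ≈⟨ sum-cong-≋ (comb-- k l) ⟩
      sum (λ j → comb k j - comb l j)              ≈⟨ ∑-distrib-+ (comb k) (λ j → - comb l j) ⟩
      sum (comb k) + sum (λ j → - comb l j)        ≈⟨ +-congˡ (sum-neg (comb l)) ⟩
      sum (comb k) - sum (comb l)                  ∎
    eq : sum (comb c) ≈ 0#
    eq = begin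
      sum (comb c)                     ≈⟨ sum-comb-- a b ⟩
      sum (comb a) - sum (comb b)      ≈⟨ +-cong (sym (spans (x - y))) (-‿cong (sum-comb-- (coord x) (coord y))) ⟩
      (x - y) - (sum (comb (coord x)) - sum (comb (coord y)))
        ≈⟨ +-congˡ (-‿cong (+-cong (sym (spans x)) (-‿cong (sym (spans y))))) ⟩
      (x - y) - (x - y)                ≈⟨ -‿inverseʳ _ ⟩
      0#                               ∎

  coord-cong : ∀ {x y} → x ≈ y → ∀ i → coord x i F.≈ coord y i
  coord-cong {x} {y} x≈y i = F.x∙y⁻¹≈ε⇒x≈y (coord x i) (coord y i)
    (F.trans (F.sym (coord-- x y i)) (independent (coord (x - y)) (trans (sym (spans (x - y))) (x≈y⇒x∙y⁻¹≈ε x≈y)) i))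

  tr-cong : ∀ {x y} → x ≈ y → tr x F.≈ tr y
  tr-cong x≈y = F.sum-cong-≋ (λ i → coord-cong (*-congʳ x≈y) i)

  tr-- : ∀ x y → tr (x - y) F.≈ tr x F.- tr y
  tr-- x y = begin
    tr (x - y)  ≈⟨ F.sum-cong-≋ (λ i → F.trans (coord-cong (lem i) i) (coord-- _ _ i)) ⟩
    F.sum (λ i → X i F.- Y i)              ≈⟨ F.∑-distrib-+ X (λ i → F.- Y i) ⟩
    tr x F.+ F.sum (λ i → F.- Y i)         ≈⟨ F.+-congˡ (F.sum-cong-≋ (λ i → F.sym (F.-1*x≈-x (Y i)))) ⟩
    tr x F.+ F.sum (λ i → F.- F.1# F.* Y i) ≈⟨ F.+-congˡ (F.*-distribˡ-sum _ Y) ⟨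
    tr x F.+ F.- F.1# F.* tr y             ≈⟨ F.+-congˡ (F.-1*x≈-x _) ⟩
    tr x F.- tr y                          ∎
    where
    open SetoidReasoning F.setoid
    X Y : Fin degree → F.Carrier
    X i = coord (x * basis i) i
    Y i = coord (y * basis i) i
    lem : ∀ i → (x - y) * basis i ≈ x * basis i - y * basis i
    lem i = trans (*-comm _ _) (trans (x[y-z]≈xy-xz _ _ _) (+-cong (*-comm _ _) (-‿cong (*-comm _ _))))

record LocalData {F : ValuedField} (K : FiniteExtension F) : Set where
  private module F = ValuedField F
  open FiniteExtension K using (valuedField; tr)
  open ValuedField valuedField
  field
    π          : Carrier
    π-generates : ∀ x → (¬ v x ≤∞ 0∞) ⇔ (∃[ y ] Integral y × x ≈ π * y)

    -- residues is a system of representatives of (valuation ring)/(π).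
    q        : ℕ
    residues : Fin q → Carrier
    residues-integral : ∀ i → Integral (residues i)
    residues-complete : ∀ x → Integral x →
      ∃! _≡_ (λ i → ∃[ y ] Integral y × x - residues i ≈ π * y)

  -- The dual of the valuation ring for the trace form, i.e. the inverse
  -- of the different.
  codifferent : Pred Carrier 0ℓ
  codifferent x = ∀ y → Integral y → F.Integral (tr (x * y))

  field
    δ : ℕ
    -- (π^δ) is the inverse fractional ideal of the codifferent:
    -- (π^δ) · codifferent = (1).
    different : ∀ x → Integral x ⇔ (∃[ y ] y ∈ codifferent × x ≈ π ^ δ * y)

  𝔩^_ : ℤ → Pred Carrier 0ℓ
  (𝔩^ (+ n))      x = ∃[ y ] Integral y × x ≈ π ^ n * y
  (𝔩^ (-[1+ n ])) x = Integral (π ^ suc n * x)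

  tr-near : ∀ ξ → ∃[ s ] ∀ z → [ s ] ≤∞ v z → F.Integral (tr (ξ * z))
  tr-near ξ with Equivalence.to (different 1#) 1-integral | radius (v (π ^ δ * ξ))
  ... | d , d∈ , 1≈πd | s , near = s , λ z s≤z →
    ≡.subst (0∞ ≤∞_) (F.v-cong (FiniteExtension.tr-cong K (eq z)))
      (d∈ (π ^ δ * ξ * z) (≡.subst (0∞ ≤∞_) (≡.sym (v-* (π ^ δ * ξ) z)) (near s≤z)))
    where
    open SetoidReasoning setoid
    eq : ∀ z → d * (π ^ δ * ξ * z) ≈ ξ * z
    eq z = begin
      d * (π ^ δ * ξ * z)     ≈⟨ *-congˡ (*-assoc _ _ _) ⟩
      d * (π ^ δ * (ξ * z))   ≈⟨ *-assoc _ _ _ ⟨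
      d * π ^ δ * (ξ * z)     ≈⟨ *-congʳ (trans (*-comm _ _) (sym 1≈πd)) ⟩
      1# * (ξ * z)            ≈⟨ *-identityˡ _ ⟩
      ξ * z                   ∎

record AlgebraicClosure (F : ValuedField) : Set₁ where
  private module F = ValuedField F
  field
    valuedField : ValuedField
  open ValuedField valuedField
  field
    ι           : F.Carrier → Carrier
    isEmbedding : IsEmbedding F valuedField ι
    algebraic   : ∀ x → ∃[ n ] Σ[ cs ∈ Vec F.Carrier n ] monic (Vec.map ι cs) x ≈ 0#
    closed      : AlgebraicallyClosed

record ComplexPAdics (p : ℕ) : Set₁ where
  field
    ℚₚ           : PAdicNumbers p
    closure      : AlgebraicClosure (PAdicNumbers.valuedField ℚₚ)
    valuedField  : ValuedField
    ι            : ValuedField.Carrier (AlgebraicClosure.valuedField closure) →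
                   ValuedField.Carrier valuedField
    isCompletion : IsCompletion (AlgebraicClosure.valuedField closure) valuedField ι

module Topology (K : ValuedField) where
  open ValuedField K

  Open : Pred Carrier 0ℓ → Set
  Open U = ∀ {x} → x ∈ U → ∃[ s ] ∀ y → [ s ] ≤∞ v (y - x) → y ∈ U

  Compact : Pred Carrier 0ℓ → Set₁
  Compact U = (I : Set) (V : I → Pred Carrier 0ℓ) → (∀ i → Open (V i)) → U ⊆ ⋃ I V →
    Σ[ is ∈ List I ] (∀ {x} → x ∈ U → Any (λ i → x ∈ V i) is)

  CompactOpen : Pred Carrier 0ℓ → Set₁
  CompactOpen U = Compact U × Open U

  ∅-compact : Compact ∅
  ∅-compact I V _ _ = [] , λ ()

  ∪-compact : ∀ {U W} → Compact U → Compact W → Compact (U ∪ W)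
  ∪-compact {U} {W} cU cW I V oV cover with cU I V oV (cover ∘ inj₁) | cW I V oV (cover ∘ inj₂)
  ... | is , f | js , g = is ++ js , [ ++⁺ˡ ∘ f , ++⁺ʳ is ∘ g ]′

  ∪-open : ∀ {U W} → Open U → Open W → Open (U ∪ W)
  ∪-open oU oW (inj₁ x∈U) with oU x∈U
  ... | s , f = s , λ y p → inj₁ (f y p)
  ∪-open oU oW (inj₂ x∈W) with oW x∈W
  ... | s , f = s , λ y p → inj₂ (f y p)

  ∪-compactOpen : ∀ {U W} → CompactOpen U → CompactOpen W → CompactOpen (U ∪ W)
  ∪-compactOpen {U} {W} (cU , oU) (cW , oW) = ∪-compact cU cW , ∪-open {U} {W} oU oW

  ∅-compactOpen : CompactOpen ∅
  ∅-compactOpen = ∅-compact , λ ()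

-- Functions K → 𝔬, for 𝔬 the valuation ring of ℂ, are functions K → ℂ
-- with integral values.
module FunctionSpaces (K ℂ : ValuedField) where
  private module K = ValuedField K
  open Topology K
  open ValuedField ℂ
  open RingProperties ring using (-0#≈0#; -‿distribʳ-*)
  open CommutativeSemigroupProperties *-commutativeSemigroup using (x∙yz≈y∙xz)

  near : ℚ → Carrier → Carrier → Set
  near r x y = [ r ] ≤∞ v (x - y)

  Fun : Set
  Fun = Func K.setoid setoid

  open Func

  infix 4 _≗_
  _≗_ : Fun → Fun → Set
  f ≗ g = ∀ x → to f x ≈ to g x

  _+ᶠ_ _*ᶠ_ : Fun → Fun → Fun
  f +ᶠ g = record { to = λ x → to f x + to g x ; cong = λ e → +-cong (cong f e) (cong g e) }
  f *ᶠ g = record { to = λ x → to f x * to g x ; cong = λ e → *-cong (cong f e) (cong g e) }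

  _∙ᶠ_ : 𝔬 → Fun → Fun
  c ∙ᶠ f = record { to = λ x → proj₁ c * to f x ; cong = λ e → *-congˡ (cong f e) }

  -ᶠ_ : Fun → Fun
  -ᶠ f = record { to = λ x → - to f x ; cong = λ e → -‿cong (cong f e) }

  0ᶠ : Fun
  0ᶠ = record { to = λ _ → 0# ; cong = λ _ → refl }

  IntegralValued : Fun → Set
  IntegralValued f = ∀ x → Integral (to f x)

  Continuous : Fun → Set
  Continuous f = ∀ x r → ∃[ s ] ∀ y → [ s ] ≤∞ K.v (y K.- x) → near r (to f y) (to f x)

  UniformlyContinuous : Fun → Set
  UniformlyContinuous f = ∀ r → ∃[ s ] ∀ x y → [ s ] ≤∞ K.v (x K.- y) → near r (to f x) (to f y)

  LocallyConstant : Fun → Set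
  LocallyConstant f = ∀ x → ∃[ s ] ∀ y → [ s ] ≤∞ K.v (y K.- x) → to f y ≈ to f x

  CompactlySupported : Fun → Set₁
  CompactlySupported f = ∃[ U ] Compact U × (∀ x → x ∉ U → to f x ≈ 0#)

  VanishesAtInfinity : Fun → Set₁
  VanishesAtInfinity f = ∀ r → ∃[ U ] Compact U × (∀ x → x ∉ U → near r (to f x) 0#)

  IsIndicator : Fun → Pred K.Carrier 0ℓ → Set
  IsIndicator f E = (∀ x → x ∈ E → to f x ≈ 1#) × (∀ x → x ∉ E → to f x ≈ 0#)

  record 𝒞 : Set where
    field
      fun        : Fun
      integral   : IntegralValued fun
      continuous : Continuous fun
    open Func fun public using (to)

  record 𝒞₀ : Set₁ where
    field
      fun        : Fun
      integral   : IntegralValued fun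
      continuous : Continuous fun
      vanishes   : VanishesAtInfinity fun
    open Func fun public using (to)

  record LCc : Set₁ where
    field
      fun                : Fun
      integral           : IntegralValued fun
      locallyConstant    : LocallyConstant fun
      compactlySupported : CompactlySupported fun
    open Func fun public using (to)

  continuous-+ : ∀ f g → Continuous f → Continuous g → Continuous (f +ᶠ g)
  continuous-+ f g cf cg x r with cf x r | cg x r
  ... | s , p | t , q = s ℚ.⊔ t , λ y h →
    v-+-diff _ _ _ _ (p y (⊔-≤∞ˡ {s} {t} h)) (q y (⊔-≤∞ʳ {s} {t} h))

  continuous-* : ∀ f g → IntegralValued f → IntegralValued g →
                 Continuous f → Continuous g → Continuous (f *ᶠ g)
  continuous-* f g if ig cf cg x r with cf x r | cg x r
  ... | s , p | t , q = s ℚ.⊔ t , λ y h →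
    v-*-diff _ _ _ _ (if y) (ig x) (p y (⊔-≤∞ˡ {s} {t} h)) (q y (⊔-≤∞ʳ {s} {t} h))

  v-*ˡ-diff : ∀ {a} (c : 𝔬) x y → a ≤∞ v (x - y) → a ≤∞ v (proj₁ c * x - proj₁ c * y)
  v-*ˡ-diff {a} (c , ic) x y p = ≡.subst (a ≤∞_) (v-cong (x[y-z]≈xy-xz c x y)) (v-*ˡ c (x - y) ic p)

  continuous-∙ : ∀ c f → Continuous f → Continuous (c ∙ᶠ f)
  continuous-∙ c f cf x r with cf x r
  ... | s , p = s , λ y h → v-*ˡ-diff c _ _ (p y h)

  continuous-- : ∀ f → Continuous f → Continuous (-ᶠ f)
  continuous-- f cf x r with cf x r
  ... | s , p = s , λ y h → v-neg-diff _ _ (p y h)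

  vanish-+ : ∀ f g → VanishesAtInfinity f → VanishesAtInfinity g → VanishesAtInfinity (f +ᶠ g)
  vanish-+ f g vf vg r with vf r | vg r
  ... | U , cU , p | W , cW , q = U ∪ W , ∪-compact cU cW , λ x h →
    v-trans _ (0# + 0#) _ (v-+-diff _ _ _ _ (p x (h ∘ inj₁)) (q x (h ∘ inj₂)))
      (v-≈ _ _ (+-identityˡ 0#))

  vanish-*ʳ : ∀ f g → IntegralValued g → VanishesAtInfinity f → VanishesAtInfinity (f *ᶠ g)
  vanish-*ʳ f g ig vf r with vf r
  ... | U , cU , p = U , cU , λ x h →
    v-trans _ (to g x * 0#) _
      (v-trans _ (to g x * to f x) _ (v-≈ _ _ (*-comm _ _)) (v-*ˡ-diff (to g x , ig x) _ _ (p x h)))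
      (v-≈ _ _ (zeroʳ _))

  vanish-∙ : ∀ c f → VanishesAtInfinity f → VanishesAtInfinity (c ∙ᶠ f)
  vanish-∙ c f vf r with vf r
  ... | U , cU , p = U , cU , λ x h →
    v-trans _ (proj₁ c * 0#) _ (v-*ˡ-diff c _ _ (p x h)) (v-≈ _ _ (zeroʳ _))

  vanish-- : ∀ f → VanishesAtInfinity f → VanishesAtInfinity (-ᶠ f)
  vanish-- f vf r with vf r
  ... | U , cU , p = U , cU , λ x h →
    v-trans _ (- 0#) _ (v-neg-diff _ _ (p x h)) (v-≈ _ _ -0#≈0#)

  LCc⇒𝒞₀ : LCc → 𝒞₀
  LCc⇒𝒞₀ f = record
    { fun = fun
    ; integral = integral
    ; continuous = λ x r → let s , p = locallyConstant x in s , λ y h → v-≈ _ _ (p y h)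
    ; vanishes = λ r → let U , cU , p = compactlySupported in U , cU , λ x h → v-≈ _ _ (p x h)
    }
    where open LCc f

  infixl 7 _⊛_
  _⊛_ : 𝒞₀ → 𝒞 → 𝒞₀
  f ⊛ g = record
    { fun = F.fun *ᶠ G.fun
    ; integral = λ x → *-integral (F.integral x) (G.integral x)
    ; continuous = continuous-* F.fun G.fun F.integral G.integral F.continuous G.continuous
    ; vanishes = vanish-*ʳ F.fun G.fun G.integral F.vanishes
    }
    where
    module F = 𝒞₀ f
    module G = 𝒞 g

  ℂ-module : RawLeftModule 𝔬 0ℓ 0ℓ
  ℂ-module = record
    { Carrierᴹ = Carrier ; _≈ᴹ_ = _≈_ ; _+ᴹ_ = _+_ ; _*ₗ_ = λ c x → proj₁ c * x ; 0ᴹ = 0# ; -ᴹ_ = -_ }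

  𝒞-module : RawLeftModule 𝔬 0ℓ 0ℓ
  𝒞-module = record
    { Carrierᴹ = 𝒞
    ; _≈ᴹ_ = λ f g → fun f ≗ fun g
    ; _+ᴹ_ = λ f g → record
        { fun = fun f +ᶠ fun g
        ; integral = λ x → +-integral (integral f x) (integral g x)
        ; continuous = continuous-+ (fun f) (fun g) (continuous f) (continuous g) }
    ; _*ₗ_ = λ c f → record
        { fun = c ∙ᶠ fun f
        ; integral = λ x → *-integral (proj₂ c) (integral f x)
        ; continuous = continuous-∙ c (fun f) (continuous f) }
    ; 0ᴹ = record
        { fun = 0ᶠ ; integral = λ _ → 0-integral ; continuous = λ _ _ → 0ℚ , λ _ _ → v-≈ _ _ refl }
    ; -ᴹ_ = λ f → record
        { fun = -ᶠ fun f
        ; integral = λ x → v-neg _ (integral f x)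
        ; continuous = continuous-- (fun f) (continuous f) }
    }
    where open 𝒞

  𝒞₀-module : RawLeftModule 𝔬 (lsuc 0ℓ) 0ℓ
  𝒞₀-module = record
    { Carrierᴹ = 𝒞₀
    ; _≈ᴹ_ = λ f g → fun f ≗ fun g
    ; _+ᴹ_ = λ f g → record
        { fun = fun f +ᶠ fun g
        ; integral = λ x → +-integral (integral f x) (integral g x)
        ; continuous = continuous-+ (fun f) (fun g) (continuous f) (continuous g)
        ; vanishes = vanish-+ (fun f) (fun g) (vanishes f) (vanishes g) }
    ; _*ₗ_ = λ c f → record
        { fun = c ∙ᶠ fun f
        ; integral = λ x → *-integral (proj₂ c) (integral f x)
        ; continuous = continuous-∙ c (fun f) (continuous f)
        ; vanishes = vanish-∙ c (fun f) (vanishes f) }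
    ; 0ᴹ = record
        { fun = 0ᶠ
        ; integral = λ _ → 0-integral
        ; continuous = λ _ _ → 0ℚ , λ _ _ → v-≈ _ _ refl
        ; vanishes = λ _ → ∅ , ∅-compact , λ _ _ → v-≈ _ _ refl }
    ; -ᴹ_ = λ f → record
        { fun = -ᶠ fun f
        ; integral = λ x → v-neg _ (integral f x)
        ; continuous = continuous-- (fun f) (continuous f)
        ; vanishes = vanish-- (fun f) (vanishes f) }
    }
    where open 𝒞₀

  LCc-module : RawLeftModule 𝔬 (lsuc 0ℓ) 0ℓ
  LCc-module = record
    { Carrierᴹ = LCc
    ; _≈ᴹ_ = λ f g → fun f ≗ fun g
    ; _+ᴹ_ = λ f g → record
        { fun = fun f +ᶠ fun g
        ; integral = λ x → +-integral (integral f x) (integral g x)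
        ; locallyConstant = λ x →
            let s , p = locallyConstant f x
                t , q = locallyConstant g x
            in s ℚ.⊔ t , λ y h → +-cong (p y (⊔-≤∞ˡ {s} {t} h)) (q y (⊔-≤∞ʳ {s} {t} h))
        ; compactlySupported =
            let U , cU , p = compactlySupported f
                W , cW , q = compactlySupported g
            in U ∪ W , ∪-compact cU cW , λ x h →
                 trans (+-cong (p x (h ∘ inj₁)) (q x (h ∘ inj₂))) (+-identityˡ 0#) }
    ; _*ₗ_ = λ c f → record
        { fun = c ∙ᶠ fun f
        ; integral = λ x → *-integral (proj₂ c) (integral f x)
        ; locallyConstant = λ x → let s , p = locallyConstant f x in s , λ y h → *-congˡ (p y h)
        ; compactlySupported = let U , cU , p = compactlySupported f in
            U , cU , λ x h → trans (*-congˡ (p x h)) (zeroʳ _) }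
    ; 0ᴹ = record
        { fun = 0ᶠ
        ; integral = λ _ → 0-integral
        ; locallyConstant = λ _ → 0ℚ , λ _ _ → refl
        ; compactlySupported = ∅ , ∅-compact , λ _ _ → refl }
    ; -ᴹ_ = λ f → record
        { fun = -ᶠ fun f
        ; integral = λ x → v-neg _ (integral f x)
        ; locallyConstant = λ x → let s , p = locallyConstant f x in s , λ y h → -‿cong (p y h)
        ; compactlySupported = let U , cU , p = compactlySupported f in
            U , cU , λ x h → trans (-‿cong (p x h)) -0#≈0# }
    }
    where open LCc

  -- Continuity for the topology of the seminorms ‖·‖_U.  One U suffices
  -- in a basic neighbourhood, since ‖·‖_U and ‖·‖_W are dominated by
  -- ‖·‖_(U ∪ W).
  FréchetContinuous : (𝒞 → Carrier) → Set₁
  FréchetContinuous μ = ∀ f r → ∃[ U ] CompactOpen U × (∃[ s ] ∀ g →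
    (∀ {x} → x ∈ U → near s (𝒞.to g x) (𝒞.to f x)) → near r (μ g) (μ f))

  SupNormContinuous : (𝒞₀ → Carrier) → Set₁
  SupNormContinuous I = ∀ f r → ∃[ s ] ∀ g →
    (∀ x → near s (𝒞₀.to g x) (𝒞₀.to f x)) → near r (I g) (I f)

  record 𝒟 : Set₁ where
    field
      ∫          : 𝒞 → Carrier
      integral   : ∀ f → Integral (∫ f)
      linear     : IsLeftModuleHomomorphism 𝒞-module ℂ-module ∫
      continuous : FréchetContinuous ∫

  𝒟-module : RawLeftModule 𝔬 (lsuc 0ℓ) 0ℓ
  𝒟-module = record
    { Carrierᴹ = 𝒟
    ; _≈ᴹ_ = λ μ ν → ∀ f → ∫ μ f ≈ ∫ ν f
    ; _+ᴹ_ = λ μ ν → record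
        { ∫ = λ f → ∫ μ f + ∫ ν f
        ; integral = λ f → +-integral (integral μ f) (integral ν f)
        ; linear = mkLinear
            (λ e → +-cong (L.⟦⟧-cong μ e) (L.⟦⟧-cong ν e))
            (λ f g → trans (+-cong (L.+ᴹ-homo μ f g) (L.+ᴹ-homo ν f g)) (interchange _ _ _ _))
            (trans (+-cong (L.0ᴹ-homo μ) (L.0ᴹ-homo ν)) (+-identityˡ 0#))
            (λ f → trans (+-cong (L.-ᴹ-homo μ f) (L.-ᴹ-homo ν f)) (-‿+-comm _ _))
            (λ c f → trans (+-cong (L.*ₗ-homo μ c f) (L.*ₗ-homo ν c f)) (sym (distribˡ _ _ _)))
        ; continuous = continuous-sum μ ν }
    ; _*ₗ_ = λ c μ → record
        { ∫ = λ f → proj₁ c * ∫ μ f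
        ; integral = λ f → *-integral (proj₂ c) (integral μ f)
        ; linear = mkLinear
            (λ e → *-congˡ (L.⟦⟧-cong μ e))
            (λ f g → trans (*-congˡ (L.+ᴹ-homo μ f g)) (distribˡ _ _ _))
            (trans (*-congˡ (L.0ᴹ-homo μ)) (zeroʳ _))
            (λ f → trans (*-congˡ (L.-ᴹ-homo μ f)) (sym (-‿distribʳ-* _ _)))
            (λ d f → trans (*-congˡ (L.*ₗ-homo μ d f)) (x∙yz≈y∙xz _ _ _))
        ; continuous = λ f r → let U , coU , s , p = continuous μ f r in
            U , coU , s , λ g h →
              v-*ˡ-diff c _ _ (p g h) }
    ; 0ᴹ = record
        { ∫ = λ _ → 0#
        ; integral = λ _ → 0-integral
        ; linear = mkLinear (λ _ → refl) (λ _ _ → sym (+-identityˡ 0#)) refl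
            (λ _ → sym -0#≈0#) (λ c _ → sym (zeroʳ _))
        ; continuous = λ _ _ → ∅ , ∅-compactOpen , 0ℚ , λ _ _ → v-≈ _ _ refl }
    ; -ᴹ_ = λ μ → record
        { ∫ = λ f → - ∫ μ f
        ; integral = λ f → v-neg _ (integral μ f)
        ; linear = mkLinear
            (λ e → -‿cong (L.⟦⟧-cong μ e))
            (λ f g → trans (-‿cong (L.+ᴹ-homo μ f g)) (sym (-‿+-comm _ _)))
            (trans (-‿cong (L.0ᴹ-homo μ)) -0#≈0#)
            (λ f → -‿cong (L.-ᴹ-homo μ f))
            (λ c f → trans (-‿cong (L.*ₗ-homo μ c f)) (-‿distribʳ-* _ _))
        ; continuous = λ f r → let U , coU , s , p = continuous μ f r in
            U , coU , s , λ g h → v-neg-diff _ _ (p g h) }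
    }
    where
    open 𝒟
    module L (μ : 𝒟) = IsLeftModuleHomomorphism (linear μ)
    module M = RawLeftModule 𝒞-module
    mkLinear : ∀ {φ : 𝒞 → Carrier} → (∀ {f g} → f M.≈ᴹ g → φ f ≈ φ g) →
      (∀ f g → φ (f M.+ᴹ g) ≈ φ f + φ g) → φ M.0ᴹ ≈ 0# →
      (∀ f → φ (M.-ᴹ f) ≈ - φ f) → (∀ c f → φ (c M.*ₗ f) ≈ proj₁ c * φ f) →
      IsLeftModuleHomomorphism 𝒞-module ℂ-module φ
    mkLinear φ-cong φ-+ φ-0 φ-- φ-* = record
      { +ᴹ-isGroupHomomorphism = record
        { isMonoidHomomorphism = record
          { isMagmaHomomorphism = record
            { isRelHomomorphism = record { cong = λ {f} {g} → φ-cong {f} {g} }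
            ; homo = φ-+ }
          ; ε-homo = φ-0 }
        ; ⁻¹-homo = φ-- }
      ; *ₗ-homo = φ-* }
    continuous-sum : ∀ μ ν → FréchetContinuous (λ f → ∫ μ f + ∫ ν f)
    continuous-sum μ ν f r with continuous μ f r | continuous ν f r
    ... | U , coU , s , p | W , coW , t , q = U ∪ W , ∪-compactOpen coU coW , s ℚ.⊔ t , λ g h →
      v-+-diff _ _ _ _
        (p g (λ x∈U → ⊔-≤∞ˡ {s} {t} (h (inj₁ x∈U))))
        (q g (λ x∈W → ⊔-≤∞ʳ {s} {t} (h (inj₂ x∈W))))

-- A generator ζ of the inverse limit of the groups of ℓⁿ-th roots of unity.
record CompatibleRoots (ℓ : ℕ) (ℂ : ValuedField) : Set where
  open ValuedField ℂ
  field
    ζ           : ℕ → Carrier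
    ζ-integral  : ∀ n → Integral (ζ n)
    ζ-root      : ∀ n → ζ n ^ (ℓ ℕ.^ n) ≈ 1#
    ζ-primitive : ∀ n m → ζ n ^ m ≈ 1# → ℓ ℕ.^ n ∣ m
    compatible  : ∀ n → ζ (suc n) ^ ℓ ≈ ζ n

-- √x together with its inverse, so that integer powers make sense.
record InvertibleRoot (ℂ : ValuedField) (x : ValuedField.Carrier ℂ) : Set where
  open ValuedField ℂ
  field
    √x √x⁻¹ : Carrier
    square  : √x * √x ≈ x
    inverse : √x * √x⁻¹ ≈ 1#

  √x^_ : ℤ → Carrier
  √x^ (+ n)    = √x ^ n
  √x^ -[1+ n ] = √x⁻¹ ^ suc n

-- The largest m < n satisfying P, or 0 if there is none.
search : ∀ {P : Pred ℕ 0ℓ} → (∀ m → Dec (P m)) → ℕ → ℕ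
search P? zero    = zero
search P? (suc n) = if does (P? n) then n else search P? n

search-cong : ∀ {P Q : Pred ℕ 0ℓ} (P? : ∀ m → Dec (P m)) (Q? : ∀ m → Dec (Q m)) →
  (∀ m → P m ⇔ Q m) → ∀ n → search P? n ≡ search Q? n
search-cong P? Q? eq zero    = ≡.refl
search-cong P? Q? eq (suc n)
  rewrite does-⇔ (eq n) (P? n) (Q? n) | search-cong P? Q? eq n = ≡.refl

-- Exponent of ℓ in the denominator of an element of ℚ_ℓ of valuation a.
-- Valuations of nonzero elements of ℚ_ℓ are integers, so the floor only
-- changes the type.
denominator : ℚ∞ → ℕ
denominator ⊤⁺    = 0
denominator [ r ] = if does (0ℚ ℚ.≤? r) then 0 else ℤ.∣ ℚ.floor r ∣

denominator-integral : ∀ {a} → 0∞ ≤∞ a → denominator a ≡ 0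
denominator-integral {⊤⁺} _ = ≡.refl
denominator-integral {[ r ]} [ 0≤r ] =
  ≡.cong (if_then 0 else ℤ.∣ ℚ.floor r ∣) (dec-true (0ℚ ℚ.≤? r) 0≤r)

module Exponential {ℓ : ℕ} (ℚₗ : PAdicNumbers ℓ) {ℂ : ValuedField} (roots : CompatibleRoots ℓ ℂ) where
  open ValuedField (PAdicNumbers.valuedField ℚₗ)
  private module ℂ = ValuedField ℂ
  open CompatibleRoots roots

  ℓ^_ : ℕ → Carrier
  ℓ^ n = (ℓ • 1#) ^ n

  Congruent : ℕ → Carrier → Pred ℕ 0ℓ
  Congruent n u m = v (ℓ^ n) ≤∞ v (u - m • 1#)

  -- The residue of u ∈ ℤ_ℓ modulo ℓⁿ.  Exactly one m < ℓⁿ is congruent to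
  -- u, as ℤ is dense in ℤ_ℓ, so the default of search is not used.
  residue : ℕ → Carrier → ℕ
  residue n u = search {Congruent n u} (λ m → v (ℓ^ n) ≤∞? v (u - m • 1#)) (ℓ ℕ.^ n)

  -- With x = ℓ⁻ⁿ u and u ∈ ℤ_ℓ, this is ζₙ^u.  For x ∈ ℤ_ℓ, n = 0 and the
  -- value is 1.
  ζ^_ : Carrier → ℂ.Carrier
  ζ^ x = ζ n ℂ.^ residue n (ℓ^ n * x)
    where n = denominator (v x)

  ζ^-integral : ∀ x → ℂ.Integral (ζ^ x)
  ζ^-integral x = power (residue n (ℓ^ n * x))
    where
    n = denominator (v x)
    power : ∀ m → ℂ.Integral (ζ n ℂ.^ m)
    power zero    = ℂ.1-integral
    power (suc m) = ℂ.*-integral (ζ-integral n) (power m)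

  private
    v-near : ∀ {a} x y → a ≤∞ v x → a ≤∞ v (x - y) → a ≤∞ v y
    v-near {a} x y p q = ≡.subst (a ≤∞_) (v-cong eq) (v-+-min (y - x) x (v-swap x y q) p)
      where
      eq : (y - x) + x ≈ y
      eq = trans (+-assoc y (- x) x) (trans (+-congˡ (-‿inverseˡ x)) (+-identityʳ y))

    denominator-near : ∀ x y → Integral (x - y) → denominator (v x) ≡ denominator (v y)
    denominator-near x y h with ≤∞-total 0∞ (v x) | ≤∞-total 0∞ (v y)
    ... | inj₁ p | _      = ≡.trans (denominator-integral p)
                              (≡.sym (denominator-integral (v-near x y p h)))
    ... | inj₂ _ | inj₁ q = ≡.trans (denominator-integral (v-near y x q (v-swap x y h)))
                              (≡.sym (denominator-integral q))
    ... | inj₂ p | inj₂ q = ≡.cong denominator (≤∞-antisym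
      (v-near x y ≤∞-refl (≤∞-trans p h))
      (v-near y x ≤∞-refl (≤∞-trans q (v-swap x y h))))

    residue-near : ∀ n x y → Integral (x - y) → residue n (ℓ^ n * x) ≡ residue n (ℓ^ n * y)
    residue-near n x y h = search-cong _ _
      (λ m → mk⇔ (shift x y h m) (shift y x (v-swap x y h) m)) (ℓ ℕ.^ n)
      where
      shift : ∀ x y → Integral (x - y) → ∀ m → Congruent n (ℓ^ n * x) m → Congruent n (ℓ^ n * y) m
      shift x y h m p = v-trans _ (ℓ^ n * x) _ (v-swap (ℓ^ n * x) (ℓ^ n * y)
        (≡.subst (v (ℓ^ n) ≤∞_)
          (≡.trans (≡.sym (v-* _ _)) (v-cong (x[y-z]≈xy-xz _ _ _)))
          (≤∞-+ˡ {v (ℓ^ n)} h))) p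

  ζ^-near : ∀ x y → Integral (x - y) → ζ^ x ≡ ζ^ y
  ζ^-near x y h rewrite denominator-near x y h =
    ≡.cong (ζ (denominator (v y)) ℂ.^_) (residue-near (denominator (v y)) x y h)

module Fourier
  {ℓ : ℕ} (ℚₗ : PAdicNumbers ℓ)
  (K : FiniteExtension (PAdicNumbers.valuedField ℚₗ)) (localData : LocalData K)
  (ℂ : ValuedField) (roots : CompatibleRoots ℓ ℂ)
  (√q : InvertibleRoot ℂ (ValuedField._•_ ℂ (LocalData.q localData) (ValuedField.1# ℂ)))
  where

  open FiniteExtension K public using (tr)
  open LocalData localData public using (δ; 𝔩^_)
  open Exponential ℚₗ roots public using (ζ^_)
  open FunctionSpaces (FiniteExtension.valuedField K) ℂ public
  module K = ValuedField (FiniteExtension.valuedField K)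
  module ℂ = ValuedField ℂ
  private
    module ℚₗ = ValuedField (PAdicNumbers.valuedField ℚₗ)
    open FiniteExtension K using (tr-cong; tr--)
    open Exponential ℚₗ roots using (ζ^-integral; ζ^-near)

    character : ∀ ξ (φ : K.Carrier → K.Carrier) → (∀ x → φ x K.≈ ξ K.* x) → 𝒞
    character ξ φ φ≈ = record
      { fun = record
        { to = λ x → ζ^ tr (φ x)
        ; cong = λ {x} {y} x≈y → ℂ.reflexive (ζ^-near _ _ (ℚₗ.v-≈ _ _
            (tr-cong (K.trans (φ≈ x) (K.trans (K.*-congˡ x≈y) (K.sym (φ≈ y))))))) }
      ; integral = λ x → ζ^-integral _
      ; continuous = λ x r →
          let s , near = LocalData.tr-near localData ξ in
          s , λ y h → ℂ.v-≈ _ _ (ℂ.reflexive (ζ^-near _ _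
            (≡.subst (0∞ ≤∞_) (ℚₗ.v-cong (tr-diff y x)) (near (y K.- x) h))))
      }
      where
      tr-diff : ∀ y x → tr (ξ K.* (y K.- x)) ℚₗ.≈ tr (φ y) ℚₗ.- tr (φ x)
      tr-diff y x = ℚₗ.trans
        (tr-cong (K.trans (K.x[y-z]≈xy-xz ξ y x)
          (K.+-cong (K.sym (φ≈ y)) (K.-‿cong (K.sym (φ≈ x))))))
        (tr-- (φ y) (φ x))

  -- x ↦ ζ^tr(rx)
  χ : K.Carrier → 𝒞
  χ r = character r (λ x → r K.* x) (λ _ → K.refl)

  -- x ↦ ζ^tr(xξ)
  χ′ : K.Carrier → 𝒞
  χ′ ξ = character ξ (λ x → x K.* ξ) (λ x → K.*-comm x ξ)

  infix 10 _^
  _^ : 𝒟 → K.Carrier → ℂ.Carrier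
  (μ ^) r = 𝒟.∫ μ (χ r)

  record IsHaar (dx : LCc → ℂ.Carrier) : Set₁ where
    open InvertibleRoot √q using () renaming (√x^_ to √q^_)
    field
      linear : IsLeftModuleHomomorphism LCc-module ℂ-module dx
      -- q^(-δ/2 - n) is (√q)^(-δ - 2n).
      value  : ∀ a n h → IsIndicator (LCc.fun h) (λ x → (x K.- a) ∈ 𝔩^ n) →
               dx h ℂ.≈ √q^ (ℤ.- (+ δ) ℤ.- + 2 ℤ.* n)

  -- The extension of dx by continuity for the sup norm.
  record IsExtension (dx : LCc → ℂ.Carrier) (∫dx : 𝒞₀ → ℂ.Carrier) : Set₁ where
    field
      linear     : IsLeftModuleHomomorphism 𝒞₀-module ℂ-module ∫dx
      continuous : SupNormContinuous ∫dx
      extends    : ∀ h → ∫dx (LCc⇒𝒞₀ h) ℂ.≈ dx h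

{-# OPTIONS --safe #-}

-- Characters of K are orthogonal on the finite quotients π⁻ᴹ𝔬/πᴺ𝔬, whose orders
-- are powers of q and hence, as p ≠ ℓ, units of 𝔬_p.  So finite Fourier
-- inversion is integral: on a compact set every continuous function is a
-- uniform limit of integral combinations of the characters χ r, and a measure
-- is determined by its transform.  Up to a given precision a measure lives on a
-- compact set, on which χ r depends only on r modulo a lattice; its transform is
-- therefore uniformly continuous.  Conversely, if g is uniformly continuous,
-- inversion at level N gives the ball ϖᴺx + πᴺ𝔬 a mass, where ϖ = π⁻¹; up to a
-- given precision these masses vanish off a fixed disc, so the resulting
-- functionals converge to a measure, and on χ ρ they converge to g ρ.
--
-- The Haar integral is the limit of Riemann sums over π⁻ᴺ𝔬/πᴺ𝔬; uniqueness
-- follows by approximating functions by combinations of indicators of balls.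

module Submission where

open import Defs
open import Level using (0ℓ) renaming (suc to lsuc)
open import Axiom.ExcludedMiddle using (ExcludedMiddle)
open import Data.Nat.Base using (ℕ)
open import Data.Nat.Primality using (Prime)
open import Data.Product.Base using (Σ; Σ-syntax; ∃-syntax; _×_)
open import Function.Bundles using (_⇔_)
open import Relation.Binary.PropositionalEquality using (_≢_)
open import Algebra.Module.Morphism.Structures using (IsLeftModuleMonomorphism)

open import Level using (lift; lower)
open import Data.Bool.Base using (if_then_else_; true; false)
open import Data.Nat.Base as ℕ using (zero; suc)
import Data.Nat.Properties as ℕ
import Data.Nat.DivMod as ℕ
import Data.Nat.ListAction as ℕ using (sum)
open import Data.Nat.Divisibility as ∣ using (_∣_)
import Data.Nat.Primality as Primality
import Data.Nat.Coprimality as Coprimality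
open import Data.Nat.GCD using (module Bézout)
open import Data.Nat.GeneralisedArithmetic using (fold)
open import Data.Nat.Solver using (module +-*-Solver)
open import Data.Integer.Base as ℤ using (ℤ; +_; -[1+_])
import Data.Integer.Properties as ℤ
import Data.Integer.DivMod as ℤ
open import Data.Rational.Base as ℚ using (ℚ; 0ℚ; 1ℚ)
import Data.Rational.Properties as ℚ
import Data.Rational.Unnormalised.Base as ℚᵘ
import Data.Rational.Unnormalised.Properties as ℚᵘ
open import Data.Fin.Base as Fin using (Fin; zero; suc)
import Data.Fin.Properties as Fin
open import Data.Fin.Permutation using (permutation)
open import Data.List.Base as List using (List; []; _∷_; length; allFin; concat)
open import Data.List.Properties using (length-tabulate)
open import Data.List.Relation.Unary.Any as Any using (Any; here; there)
import Data.List.Relation.Unary.Any.Properties as Any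
import Data.List.Membership.Propositional as List
open import Data.List.Membership.Propositional.Properties using (∈-allFin)
import Data.Maybe.Base as Maybe
open import Data.Product.Base using (_,_; proj₁; proj₂)
open import Data.Sum.Base using (inj₁; inj₂)
open import Algebra.Bundles using (CommutativeMonoid; CommutativeRing)
open import Algebra.Bundles.Raw using (RawMonoid)
open import Algebra.Apartness.Bundles using (HeytingField)
open import Algebra.Morphism.Structures using (IsRingHomomorphism)
open import Algebra.Module.Bundles.Raw using (RawLeftModule)
open import Algebra.Module.Morphism.Structures using (IsLeftModuleHomomorphism)
open import Algebra.Solver.Ring.AlmostCommutativeRing using (fromCommutativeRing; _-Raw-AlmostCommutative⟶_)
import Algebra.Solver.Ring as RingSolver
import Algebra.Definitions.RawMonoid as RawMonoidDefinitions
import Algebra.Properties.CommutativeMonoid.Sum as CommutativeMonoidSum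
import Algebra.Properties.Group as GroupProperties
import Algebra.Properties.Ring as RingProperties
import Algebra.Properties.Semiring.Exp as Exp
import Algebra.Properties.Semiring.Mult as Mult
import Algebra.Properties.Semiring.Sum as Sums
open import Function.Base using (_∘_; _∋_)
open import Function.Bundles using (Func; mk⇔; Equivalence)
open import Relation.Binary.PropositionalEquality as ≡ using (_≡_)
open import Relation.Nullary using (¬_; Dec; yes; no; does; contradiction)
open import Relation.Nullary.Construct.Add.Supremum using (⊤⁺; [_])
open import Relation.Nullary.Decidable
  using (dec⇒maybe; decidable-stable; map′; dec-true; dec-false; does-⇔)
open import Relation.Unary using (Pred)
import Relation.Binary.Reasoning.Setoid as SetoidReasoning

-- All functionals are 𝔬_p-linear on 𝔬_p-valued functions, so no denominator may ever appear; the
-- decisive fact is that q⁻¹ is integral. It holds because ℓ kills the residue field of K, so that q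
-- divides a power of ℓ. Since ℂ_p is non-archimedean, the length of a finite sum costs no precision
-- and termwise estimates suffice. Quotients never appear as such. A sum over 𝔬/π^k runs over digit
-- expansions, and representatives are not closed under addition; translation invariance has to be
-- proved with carries, and also for functions that are periodic only up to an error. The different
-- enters through one fact: x ↦ ζ^tr(x) is trivial on b𝔬 exactly when π^δ b is integral. This makes
-- the rescaled pairing on 𝔬/π^k perfect, and it fixes the disc off which the masses become
-- negligible: if g varies by at most r on cosets of π^n 𝔬, that disc is the dual lattice of π^n 𝔬,
-- namely π^(-δ-n) 𝔬. Completeness of K is derived from that of ℚ_ℓ; it provides the limit points
-- behind the compactness of discs.

-- Unlike the weak zero test of Algebra.Solver.Ring.Simple on an abstract
-- ring, integer coefficients let the solver cancel x against - x.
module IntegerSolver {c ℓ} (R : CommutativeRing c ℓ) where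
  open CommutativeRing R
  open RingProperties ring
  open Mult semiring using () renaming (_×_ to _•_; ×-homo-+ to •-homo-+; ×1-homo-* to •1-homo-*)
  open SetoidReasoning setoid

  private
    ⟦_⟧ℤ : ℤ → Carrier
    ⟦ + n ⟧ℤ      = n • 1#
    ⟦ -[1+ n ] ⟧ℤ = - (suc n • 1#)

    ⊖-homo : ∀ m n → ⟦ m ℤ.⊖ n ⟧ℤ ≈ m • 1# - n • 1#
    ⊖-homo m zero = sym (trans (+-congˡ -0#≈0#) (+-identityʳ _))
    ⊖-homo zero (suc n) = sym (+-identityˡ _)
    ⊖-homo (suc m) (suc n) = begin
      ⟦ suc m ℤ.⊖ suc n ⟧ℤ                    ≡⟨ ≡.cong ⟦_⟧ℤ (ℤ.[1+m]⊖[1+n]≡m⊖n m n) ⟩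
      ⟦ m ℤ.⊖ n ⟧ℤ                            ≈⟨ ⊖-homo m n ⟩
      m • 1# - n • 1#                         ≈⟨ +-identityˡ _ ⟨
      0# + (m • 1# - n • 1#)                  ≈⟨ +-congʳ (-‿inverseʳ 1#) ⟨
      1# - 1# + (m • 1# - n • 1#)             ≈⟨ +-assoc _ _ _ ⟩
      1# + (- 1# + (m • 1# - n • 1#))         ≈⟨ +-congˡ (+-congˡ (+-comm _ _)) ⟩
      1# + (- 1# + (- (n • 1#) + m • 1#))     ≈⟨ +-congˡ (+-assoc _ _ _) ⟨
      1# + (- 1# + - (n • 1#) + m • 1#)       ≈⟨ +-congˡ (+-congʳ (-‿+-comm _ _)) ⟩
      1# + (- (suc n • 1#) + m • 1#)          ≈⟨ +-congˡ (+-comm _ _) ⟩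
      1# + (m • 1# + - (suc n • 1#))          ≈⟨ +-assoc _ _ _ ⟨
      suc m • 1# - suc n • 1#                 ∎

    -homo : ∀ i → ⟦ ℤ.- i ⟧ℤ ≈ - ⟦ i ⟧ℤ
    -homo (+ zero)  = sym -0#≈0#
    -homo (+ suc n) = refl
    -homo -[1+ n ]  = sym (-‿involutive _)

    +-homo : ∀ i j → ⟦ i ℤ.+ j ⟧ℤ ≈ ⟦ i ⟧ℤ + ⟦ j ⟧ℤ
    +-homo (+ m) (+ n) = •-homo-+ 1# m n
    +-homo (+ m) -[1+ n ] = ⊖-homo m (suc n)
    +-homo -[1+ m ] (+ n) = trans (⊖-homo n (suc m)) (+-comm _ _)
    +-homo -[1+ m ] -[1+ n ] = begin
      - (suc (suc (m ℕ.+ n)) • 1#)             ≈⟨ -‿cong (+-congˡ (•-homo-+ 1# (suc m) n)) ⟩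
      - (1# + (suc m • 1# + n • 1#))           ≈⟨ -‿cong (+-congˡ (+-comm _ _)) ⟩
      - (1# + (n • 1# + suc m • 1#))           ≈⟨ -‿cong (+-assoc _ _ _) ⟨
      - (suc n • 1# + suc m • 1#)              ≈⟨ -‿cong (+-comm _ _) ⟩
      - (suc m • 1# + suc n • 1#)              ≈⟨ -‿+-comm _ _ ⟨
      - (suc m • 1#) - suc n • 1#              ∎

    *-homo-+ : ∀ m j → ⟦ + m ℤ.* j ⟧ℤ ≈ m • 1# * ⟦ j ⟧ℤ
    *-homo-+ m (+ n) = trans (reflexive (≡.cong ⟦_⟧ℤ (≡.sym (ℤ.pos-* m n)))) (•1-homo-* m n)
    *-homo-+ m -[1+ n ] = begin
      ⟦ + m ℤ.* -[1+ n ] ⟧ℤ         ≡⟨ ≡.cong ⟦_⟧ℤ (ℤ.neg-distribʳ-* (+ m) (+ suc n)) ⟨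
      ⟦ ℤ.- (+ m ℤ.* + suc n) ⟧ℤ    ≈⟨ -homo (+ m ℤ.* + suc n) ⟩
      - ⟦ + m ℤ.* + suc n ⟧ℤ        ≈⟨ -‿cong (*-homo-+ m (+ suc n)) ⟩
      - (m • 1# * suc n • 1#)       ≈⟨ -‿distribʳ-* _ _ ⟩
      m • 1# * - (suc n • 1#)       ∎

    *-homo : ∀ i j → ⟦ i ℤ.* j ⟧ℤ ≈ ⟦ i ⟧ℤ * ⟦ j ⟧ℤ
    *-homo (+ m) j = *-homo-+ m j
    *-homo -[1+ m ] j = begin
      ⟦ -[1+ m ] ℤ.* j ⟧ℤ           ≡⟨ ≡.cong ⟦_⟧ℤ (ℤ.neg-distribˡ-* (+ suc m) j) ⟨
      ⟦ ℤ.- (+ suc m ℤ.* j) ⟧ℤ      ≈⟨ -homo (+ suc m ℤ.* j) ⟩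
      - ⟦ + suc m ℤ.* j ⟧ℤ          ≈⟨ -‿cong (*-homo-+ (suc m) j) ⟩
      - (suc m • 1# * ⟦ j ⟧ℤ)       ≈⟨ -‿distribˡ-* _ _ ⟩
      - (suc m • 1#) * ⟦ j ⟧ℤ       ∎

    morphism : ℤ.+-*-rawRing -Raw-AlmostCommutative⟶ fromCommutativeRing R
    morphism = record
      { ⟦_⟧    = ⟦_⟧ℤ
      ; +-homo = +-homo
      ; *-homo = *-homo
      ; -‿homo = -homo
      ; 0-homo = refl
      ; 1-homo = +-identityʳ 1#
      }

  open RingSolver ℤ.+-*-rawRing (fromCommutativeRing R) morphism
    (λ i j → Maybe.map (λ eq → reflexive (≡.cong ⟦_⟧ℤ eq)) (dec⇒maybe (i ℤ.≟ j)))
    public using (solve; _:=_; con; _:+_; _:*_; _:-_; :-_)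

-- Commuting permutations and divisibility of a cardinality

-- Averaging the indicator function of a point over the cyclic group
-- generated by each σ a in turn multiplies its sum by ℓ every time and
-- ends with a constant function.
module CommutingPermutations
  (ℓ n : ℕ) .{{_ : ℕ.NonZero ℓ}} (σ : Fin n → Fin n → Fin n)
  (σ-comm : ∀ a b i → σ a (σ b i) ≡ σ b (σ a i))
  (σ-order : ∀ a i → fold i (σ a) ℓ ≡ i)
  (σ-transitive : ∀ i j → ∃[ a ] σ a i ≡ j)
  where
  open CommutativeMonoidSum ℕ.+-0-commutativeMonoid
  open ≡.≡-Reasoning

  orbitSum : Fin n → ℕ → (Fin n → ℕ) → Fin n → ℕ
  orbitSum a zero    φ i = 0
  orbitSum a (suc k) φ i = φ i ℕ.+ orbitSum a k φ (σ a i)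

  fold-comm : ∀ a k i → fold (σ a i) (σ a) k ≡ σ a (fold i (σ a) k)
  fold-comm a zero    i = ≡.refl
  fold-comm a (suc k) i = ≡.cong (σ a) (fold-comm a k i)

  -- Both sides add up `φ` along the k + 1 points i, σ a i, and so on up to the k-th iterate. For k
  -- = ℓ the two extra terms agree by `σ-order`, which leaves invariance of the orbit sum.
  orbitSum-shift : ∀ a k φ i →
    orbitSum a k φ (σ a i) ℕ.+ φ i ≡ orbitSum a k φ i ℕ.+ φ (fold i (σ a) k)
  orbitSum-shift a zero    φ i = ≡.refl
  orbitSum-shift a (suc k) φ i = begin
    φ (σ a i) ℕ.+ orbitSum a k φ (σ a (σ a i)) ℕ.+ φ i
      ≡⟨ solve 3 (λ x y z → x :+ y :+ z := z :+ (y :+ x)) ≡.refl (φ (σ a i)) _ (φ i) ⟩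
    φ i ℕ.+ (orbitSum a k φ (σ a (σ a i)) ℕ.+ φ (σ a i))
      ≡⟨ ≡.cong (φ i ℕ.+_) (orbitSum-shift a k φ (σ a i)) ⟩
    φ i ℕ.+ (orbitSum a k φ (σ a i) ℕ.+ φ (fold (σ a i) (σ a) k))
      ≡⟨ ≡.cong (λ j → φ i ℕ.+ (orbitSum a k φ (σ a i) ℕ.+ φ j)) (fold-comm a k i) ⟩
    φ i ℕ.+ (orbitSum a k φ (σ a i) ℕ.+ φ (σ a (fold i (σ a) k)))
      ≡⟨ ℕ.+-assoc (φ i) _ _ ⟨
    φ i ℕ.+ orbitSum a k φ (σ a i) ℕ.+ φ (σ a (fold i (σ a) k)) ∎
    where open +-*-Solver

  orbitSum-invariant : ∀ a φ i → orbitSum a ℓ φ (σ a i) ≡ orbitSum a ℓ φ i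
  orbitSum-invariant a φ i = ℕ.+-cancelʳ-≡ (φ i) _ _
    (≡.trans (orbitSum-shift a ℓ φ i) (≡.cong (λ j → orbitSum a ℓ φ i ℕ.+ φ j) (σ-order a i)))

  -- Commutativity lets invariance under `σ b` survive the averaging over `σ a`, so that invariance
  -- accumulates along a list of permutations.
  orbitSum-preserves : ∀ a b k φ → (∀ i → φ (σ b i) ≡ φ i) →
    ∀ i → orbitSum a k φ (σ b i) ≡ orbitSum a k φ i
  orbitSum-preserves a b zero    φ inv i = ≡.refl
  orbitSum-preserves a b (suc k) φ inv i = ≡.cong₂ ℕ._+_ (inv i)
    (≡.trans (≡.cong (orbitSum a k φ) (σ-comm a b i)) (orbitSum-preserves a b k φ inv (σ a i)))

  sum-σ : ∀ a φ → sum (λ i → φ (σ a i)) ≡ sum φ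
  sum-σ a φ = ≡.sym (sum-permute φ (permutation (σ a) (λ i → fold i (σ a) (ℕ.pred ℓ))
    (λ i → inverse ℓ (σ-order a) i) (λ i → ≡.trans (fold-comm′ i) (inverse ℓ (σ-order a) i))))
    where
    inverse : ∀ ℓ .{{_ : ℕ.NonZero ℓ}} → (∀ i → fold i (σ a) ℓ ≡ i) → ∀ i →
        σ a (fold i (σ a) (ℕ.pred ℓ)) ≡ i
    inverse (suc _) e i = e i
    fold-comm′ : ∀ i → fold (σ a i) (σ a) (ℕ.pred ℓ) ≡ σ a (fold i (σ a) (ℕ.pred ℓ))
    fold-comm′ = fold-comm a (ℕ.pred ℓ)

  sum-orbitSum : ∀ a k φ → sum (orbitSum a k φ) ≡ k ℕ.* sum φ
  sum-orbitSum a zero    φ = sum-replicate-zero n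
  sum-orbitSum a (suc k) φ = begin
    sum (λ i → φ i ℕ.+ orbitSum a k φ (σ a i))           ≡⟨ ∑-distrib-+ φ _ ⟩
    sum φ ℕ.+ sum (λ i → orbitSum a k φ (σ a i))
        ≡⟨ ≡.cong (sum φ ℕ.+_) (sum-σ a (orbitSum a k φ)) ⟩
    sum φ ℕ.+ sum (orbitSum a k φ)
        ≡⟨ ≡.cong (sum φ ℕ.+_) (sum-orbitSum a k φ) ⟩
    sum φ ℕ.+ k ℕ.* sum φ                                ∎

  orbitSums : (Fin n → ℕ) → List (Fin n) → Fin n → ℕ
  orbitSums φ []       = φ
  orbitSums φ (a ∷ as) = orbitSum a ℓ (orbitSums φ as)

  sum-orbitSums : ∀ φ as → sum (orbitSums φ as) ≡ ℓ ℕ.^ length as ℕ.* sum φ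
  sum-orbitSums φ []       = ≡.sym (ℕ.*-identityˡ _)
  sum-orbitSums φ (a ∷ as) = ≡.trans (sum-orbitSum a ℓ _)
    (≡.trans (≡.cong (ℓ ℕ.*_) (sum-orbitSums φ as)) (≡.sym (ℕ.*-assoc ℓ (ℓ ℕ.^ length as) _)))

  orbitSums-invariant : ∀ φ as {a} → a List.∈ as → ∀ i → orbitSums φ as (σ a i) ≡ orbitSums φ as i
  orbitSums-invariant φ (a ∷ as) (here ≡.refl) i = orbitSum-invariant a _ i
  orbitSums-invariant φ (a ∷ as) (there a∈) i =
    orbitSum-preserves a _ ℓ _ (orbitSums-invariant φ as a∈) i

  δ : Fin n → Fin n → ℕ
  δ i j = if does (i Fin.≟ j) then 1 else 0

  sum-δ : ∀ {m} (i : Fin m) → sum (λ j → if does (i Fin.≟ j) then 1 else 0) ≡ 1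
  sum-δ {suc m} zero    = ≡.cong suc (sum-replicate-zero m)
  sum-δ {suc m} (suc i) = sum-δ i

  -- Transitivity makes the fully averaged function constant, and its total is ℓ^n times the total 1
  -- of the point mass. The exponent merely counts the averagings, one for each index; only the
  -- prime divisors of the cardinality matter later.
  cardinality-∣ : Fin n → n ∣ ℓ ℕ.^ n
  cardinality-∣ i = ∣.divides (φ i) (begin
    ℓ ℕ.^ n
        ≡⟨ ≡.cong (ℓ ℕ.^_) (length-tabulate {n = n} (λ j → j)) ⟨
    ℓ ℕ.^ length (allFin n)                       ≡⟨ ℕ.*-identityʳ _ ⟨
    ℓ ℕ.^ length (allFin n) ℕ.* 1
        ≡⟨ ≡.cong (ℓ ℕ.^ length (allFin n) ℕ.*_) (sum-δ i) ⟨
    ℓ ℕ.^ length (allFin n) ℕ.* sum (δ i)         ≡⟨ sum-orbitSums (δ i) (allFin n) ⟨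
    sum φ                                         ≡⟨ sum-cong-≗ (λ j → constant j) ⟩
    sum (λ (_ : Fin n) → φ i)                     ≡⟨ sum-const n (φ i) ⟩
    n ℕ.* φ i                                     ≡⟨ ℕ.*-comm n (φ i) ⟩
    φ i ℕ.* n                                     ∎)
    where
    φ : Fin n → ℕ
    φ = orbitSums (δ i) (allFin n)
    constant : ∀ j → φ j ≡ φ i
    constant j with σ-transitive i j
    ... | a , ≡.refl = orbitSums-invariant (δ i) (allFin n) (∈-allFin a) i
    sum-const : ∀ m c → sum (λ (_ : Fin m) → c) ≡ m ℕ.* c
    sum-const zero    c = ≡.refl
    sum-const (suc m) c = ≡.cong (c ℕ.+_) (sum-const m c)

-- Rational numbers and valuations in `ℚ∞`

open Mult (CommutativeRing.semiring ℚ.+-*-commutativeRing)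
  public using () renaming (_×_ to infixr 8 _ℚ•_; ×-assoc-* to •-assoc-*)

fromℕ : ℕ → ℚ
fromℕ n = ℚ.mkℚ (+ n) 0 (Coprimality.sym (Coprimality.1-coprimeTo n))

•1≡fromℕ : ∀ n → n ℚ• 1ℚ ≡ fromℕ n
•1≡fromℕ zero    = ≡.refl
•1≡fromℕ (suc n) = ≡.trans (≡.cong (1ℚ ℚ.+_) (•1≡fromℕ n)) (ℚ.toℚᵘ-injective
  (ℚᵘ.≃-trans (ℚ.toℚᵘ-homo-+ 1ℚ (fromℕ n)) (ℚᵘ.*≡*
      (≡.cong (λ m → (+ 1 ℤ.+ m) ℤ.* + 1) (ℤ.*-identityʳ (+ n))))))

•≡fromℕ-* : ∀ n r → n ℚ• r ≡ fromℕ n ℚ.* r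
•≡fromℕ-* n r = begin
  n ℚ• r                  ≡⟨ ≡.cong (n ℚ•_) (ℚ.*-identityˡ r) ⟨
  n ℚ• (1ℚ ℚ.* r)         ≡⟨ •-assoc-* n 1ℚ r ⟨
  n ℚ• 1ℚ ℚ.* r           ≡⟨ ≡.cong (ℚ._* r) (•1≡fromℕ n) ⟩
  fromℕ n ℚ.* r          ∎
  where open ≡.≡-Reasoning

p≤∣↥p∣ : ∀ p → p ℚ.≤ fromℕ ℤ.∣ ℚ.↥ p ∣
p≤∣↥p∣ p@(ℚ.mkℚ (+ n) d _) = ℚ.*≤* (ℤ.*-monoˡ-≤-nonNeg (+ n) (ℤ.+≤+ (ℕ.s≤s ℕ.z≤n)))
p≤∣↥p∣ p@(ℚ.mkℚ -[1+ n ] d _) = ℚ.*≤* ℤ.-≤+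

-- A fraction is at most the absolute value of its numerator, so the numerator of r / ρ gives a
-- sufficient multiple of ρ.
archimedean : ∀ r {ρ} → 0ℚ ℚ.< ρ → ∃[ n ] r ℚ.≤ n ℚ• ρ
archimedean r {ρ} 0<ρ = n , (begin
  r                        ≡⟨ ℚ.*-identityʳ r ⟨
  r ℚ.* 1ℚ                 ≡⟨ ≡.cong (r ℚ.*_) (ℚ.*-inverseˡ ρ) ⟨
  r ℚ.* (1/ρ ℚ.* ρ)        ≡⟨ ℚ.*-assoc r 1/ρ ρ ⟨
  r ℚ.* 1/ρ ℚ.* ρ          ≤⟨ ℚ.*-monoʳ-≤-nonNeg ρ (p≤∣↥p∣ (r ℚ.* 1/ρ)) ⟩
  fromℕ n ℚ.* ρ            ≡⟨ •≡fromℕ-* n ρ ⟨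
  n ℚ• ρ                    ∎)
  where
  open ℚ.≤-Reasoning
  instance
    ρ-positive : ℚ.Positive ρ
    ρ-positive = ℚ.positive 0<ρ
    ρ-nonNegative : ℚ.NonNegative ρ
    ρ-nonNegative = ℚ.pos⇒nonNeg ρ
    ρ-nonZero : ℚ.NonZero ρ
    ρ-nonZero = ℚ.pos⇒nonZero ρ
  1/ρ : ℚ
  1/ρ = ℚ.1/ ρ
  n : ℕ
  n = ℤ.∣ ℚ.↥ (r ℚ.* 1/ρ) ∣

fromℕ-mono : ∀ {m n} → m ℕ.≤ n → fromℕ m ℚ.≤ fromℕ n
fromℕ-mono {m} {n} m≤n = ℚ.*≤* (ℤ.*-monoʳ-≤-nonNeg (+ 1) (ℤ.+≤+ m≤n))

Classical : Set₁
Classical = {P : Set} → Dec P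

classical : ExcludedMiddle (lsuc 0ℓ) → Classical
classical em = map′ lower lift em

¬∀⇒∃¬ : Classical → ∀ {A : Set} {P : A → Set} → ¬ (∀ x → P x) → ∃[ x ] ¬ P x
¬∀⇒∃¬ em ¬∀ with em
... | yes p = p
... | no ¬p = contradiction (λ x → decidable-stable em (λ ¬Px → ¬p (x , ¬Px))) ¬∀

≰∞⇒≥ : ∀ {a b} → ¬ a ≤∞ b → b ≤∞ a
≰∞⇒≥ {a} {b} a≰b with ≤∞-total a b
... | inj₁ a≤b = contradiction a≤b a≰b
... | inj₂ b≤a = b≤a

≡⇒≤∞ : ∀ {a b} → a ≡ b → a ≤∞ b
≡⇒≤∞ ≡.refl = ≤∞-refl

unbounded⇒⊤ : ∀ {a} → (∀ r → [ r ] ≤∞ a) → a ≡ ⊤⁺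
unbounded⇒⊤ {⊤⁺} _ = ≡.refl
unbounded⇒⊤ {[ s ]} p with p (s ℚ.+ 1ℚ)
... | [ q ] = contradiction (ℚ.<-≤-trans (≡.subst (ℚ._< s ℚ.+ 1ℚ) (ℚ.+-identityʳ s)
  (ℚ.+-monoʳ-< s (ℚ.positive⁻¹ 1ℚ))) q) (ℚ.<-irrefl ≡.refl)

+∞-comm : ∀ a b → a +∞ b ≡ b +∞ a
+∞-comm [ r ] [ s ] = ≡.cong (ℚ∞ ∋_) (≡.cong [_] (ℚ.+-comm r s))
+∞-comm [ r ] ⊤⁺    = ≡.refl
+∞-comm ⊤⁺    [ s ] = ≡.refl
+∞-comm ⊤⁺    ⊤⁺    = ≡.refl

unbracket : ∀ {r s : ℚ} → _≡_ {A = ℚ∞} [ r ] [ s ] → r ≡ s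
unbracket ≡.refl = ≡.refl

[]-cong : ∀ {r s : ℚ} → r ≡ s → _≡_ {A = ℚ∞} [ r ] [ s ]
[]-cong = ≡.cong [_]

-- For c = ⊤⁺ the factor is zero, so any bound will do and 0 is only a default; otherwise r - c is
-- the precision that a factor of valuation c turns into r.
scale : ∀ c r → ∃[ s ] ∀ {a} → [ s ] ≤∞ a → [ r ] ≤∞ c +∞ a
scale ⊤⁺    r = 0ℚ , λ _ → _ ≤⊤⁺
scale [ c ] r = r ℚ.- c , λ {a} p →
  ≡.subst (_≤∞ [ c ] +∞ a) ([]-cong eq) (+∞-mono (≤∞-refl {[ c ]}) p)
  where
  eq : c ℚ.+ (r ℚ.- c) ≡ r
  eq = ≡.trans (ℚ.+-comm c _) (//-rightDividesˡ c r)
    where open GroupProperties ℚ.+-0-group using (//-rightDividesˡ)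

-- Inverses, valuations and limits in a valued field

Inverses : (K : ValuedField) → ValuedField.Carrier K → ValuedField.Carrier K → Set
Inverses K x y = x * y ≈ 1#
  where open ValuedField K

module ValuedFieldProperties (em : Classical) (K : ValuedField) where
  open ValuedField K hiding (zero)
  open IntegerSolver commutativeRing
  private module H = HeytingField heytingField
  open SetoidReasoning setoid

  -- In the trivial ring 0 - 0 would be invertible, which makes 0 apart from itself.
  1≉0 : ¬ 1# ≈ 0#
  1≉0 1≈0 = H.#-irrefl {0#} refl (H.invertible⇒# (1# , all≈ _ _ , all≈ _ _))
    where
    all≈0 : ∀ x → x ≈ 0#
    all≈0 x = trans (sym (*-identityˡ x)) (trans (*-congʳ 1≈0) (zeroˡ x))
    all≈ : ∀ x y → x ≈ y
    all≈ x y = trans (all≈0 x) (sym (all≈0 y))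

  -- Tightness and excluded middle turn inequality into apartness from 0, which is what yields
  -- inverses in a Heyting field.
  inverse : ∀ {x} → ¬ x ≈ 0# → ∃[ y ] x * y ≈ 1#
  inverse {x} x≉0 with decidable-stable em (λ ¬# → x≉0 (proj₁ (H.tight _ _) ¬#))
  ... | x#0 with H.#⇒invertible x#0
  ... | y , _ , eq = y , trans (*-congʳ (solve 1 (λ x → x := x :- con (+ 0)) refl x)) eq

  v-1 : v 1# ≡ 0∞
  v-1 with v 1# in eq | 1-integral
  ... | ⊤⁺    | _ = contradiction (Equivalence.to (v≡∞ 1#) eq) 1≉0
  ... | [ r ] | [ 0≤r ] = ≤∞-antisym (lemma (≡.trans (≡.sym (v-* 1# 1#)) (v-cong (*-identityˡ 1#))))
      [ 0≤r ]
    where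
    lemma : v 1# +∞ v 1# ≡ v 1# → [ r ] ≤∞ 0∞
    lemma e rewrite eq = ≡⇒≤∞ ([]-cong (identityʳ-unique r r (unbracket e)))
      where
      open GroupProperties ℚ.+-0-group using (identityʳ-unique)

  v-inverse : ∀ {x y} → x * y ≈ 1# → v x +∞ v y ≡ 0∞
  v-inverse eq = ≡.trans (≡.sym (v-* _ _)) (≡.trans (v-cong eq) v-1)

  invertible⇒≉0 : ∀ {x y} → x * y ≈ 1# → ¬ x ≈ 0#
  invertible⇒≉0 xy≈1 x≈0 = 1≉0 (trans (sym xy≈1) (trans (*-congʳ x≈0) (zeroˡ _)))

  *-cancel-0 : ∀ {x y} → x * y ≈ 0# → ¬ x ≈ 0# → y ≈ 0#
  *-cancel-0 {x} {y} xy≈0 x≉0 with inverse x≉0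
  ... | z , xz≈1 = begin
    y            ≈⟨ *-identityˡ y ⟨
    1# * y       ≈⟨ *-congʳ xz≈1 ⟨
    x * z * y    ≈⟨ solve 3 (λ x y z → x :* z :* y := z :* (x :* y)) refl x y z ⟩
    z * (x * y)  ≈⟨ *-congˡ xy≈0 ⟩
    z * 0#       ≈⟨ zeroʳ z ⟩
    0#           ∎

  v-finite : ∀ {x} → ¬ x ≈ 0# → ∃[ r ] v x ≡ [ r ]
  v-finite {x} x≉0 with v x in eq
  ... | ⊤⁺    = contradiction (Equivalence.to (v≡∞ x) eq) x≉0
  ... | [ r ] = r , ≡.refl

  ≈0⇒≤v : ∀ {a x} → x ≈ 0# → a ≤∞ v x
  ≈0⇒≤v x≈0 = ≡.subst (_ ≤∞_) (≡.sym (≡.trans (v-cong x≈0) v-0)) (_ ≤⊤⁺)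

  ≤v-cong : ∀ {a x y} → x ≈ y → a ≤∞ v x → a ≤∞ v y
  ≤v-cong x≈y = ≡.subst (_ ≤∞_) (v-cong x≈y)

  v-*-mono : ∀ {a b} x y → a ≤∞ v x → b ≤∞ v y → a +∞ b ≤∞ v (x * y)
  v-*-mono x y p q = ≡.subst (_ ≤∞_) (≡.sym (v-* x y)) (+∞-mono p q)

  v-*≥ˡ : ∀ c {x} → Integral x → v c ≤∞ v (c * x)
  v-*≥ˡ c {x} ix = ≤v-cong (*-comm x c) (v-*ˡ x c ix ≤∞-refl)

  v-+-neg : ∀ {a} x y → a ≤∞ v x → a ≤∞ v y → a ≤∞ v (x - y)
  v-+-neg x y p q = v-+-min x (- y) p (v-neg y q)

  ≤v⇒∣ : ∀ {c d x} → c * d ≈ 1# → v c ≤∞ v x → ∃[ y ] Integral y × x ≈ c * y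
  ≤v⇒∣ {c} {d} {x} cd≈1 c≤x = d * x ,
    ≡.subst (_≤∞ v (d * x)) (≡.trans (+∞-comm (v d) (v c)) (v-inverse cd≈1))
        (v-*-mono d x ≤∞-refl c≤x) ,
    (begin
      x            ≈⟨ *-identityˡ x ⟨
      1# * x       ≈⟨ *-congʳ cd≈1 ⟨
      c * d * x    ≈⟨ *-assoc c d x ⟩
      c * (d * x)  ∎)

  inverse-cancelˡ : ∀ {a b} x → a * b ≈ 1# → a * (b * x) ≈ x
  inverse-cancelˡ {a} {b} x ab≈1 = trans (sym (*-assoc a b x))
      (trans (*-congʳ ab≈1) (*-identityˡ x))

  v-*-monoʳ : ∀ c {x y} → v x ≤∞ v y → v (c * x) ≤∞ v (c * y)
  v-*-monoʳ c {x} {y} le = ≡.subst₂ _≤∞_ (≡.sym (v-* c x)) (≡.sym (v-* c y))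
      (+∞-mono (≤∞-refl {v c}) le)

  v-*-cancel : ∀ {c d} x y → c * d ≈ 1# → v (c * x) ≤∞ v (c * y) → v x ≤∞ v y
  v-*-cancel {c} {d} x y cd≈1 le =
    ≡.subst₂ _≤∞_ (v-cong (inverse-cancelˡ x dc≈1)) (v-cong (inverse-cancelˡ y dc≈1))
        (v-*-monoʳ d le)
    where
    dc≈1 : d * c ≈ 1#
    dc≈1 = trans (*-comm d c) cd≈1

  v-^ : ∀ {x r} → v x ≡ [ r ] → ∀ n → v (x ^ n) ≡ [ n ℚ• r ]
  v-^ eq zero    = v-1
  v-^ {x} eq (suc n) = ≡.trans (v-* x (x ^ n)) (≡.cong₂ _+∞_ eq (v-^ eq n))

  -‿≈0⇒≈ : ∀ {x y} → (∀ r → [ r ] ≤∞ v (x - y)) → x ≈ y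
  -‿≈0⇒≈ {x} {y} p = x∙y⁻¹≈ε⇒x≈y x y (Equivalence.to (v≡∞ (x - y)) (unbounded⇒⊤ p))

  ⟶-unique : ∀ {u x y} → u ⟶ x → u ⟶ y → x ≈ y
  ⟶-unique {u} {x} {y} ux uy = -‿≈0⇒≈ λ r →
    let M , p = ux r
        N , q = uy r
    in v-trans x (u (M ℕ.⊔ N)) y (v-swap _ _ (p _ (ℕ.m≤m⊔n M N))) (q _ (ℕ.m≤n⊔m M N))

  ⟶-const : ∀ x → (λ _ → x) ⟶ x
  ⟶-const x r = 0 , λ _ _ → v-≈ x x refl

  ⟶-cong : ∀ {u w x} → (∀ n → u n ≈ w n) → u ⟶ x → w ⟶ x
  ⟶-cong {u} {w} {x} eq ux r = let N , p = ux r in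
    N , λ n N≤n → v-trans (w n) (u n) x (v-≈ _ _ (sym (eq n))) (p n N≤n)

  ⟶-+ : ∀ {u w x y} → u ⟶ x → w ⟶ y → (λ n → u n + w n) ⟶ (x + y)
  ⟶-+ ux wy r = let M , p = ux r ; N , q = wy r in
    M ℕ.⊔ N , λ n le → v-+-diff _ _ _ _ (p n (ℕ.m⊔n≤o⇒m≤o M N le)) (q n (ℕ.m⊔n≤o⇒n≤o M N le))

  ⟶-neg : ∀ {u x} → u ⟶ x → (λ n → - u n) ⟶ (- x)
  ⟶-neg ux r = let M , p = ux r in M , λ n le → v-neg-diff _ _ (p n le)

  ⟶-* : ∀ {u x} c → u ⟶ x → (λ n → c * u n) ⟶ (c * x)
  ⟶-* {u} {x} c ux r = let s , near = scale (v c) r ; M , p = ux s in M , λ n le →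
    ≤v-cong (x[y-z]≈xy-xz c (u n) x) (≡.subst (_ ≤∞_) (≡.sym (v-* c _)) (near (p n le)))

  ⟶-bound : ∀ {u x a} N → (∀ n → N ℕ.≤ n → [ a ] ≤∞ v (u n)) → u ⟶ x → [ a ] ≤∞ v x
  ⟶-bound {u} {x} {a} N p ux = let M , q = ux a ; n = M ℕ.⊔ N in
    ≤v-cong (solve 2 (λ x y → x :- (x :- y) := y) refl (u n) x)
      (v-+-neg (u n) (u n - x) (p n (ℕ.m≤n⊔m M N)) (q n (ℕ.m≤m⊔n M N)))

  ⟶⇒Cauchy : ∀ {u x} → u ⟶ x → Cauchy u
  ⟶⇒Cauchy ux r = let N , p = ux r in N , λ m n N≤m N≤n →
    v-trans _ _ _ (p m N≤m) (v-swap _ _ (p n N≤n))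

-- Completeness of finite extensions

-- A finite-dimensional space over a complete field is complete: a vector b
-- outside a complete subspace W has positive distance from W, so that the
-- b-coordinates of a Cauchy sequence in W + F b form a Cauchy sequence.
module FiniteExtensionComplete (em : Classical) {F : ValuedField}
    (complete : ValuedField.Complete F)
  (K : FiniteExtension F) where
  open FiniteExtension K
  open ValuedField valuedField hiding (zero)
  open ValuedFieldProperties em valuedField
  open IntegerSolver commutativeRing
  private
    module F = ValuedField F
    module FP = ValuedFieldProperties em F
    open IsEmbedding isEmbedding
    open IsRingHomomorphism isRingHomomorphism

  record Subspace : Set₁ where
    field
      W      : Pred Carrier 0ℓ
      W-resp : ∀ {x y} → x ≈ y → W x → W y
      W-0    : W 0#
      W-+    : ∀ {x y} → W x → W y → W (x + y)
      W-*    : ∀ c {x} → W x → W (ι c * x)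

    W-neg : ∀ {x} → W x → W (- x)
    W-neg {x} wx = W-resp (trans (*-congʳ (trans (-‿homo F.1#) (-‿cong 1#-homo))) (-1*x≈-x x))
        (W-* (F.- F.1#) wx)

  open Subspace

  ι-- : ∀ c d → ι (c F.- d) ≈ ι c - ι d
  ι-- c d = trans (+-homo c (F.- d)) (+-congˡ (-‿homo d))

  CompleteSubspace : Subspace → Set
  CompleteSubspace S = ∀ u → (∀ n → W S (u n)) → Cauchy u → ∃[ x ] W S x × u ⟶ x

  zeroSubspace : Subspace
  zeroSubspace = record
    { W = _≈ 0# ; W-resp = λ x≈y x≈0 → trans (sym x≈y) x≈0 ; W-0 = refl
    ; W-+ = λ p q → trans (+-cong p q) (+-identityˡ 0#) ; W-* = λ c p →
        trans (*-congˡ p) (zeroʳ _) }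

  zeroSubspace-complete : CompleteSubspace zeroSubspace
  zeroSubspace-complete u u≈0 _ = 0# , refl , ⟶-cong (λ n → sym (u≈0 n)) (⟶-const 0#)

  adjoin : Carrier → Subspace → Subspace
  adjoin b S = record
    { W = λ x → ∃[ c ] ∃[ w ] W S w × x ≈ ι c * b + w
    ; W-resp = λ { x≈y (c , w , ww , eq) → c , w , ww , trans (sym x≈y) eq }
    ; W-0 = F.0# , 0# , W-0 S , sym (trans (+-identityʳ _) (trans (*-congʳ 0#-homo) (zeroˡ b)))
    ; W-+ = λ { (c , w , ww , e) (c′ , w′ , ww′ , e′) → c F.+ c′ , w + w′ , W-+ S ww ww′ ,
        trans (+-cong e e′) (trans (solve 5 (λ c b w c′ w′ → (c :* b :+ w) :+ (c′ :* b :+ w′) :=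
          (c :+ c′) :* b :+ (w :+ w′)) refl (ι c) b w (ι c′) w′)
              (+-congʳ (*-congʳ (sym (+-homo c c′))))) }
    ; W-* = λ { d (c , w , ww , e) → d F.* c , ι d * w , W-* S d ww ,
        trans (*-congˡ e) (trans (solve 4 (λ d c b w → d :* (c :* b :+ w) := d :* c :* b :+ d :* w)
            refl (ι d) (ι c) b w)
          (+-congʳ (*-congʳ (sym (*-homo d c))))) }
    }

  -- Otherwise elements of W would come within every precision of b and form a sequence converging
  -- to b; completeness and uniqueness of limits would then put b into W.
  distance : ∀ b S → CompleteSubspace S → ¬ W S b → ∃[ r ] ∀ w → W S w → ¬ [ r ] ≤∞ v (b - w)
  distance b S complete b∉W = decidable-stable em λ far →
    let close : ∀ r → ∃[ w ] W S w × [ r ] ≤∞ v (b - w)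
        close r = decidable-stable em λ no-w → far (r , λ w ww p → no-w (w , ww , p))
        w : ℕ → Carrier
        w n = proj₁ (close (fromℕ n))
        x , Wx , w⟶x = complete w (λ n → proj₁ (proj₂ (close (fromℕ n)))) (⟶⇒Cauchy (w⟶b close))
    in b∉W (W-resp S (⟶-unique w⟶x (w⟶b close)) Wx)
    where
    w⟶b : (close : ∀ r → ∃[ w ] W S w × [ r ] ≤∞ v (b - w)) → (λ n → proj₁ (close (fromℕ n))) ⟶ b
    w⟶b close r = ℤ.∣ ℚ.↥ r ∣ , λ n le → v-swap _ _ (≤∞-trans
      [ ℚ.≤-trans (p≤∣↥p∣ r) (fromℕ-mono le) ] (proj₂ (proj₂ (close (fromℕ n)))))

  scaled-difference : ∀ {c d} b w → d F.* c F.≈ F.1# → ι d * (ι c * b + w) ≈ b - (- (ι d * w))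
  scaled-difference {c} {d} b w dc≈1 = begin
    ι d * (ι c * b + w)          ≈⟨ solve 4 (λ d c b w → d :* (c :* b :+ w) :=
        d :* c :* b :- (:- (d :* w))) refl (ι d) (ι c) b w ⟩
    ι d * ι c * b - - (ι d * w)  ≈⟨ +-congʳ (*-congʳ
        (trans (sym (*-homo d c)) (trans (⟦⟧-cong dc≈1) 1#-homo))) ⟩
    1# * b - - (ι d * w)         ≈⟨ +-congʳ (*-identityˡ b) ⟩
    b - - (ι d * w)              ∎
    where open SetoidReasoning setoid

  neg-≤∞ : ∀ {a b} s → a ≤∞ [ s ] → a +∞ b ≡ 0∞ → [ ℚ.- s ] ≤∞ b
  neg-≤∞ {[ a ]} {[ b ]} s [ a≤s ] eq =
    [ ≡.subst (ℚ.- s ℚ.≤_) (≡.sym (inverseʳ-unique a b (unbracket eq))) (ℚ.neg-antimono-≤ a≤s) ]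
    where open GroupProperties ℚ.+-0-group using (inverseʳ-unique)

  -- If the bound on c failed, dividing ι c * b + w by ι c would give b - w′ with w′ in W and
  -- valuation at least -s + (s + r) = r, contradicting the distance of b from W.
  coordinate-bound : ∀ S b r → (∀ w → W S w → ¬ [ r ] ≤∞ v (b - w)) →
    ∀ s c w → W S w → [ s ℚ.+ r ] ≤∞ v (ι c * b + w) → [ s ] ≤∞ F.v c
  coordinate-bound S b r far s c w ww h with em {[ s ] ≤∞ F.v c}
  ... | yes s≤c = s≤c
  ... | no s≰c with FP.inverse {c} (λ c≈0 → s≰c (FP.≈0⇒≤v c≈0))
  ... | d , cd≈1 = contradiction (≤v-cong (scaled-difference b w
      (F.trans (F.*-comm d c) cd≈1)) bound)
                                 (far (- (ι d * w)) (W-neg S (W-* S d ww)))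
    where
    open GroupProperties ℚ.+-0-group using (\\-leftDividesʳ)
    bound : [ r ] ≤∞ v (ι d * (ι c * b + w))
    bound = ≡.subst (_≤∞ v (ι d * (ι c * b + w))) ([]-cong (\\-leftDividesʳ s r))
      (v-*-mono {[ ℚ.- s ]} {[ s ℚ.+ r ]} (ι d) (ι c * b + w)
        (≡.subst ([ ℚ.- s ] ≤∞_) (≡.sym (isometric d)) (neg-≤∞ s (≰∞⇒≥ s≰c) (FP.v-inverse cd≈1))) h)

  module _ (S : Subspace) (complete-S : CompleteSubspace S) (b : Carrier)
    (r : ℚ) (far : ∀ w → W S w → ¬ [ r ] ≤∞ v (b - w))
    (u : ℕ → Carrier) (cauchy : Cauchy u)
    (c : ℕ → F.Carrier) (w : ℕ → Carrier) (w∈ : ∀ n → W S (w n))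
    (u≈ : ∀ n → u n ≈ ι (c n) * b + w n)
    where

    coordinates-cauchy : F.Cauchy c
    coordinates-cauchy s = let N , p = cauchy (s ℚ.+ r) in N , λ m n N≤m N≤n →
      coordinate-bound S b r far s (c m F.- c n) (w m - w n) (W-+ S (w∈ m) (W-neg S (w∈ n)))
        (≤v-cong (difference m n) (p m n N≤m N≤n))
      where
      difference : ∀ m n → u m - u n ≈ ι (c m F.- c n) * b + (w m - w n)
      difference m n = begin
        u m - u n
            ≈⟨ +-cong (u≈ m) (-‿cong (u≈ n)) ⟩
        ι (c m) * b + w m - (ι (c n) * b + w n)                    ≈⟨ solve 5 (λ c b w c′ w′ →
          (c :* b :+ w) :- (c′ :* b :+ w′) := (c :- c′) :* b :+ (w :- w′))
              refl (ι (c m)) b (w m) (ι (c n)) (w n) ⟩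
        (ι (c m) - ι (c n)) * b + (w m - w n)
            ≈⟨ +-congʳ (*-congʳ (ι-- (c m) (c n))) ⟨
        ι (c m F.- c n) * b + (w m - w n)                          ∎
        where open SetoidReasoning setoid

    private
      c∞ : F.Carrier
      c∞ = proj₁ (complete c coordinates-cauchy)

      c⟶ : (λ n → ι (c n) * b) ⟶ (ι c∞ * b)
      c⟶ = ⟶-cong (λ n → *-comm _ _) (⟶-cong′ (⟶-* b ι⟶))
        where
        ι⟶ : (λ n → ι (c n)) ⟶ ι c∞
        ι⟶ s = let N , p = proj₂ (complete c coordinates-cauchy) s in N , λ n N≤n →
          ≤v-cong (ι-- (c n) c∞) (≡.subst ([ s ] ≤∞_) (≡.sym (isometric _)) (p n N≤n))
        ⟶-cong′ : ∀ {u} → u ⟶ (b * ι c∞) → u ⟶ (ι c∞ * b)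
        ⟶-cong′ u⟶ s = let N , p = u⟶ s in N , λ n N≤n →
            v-trans _ _ _ (p n N≤n) (v-≈ _ _ (*-comm _ _))

      w-cauchy : Cauchy w
      w-cauchy s = let N , p = cauchy s ; M , q = ⟶⇒Cauchy c⟶ s in
        N ℕ.⊔ M , λ m n le le′ → ≤v-cong (difference m n)
          (v-+-neg _ _ (p m n (ℕ.m⊔n≤o⇒m≤o N M le) (ℕ.m⊔n≤o⇒m≤o N M le′))
            (q m n (ℕ.m⊔n≤o⇒n≤o N M le) (ℕ.m⊔n≤o⇒n≤o N M le′)))
        where
        difference : ∀ m n → (u m - u n) - (ι (c m) * b - ι (c n) * b) ≈ w m - w n
        difference m n = trans (+-congʳ (+-cong (u≈ m) (-‿cong (u≈ n))))
          (solve 4 (λ x w x′ w′ → ((x :+ w) :- (x′ :+ w′)) :- (x :- x′) := w :- w′) refl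
            (ι (c m) * b) (w m) (ι (c n) * b) (w n))

    limit-in-adjoin : ∃[ x ] W (adjoin b S) x × u ⟶ x
    limit-in-adjoin = let w∞ , W∞ , w⟶ = complete-S w w∈ w-cauchy in
      ι c∞ * b + w∞ , (c∞ , w∞ , W∞ , refl) , ⟶-cong (λ n → sym (u≈ n)) (⟶-+ c⟶ w⟶)

  adjoin-complete : ∀ b S → CompleteSubspace S → CompleteSubspace (adjoin b S)
  adjoin-complete b S complete-S u u∈ cauchy with em {W S b}
  ... | no b∉W = let r , far = distance b S complete-S b∉W in
    limit-in-adjoin S complete-S b r far u cauchy (λ n → proj₁ (u∈ n)) (λ n → proj₁ (proj₂ (u∈ n)))
      (λ n → proj₁ (proj₂ (proj₂ (u∈ n)))) (λ n → proj₂ (proj₂ (proj₂ (u∈ n))))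
  -- Here b has no positive distance from W, but the enlarged subspace is W itself; the limit is
  -- taken in W and gets b-coordinate 0.
  ... | yes b∈W = let x , Wx , ux = complete-S u u∈S cauchy in
    x , (F.0# , x , Wx , sym (trans (+-congʳ (trans (*-congʳ 0#-homo) (zeroˡ b))) (+-identityˡ x)))
        , ux
    where
    u∈S : ∀ n → W S (u n)
    u∈S n = let c , w , ww , e = u∈ n in W-resp S (sym e) (W-+ S (W-* S c b∈W) ww)

  spanned : ∀ {n} → (Fin n → Carrier) → Subspace
  spanned {zero}  b = zeroSubspace
  spanned {suc n} b = adjoin (b zero) (spanned (b ∘ suc))

  spanned-complete : ∀ {n} (b : Fin n → Carrier) → CompleteSubspace (spanned b)
  spanned-complete {zero}  b = zeroSubspace-complete
  spanned-complete {suc n} b = adjoin-complete (b zero) (spanned (b ∘ suc))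
      (spanned-complete (b ∘ suc))

  combination∈spanned : ∀ {n} (b : Fin n → Carrier) (c : Fin n → F.Carrier) →
      W (spanned b) (sum (λ i → ι (c i) * b i))
  combination∈spanned {zero}  b c = refl
  combination∈spanned {suc n} b c = c zero , sum (λ i → ι (c (suc i)) * b (suc i)) ,
      combination∈spanned (b ∘ suc) (c ∘ suc) , refl

  extension-complete : Complete
  extension-complete u cauchy = let x , _ , u⟶x = spanned-complete basis u
                                      (λ n → W-resp (spanned basis) (sym (spans (u n)))
                                          (combination∈spanned basis (coord (u n)))) cauchy
                                in x , u⟶x

-- Sums in a non-archimedean field

module UltrametricSums (L : ValuedField) where
  open ValuedField L hiding (zero)
  open IntegerSolver commutativeRing

  v-sum : ∀ {n a} (t : Fin n → Carrier) → (∀ i → a ≤∞ v (t i)) → a ≤∞ v (sum t)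
  v-sum {zero}  {a} t p = ≡.subst (a ≤∞_) (≡.sym v-0) (_ ≤⊤⁺)
  v-sum {suc n} t p = v-+-min _ _ (p zero) (v-sum (t ∘ suc) (p ∘ suc))

  v-sum-single : ∀ {n a} (t : Fin n → Carrier) c j → a ≤∞ v (t j - c) →
    (∀ i → ¬ i ≡ j → a ≤∞ v (t i)) → a ≤∞ v (sum t - c)
  v-sum-single {suc n} {a} t c zero p small = ≡.subst (a ≤∞_)
    (v-cong (solve 3 (λ x s c → (x :- c) :+ s := (x :+ s) :- c) refl (t zero) (sum (t ∘ suc)) c))
    (v-+-min _ _ p (v-sum (t ∘ suc) (λ i → small (suc i) (λ ()))))
  v-sum-single {suc n} {a} t c (suc j) p small = ≡.subst (a ≤∞_)
    (v-cong (solve 3 (λ x s c → x :+ (s :- c) := (x :+ s) :- c) refl (t zero) (sum (t ∘ suc)) c))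
    (v-+-min _ _ (small zero (λ ())) (v-sum-single (t ∘ suc) c j p
        (λ i i≢j → small (suc i) (λ { ≡.refl → i≢j ≡.refl }))))

-- Digits, coset sums and compactness in the local field

module LocalField (em : Classical) {F : ValuedField} (K : FiniteExtension F)
  (complete : ValuedField.Complete (FiniteExtension.valuedField K)) (localData : LocalData K)
  (ϖ : ValuedField.Carrier (FiniteExtension.valuedField K))
  (πϖ≈1 : Inverses (FiniteExtension.valuedField K) (LocalData.π localData) ϖ)
  where
  open FiniteExtension K using (valuedField)
  open ValuedField valuedField hiding (zero; sum; sum-cong-≋; ∑-distrib-+)
  open LocalData localData hiding (different)
  open ValuedFieldProperties em valuedField
  open IntegerSolver commutativeRing
  open Topology valuedField

  private
    vπ≰0 : ¬ v π ≤∞ 0∞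
    vπ≰0 = Equivalence.from (π-generates π) (1# , 1-integral , sym (*-identityʳ π))

    vπ-finite : ∃[ r ] v π ≡ [ r ]
    vπ-finite = v-finite (invertible⇒≉0 πϖ≈1)

    ρ : ℚ
    ρ = proj₁ vπ-finite

    0<ρ : 0ℚ ℚ.< ρ
    0<ρ = ℚ.≰⇒> (λ ρ≤0 → vπ≰0 (≡.subst (_≤∞ 0∞) (≡.sym (proj₂ vπ-finite)) [ ρ≤0 ]))

  π-integral : Integral π
  π-integral = ≡.subst (0∞ ≤∞_) (≡.sym (proj₂ vπ-finite)) [ ℚ.<⇒≤ 0<ρ ]

  ^-integral : ∀ {x} n → Integral x → Integral (x ^ n)
  ^-integral zero    ix = 1-integral
  ^-integral (suc n) ix = *-integral ix (^-integral n ix)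

  v-π^ : ∀ n → v (π ^ n) ≡ [ n ℚ• ρ ]
  v-π^ = v-^ (proj₂ vπ-finite)

  π^-deep : ∀ r → ∃[ n ] [ r ] ≤∞ v (π ^ n)
  π^-deep r = let n , p = archimedean r 0<ρ in n , ≡.subst ([ r ] ≤∞_) (≡.sym (v-π^ n)) [ p ]

  π^-+ : ∀ m n → π ^ (m ℕ.+ n) ≈ π ^ m * π ^ n
  π^-+ m n = Exp.^-homo-* semiring π m n
    where import Algebra.Properties.Semiring.Exp as Exp

  π^-mono : ∀ {m n} → m ℕ.≤ n → v (π ^ m) ≤∞ v (π ^ n)
  π^-mono {m} {n} m≤n = ≤v-cong
    (trans (sym (π^-+ m (n ℕ.∸ m))) (reflexive (≡.cong (π ^_) (ℕ.m+[n∸m]≡n m≤n))))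
    (v-*≥ˡ (π ^ m) (^-integral (n ℕ.∸ m) π-integral))

  π^ϖ^≈1 : ∀ n → π ^ n * ϖ ^ n ≈ 1#
  π^ϖ^≈1 zero    = *-identityˡ 1#
  π^ϖ^≈1 (suc n) = begin
    π * π ^ n * (ϖ * ϖ ^ n)    ≈⟨ solve 4 (λ p q x y → p :* q :* (x :* y) := p :* x :* (q :* y))
        refl π (π ^ n) ϖ (ϖ ^ n) ⟩
    π * ϖ * (π ^ n * ϖ ^ n)    ≈⟨ *-cong πϖ≈1 (π^ϖ^≈1 n) ⟩
    1# * 1#                    ≈⟨ *-identityˡ 1# ⟩
    1#                         ∎
    where open SetoidReasoning setoid

  π^-divides : ∀ n {x} → v (π ^ n) ≤∞ v x → ∃[ y ] Integral y × x ≈ π ^ n * y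
  π^-divides n = ≤v⇒∣ (π^ϖ^≈1 n)

  bounded : ∀ x → ∃[ N ] ∀ n → N ℕ.≤ n → Integral (π ^ n * x)
  bounded x = let s , near = radius (v x)
                  N , s≤ = π^-deep s
              in N , λ n N≤n → ≤v-cong (*-comm x (π ^ n))
                   (≡.subst (0∞ ≤∞_) (≡.sym (v-* x (π ^ n))) (near (≤∞-trans s≤ (π^-mono N≤n))))

  infix 4 _~_
  _~_ : Carrier → Carrier → Set
  x ~ y = v π ≤∞ v (x - y)

  ~-step : ∀ {x y} → x ~ y → ∃[ z ] Integral z × x ≈ y + π * z
  ~-step {x} {y} x~y = let z , iz , eq = ≤v⇒∣ πϖ≈1 x~y in
    z , iz , trans (solve 2 (λ x y → x := y :+ (x :- y)) refl x y) (+-congˡ eq)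

  ~-π : ∀ x {z} → Integral z → (x + π * z) ~ x
  ~-π x {z} iz = ≤v-cong (solve 2 (λ x y → y := x :+ y :- x) refl x (π * z)) (v-*≥ˡ π iz)

  digit : ∀ x → Integral x → Fin q
  digit x ix = proj₁ (residues-complete x ix)

  digit-~ : ∀ x ix → x ~ residues (digit x ix)
  digit-~ x ix = let _ , (y , iy , eq) , _ = residues-complete x ix in
    ≤v-cong (sym eq) (v-*≥ˡ π iy)

  digit-unique : ∀ x ix {i} → x ~ residues i → digit x ix ≡ i
  digit-unique x ix x~i = proj₂ (proj₂ (residues-complete x ix)) (≤v⇒∣ πϖ≈1 x~i)

  translate : ∀ b → Integral b → Fin q → Fin q
  translate b ib i = digit (residues i + b) (+-integral (residues-integral i) ib)

  translate-~ : ∀ b ib i → residues (translate b ib i) ~ residues i + b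
  translate-~ b ib i = v-swap _ _ (digit-~ _ _)

  translate-unique : ∀ b ib i {j} → residues j ~ residues i + b → translate b ib i ≡ j
  translate-unique b ib i j~ = digit-unique _ _ (v-swap _ _ j~)

  ~-+ : ∀ {x y x′ y′} → x ~ x′ → y ~ y′ → x + y ~ x′ + y′
  ~-+ = v-+-diff _ _ _ _

  ~-refl : ∀ {x} → x ~ x
  ~-refl = v-≈ _ _ refl

  ~-reflexive : ∀ {x y} → x ≈ y → x ~ y
  ~-reflexive = v-≈ _ _

  translate-inverse : ∀ b c ib ic → b + c ≈ 0# → ∀ i → translate b ib (translate c ic i) ≡ i
  translate-inverse b c ib ic b+c≈0 i = translate-unique b ib (translate c ic i)
    (v-swap _ _ (v-trans _ (residues i + c + b) _ (~-+ (translate-~ c ic i) ~-refl)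
      (~-reflexive (trans (solve 3 (λ x b c → x :+ c :+ b := x :+ (b :+ c)) refl (residues i) b c)
        (trans (+-congˡ b+c≈0) (+-identityʳ _))))))

  -- The sum over a system of representatives of 𝔬/π^k, digit by digit.
  cosetSum : ∀ {c ℓ} (M : RawMonoid c ℓ) → ℕ → (Carrier → RawMonoid.Carrier M) → RawMonoid.Carrier M
  cosetSum M zero    φ = φ 0#
  cosetSum M (suc k) φ = RawMonoidDefinitions.sum M
      (λ i → cosetSum M k (λ x → φ (residues i + π * x)))

  digits-integral : ∀ i {x} → Integral x → Integral (residues i + π * x)
  digits-integral i ix = +-integral (residues-integral i) (*-integral π-integral ix)

  module _ {a ℓ b ℓ′} (M : RawMonoid a ℓ) (N : RawMonoid b ℓ′) where
    private
      module M = RawMonoid M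
      module N = RawMonoid N

    sum-rel : ∀ {r} (R : M.Carrier → N.Carrier → Set r) → R M.ε N.ε →
      (∀ {x y z w} → R x y → R z w → R (x M.∙ z) (y N.∙ w)) →
      ∀ {n} (f : Fin n → M.Carrier) (g : Fin n → N.Carrier) → (∀ i → R (f i) (g i)) →
      R (RawMonoidDefinitions.sum M f) (RawMonoidDefinitions.sum N g)
    sum-rel R R-ε R-∙ {zero}  f g p = R-ε
    sum-rel R R-ε R-∙ {suc n} f g p = R-∙ (p zero) (sum-rel R R-ε R-∙ (f ∘ suc) (g ∘ suc) (p ∘ suc))

    -- Coset sums are built from ε and ∙ alone, so any relation compatible with these passes from
    -- terms to sums. Congruence, valuation bounds, pointwise evaluation and membership in a span
    -- all arise from a choice of `R`.
    cosetSum-rel : ∀ {r} (R : M.Carrier → N.Carrier → Set r) → R M.ε N.ε →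
      (∀ {x y z w} → R x y → R z w → R (x M.∙ z) (y N.∙ w)) →
      ∀ k {φ ψ} → (∀ x → Integral x → R (φ x) (ψ x)) → R (cosetSum M k φ) (cosetSum N k ψ)
    cosetSum-rel R R-ε R-∙ zero    p = p 0# 0-integral
    cosetSum-rel R R-ε R-∙ (suc k) p = sum-rel R R-ε R-∙ _ _ λ i →
      cosetSum-rel R R-ε R-∙ k λ x ix → p _ (digits-integral i ix)

  module CosetSumProperties {a ℓ} (M : CommutativeMonoid a ℓ) where
    private module M = CommutativeMonoid M
    open CommutativeMonoidSum M using (∑-distrib-+; ∑-comm; sum-cong-≋; sum-permute)
        renaming (sum to ∑)

    S : ℕ → (Carrier → M.Carrier) → M.Carrier
    S = cosetSum M.rawMonoid

    S-cong : ∀ k {φ ψ} → (∀ x → Integral x → φ x M.≈ ψ x) → S k φ M.≈ S k ψ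
    S-cong = cosetSum-rel M.rawMonoid M.rawMonoid M._≈_ M.refl M.∙-cong

    S-∙ : ∀ k φ ψ → S k (λ x → φ x M.∙ ψ x) M.≈ S k φ M.∙ S k ψ
    S-∙ zero    φ ψ = M.refl
    S-∙ (suc k) φ ψ = M.trans (sum-cong-≋ {q}
        (λ i → S-∙ k (λ x → φ (residues i + π * x)) (λ x → ψ (residues i + π * x))))
        (∑-distrib-+ _ (λ i → S k (λ x → ψ (residues i + π * x))))

    S-∑ : ∀ k {n} (φ : Fin n → Carrier → M.Carrier) → S k (λ x → ∑ (λ i → φ i x)) M.≈ ∑
        (λ i → S k (φ i))
    S-∑ zero    φ = M.refl
    S-∑ (suc k) φ = M.trans (sum-cong-≋ {q} (λ j → S-∑ k (λ i x → φ i (residues j + π * x))))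
        (∑-comm (λ j i → S k (λ x → φ i (residues j + π * x))))

    S-swap : ∀ j k (φ : Carrier → Carrier → M.Carrier) → S j (λ x → S k (φ x)) M.≈ S k
        (λ y → S j (λ x → φ x y))
    S-swap zero    k φ = M.refl
    S-swap (suc j) k φ = M.trans (sum-cong-≋ {q} (λ i → S-swap j k (λ x → φ (residues i + π * x))))
      (M.sym (S-∑ k (λ i y → S j (λ x → φ (residues i + π * x) y))))

    -- The first j digits form x and the remaining k digits form y. The regrouped expression agrees
    -- with the digit expansion only up to `≈`, which is why `φ` has to respect it.
    S-split : ∀ j k {φ} → (∀ {x y} → x ≈ y → φ x M.≈ φ y) →
      S (j ℕ.+ k) φ M.≈ S j (λ x → S k (λ y → φ (x + π ^ j * y)))
    S-split zero    k {φ} φ-cong = S-cong k λ y _ →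
        φ-cong (trans (sym (*-identityˡ y)) (sym (+-identityˡ _)))
    S-split (suc j) k {φ} φ-cong = sum-cong-≋ {q} λ i →
      M.trans (S-split j k (λ e → φ-cong (+-congˡ (*-congˡ e))))
        (S-cong j λ x _ → S-cong k λ y _ → φ-cong
          (solve 5 (λ a p x t y → a :+ p :* (x :+ t :* y) := a :+ p :* x :+ p :* t :* y) refl
            (residues i) π x (π ^ j) y))

    Periodic : ℕ → (Carrier → M.Carrier) → Set ℓ
    Periodic k φ = ∀ {x y} → Integral x → Integral y → v (π ^ k) ≤∞ v (x - y) → φ x M.≈ φ y

    -- Adding b permutes the lowest digits and leaves a carry that depends on the digit. The sum
    -- over the higher digits is thereby translated by that carry, and induction removes the
    -- translation. Periodicity enters because x + b is in general not one of the chosen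
    -- representatives.
    S-shift : ∀ k {φ b} → Integral b → Periodic k φ → S k (λ x → φ (x + b)) M.≈ S k φ
    S-shift zero {φ} {b} ib per = per (+-integral 0-integral ib) 0-integral
      (≡.subst (_≤∞ v (0# + b - 0#)) (≡.sym v-1)
          (v-+-neg _ _ (+-integral 0-integral ib) 0-integral))
    S-shift (suc k) {φ} {b} ib per = M.trans (sum-cong-≋ {q} λ i → let y , iy ,
                                                                         eq = ~-step (v-swap _ _
                                                                         (translate-~ b ib i)) in
                                                                         shifted i _ iy eq)
      (M.sym (sum-permute T (permutation (translate b ib) (translate (- b) (v-neg b ib))
        (translate-inverse b (- b) _ _ (-‿inverseʳ b))
            (translate-inverse (- b) b _ _ (-‿inverseˡ b)))))
      where
      T : Fin q → M.Carrier
      T i = S k (λ x → φ (residues i + π * x))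
      carry : ∀ {r r′ y} x → r + b ≈ r′ + π * y → r + π * x + b ≈ r′ + π * (x + y)
      carry {r} {r′} {y} x eq = begin
        r + π * x + b          ≈⟨ solve 3 (λ r x b → r :+ x :+ b := r :+ b :+ x) refl r (π * x) b ⟩
        r + b + π * x          ≈⟨ +-congʳ eq ⟩
        r′ + π * y + π * x     ≈⟨ solve 4 (λ r p x y → r :+ p :* y :+ p :* x := r :+ p :* (x :+ y))
            refl r′ π x y ⟩
        r′ + π * (x + y)       ∎
        where open SetoidReasoning setoid
      periodic-digit : ∀ j → Periodic k (λ x → φ (residues j + π * x))
      periodic-digit j {x} {y} ix iy x-y = per (digits-integral j ix) (digits-integral j iy)
        (≤v-cong (solve 4 (λ r p x y → p :* (x :- y) := r :+ p :* x :- (r :+ p :* y))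
            refl (residues j) π x y)
          (≡.subst (_≤∞ v (π * (x - y))) (≡.sym (v-* π (π ^ k))) (v-*-mono π (x - y) ≤∞-refl x-y)))
      shifted : ∀ i j {y} → Integral y → residues i + b ≈ residues j + π * y →
        S k (λ x → φ (residues i + π * x + b)) M.≈ T j
      shifted i j {y} iy eq = M.trans
        (S-cong k {ψ = λ x → φ (residues j + π * (x + y))} λ x ix →
          per (+-integral (digits-integral i ix) ib) (digits-integral j (+-integral ix iy))
            (v-≈ (residues i + π * x + b) (residues j + π * (x + y)) (carry x eq)))
        (S-shift k {λ x → φ (residues j + π * x)} iy (periodic-digit j))

  module Concentration (L : ValuedField) where
    private
      module L = ValuedField L
      open UltrametricSums L

    cosetSum-≤v : ∀ k {φ r} → (∀ x → Integral x → r ≤∞ L.v (φ x)) →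
        r ≤∞ L.v (cosetSum L.+-rawMonoid k φ)
    cosetSum-≤v k {φ} {r} p = cosetSum-rel L.+-rawMonoid L.+-rawMonoid (λ x _ → r ≤∞ L.v x)
      (≡.subst (r ≤∞_) (≡.sym L.v-0) (_ ≤⊤⁺)) (λ p q → L.v-+-min _ _ p q) k {ψ = φ} p

    cosetSum-*ˡ : ∀ k c {φ} → c L.* cosetSum L.+-rawMonoid k φ L.≈ cosetSum L.+-rawMonoid k
        (λ x → c L.* φ x)
    cosetSum-*ˡ k c = cosetSum-rel L.+-rawMonoid L.+-rawMonoid (λ x y → c L.* x L.≈ y) (L.zeroʳ c)
      (λ {x} {y} {z} {w} p q → L.trans (L.distribˡ c x z) (L.+-cong p q)) k (λ _ _ → L.refl)

    cosetSum-near : ∀ k {φ ψ r} → (∀ x → Integral x → r ≤∞ L.v (φ x L.- ψ x)) →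
      r ≤∞ L.v (cosetSum L.+-rawMonoid k φ L.- cosetSum L.+-rawMonoid k ψ)
    cosetSum-near k {φ} {ψ} {r} p = cosetSum-rel L.+-rawMonoid L.+-rawMonoid
        (λ x y → r ≤∞ L.v (x L.- y))
      (L.v-≈ _ _ L.refl) (λ p q → L.v-+-diff _ _ _ _ p q) k p

    -- Exactly one representative is congruent to `a` modulo π^k; the induction finds it by
    -- following the digits of `a`, and every sum over a branch left aside is negligible.
    cosetSum-single : ∀ k {a φ c r} → Integral a →
      (∀ x → Integral x → ¬ v (π ^ k) ≤∞ v (x - a) → r ≤∞ L.v (φ x)) →
      (∀ x → Integral x → v (π ^ k) ≤∞ v (x - a) → r ≤∞ L.v (φ x L.- c)) →
      r ≤∞ L.v (cosetSum L.+-rawMonoid k φ L.- c)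
    cosetSum-single zero {a} ia far near = near 0# 0-integral
      (≡.subst (_≤∞ v (0# - a)) (≡.sym v-1) (v-+-neg 0# a 0-integral ia))
    cosetSum-single (suc k) {a} {φ} {c} {r} ia far near =
      let b , ib , eq = ~-step (digit-~ a ia) in
      v-sum-single _ c (digit a ia)
        (cosetSum-single k {b} {r = r} ib
          (λ x ix x≁b → far _ (digits-integral (digit a ia) ix) λ h →
            x≁b (v-*-cancel (π ^ k) (x - b) πϖ≈1 (≤v-cong (difference b x eq) h)))
          (λ x ix x~b → near _ (digits-integral (digit a ia) ix) (≤v-cong (sym (difference b x eq))
            (v-*-monoʳ π x~b))))
        (λ i i≢ → cosetSum-≤v k λ x ix → far _ (digits-integral i ix) λ h →
          i≢ (≡.sym (digit-unique a ia (v-swap _ _ (v-trans (residues i) (residues i + π * x) a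
            (v-swap _ _ (~-π (residues i) ix)) (≤∞-trans (v-*≥ˡ π (^-integral k π-integral)) h))))))
      where
      difference : ∀ {r} b x → a ≈ r + π * b → r + π * x - a ≈ π * (x - b)
      difference {r} b x eq = trans (+-congˡ (-‿cong eq))
        (solve 4 (λ r p x b → r :+ p :* x :- (r :+ p :* b) := p :* (x :- b)) refl r π x b)

  -- A failure of P would propagate to a nested sequence of balls, hence to their
  -- common point.
  fan : ∀ (P : ℕ → Carrier → Set) →
    (∀ n a → (∀ i → P (suc n) (a + π ^ n * residues i)) → P n a) →
    (∀ z → Integral z → ∃[ n ] ∀ a → v (π ^ n) ≤∞ v (z - a) → P n a) →
    P 0 0#
  fan P step local = decidable-stable em λ ¬P₀ →
    let n , Pz = local (z ¬P₀) (z-integral ¬P₀) in proj₂ (bad ¬P₀ n) (Pz _ (z-near ¬P₀ n))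
    where
    next : ∀ n → ∃[ a ] ¬ P n a → Fin q
    next n (a , ¬Pa) = proj₁ (¬∀⇒∃¬ em (λ h → ¬Pa (step n a h)))

    bad : ¬ P 0 0# → ∀ n → ∃[ a ] ¬ P n a
    bad ¬P₀ zero    = 0# , ¬P₀
    bad ¬P₀ (suc n) = let a , ¬Pa = bad ¬P₀ n in
      a + π ^ n * residues (next n (bad ¬P₀ n)) , proj₂ (¬∀⇒∃¬ em (λ h → ¬Pa (step n a h)))

    module _ (¬P₀ : ¬ P 0 0#) where
      a : ℕ → Carrier
      a n = proj₁ (bad ¬P₀ n)

      a-step : ∀ n → v (π ^ n) ≤∞ v (a (suc n) - a n)
      a-step n = ≤v-cong (solve 2 (λ a x → x := a :+ x :- a)
          refl (a n) (π ^ n * residues (next n (bad ¬P₀ n))))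
        (v-*≥ˡ (π ^ n) (residues-integral _))

      a-near : ∀ n j → v (π ^ n) ≤∞ v (a (j ℕ.+ n) - a n)
      a-near n zero    = v-≈ _ _ refl
      a-near n (suc j) = v-trans (a (suc j ℕ.+ n)) (a (j ℕ.+ n)) (a n)
        (≤∞-trans (π^-mono (ℕ.m≤n+m n j)) (a-step (j ℕ.+ n))) (a-near n j)

      a-near′ : ∀ {m n} → n ℕ.≤ m → v (π ^ n) ≤∞ v (a m - a n)
      a-near′ {m} {n} n≤m = ≡.subst (λ m → v (π ^ n) ≤∞ v (a m - a n)) (ℕ.m∸n+n≡m n≤m)
          (a-near n (m ℕ.∸ n))

      a-cauchy : Cauchy a
      a-cauchy r = let N , r≤ = π^-deep r in N , λ m n N≤m N≤n →
        ≤∞-trans r≤ (v-trans (a m) (a N) (a n) (a-near′ N≤m) (v-swap _ _ (a-near′ N≤n)))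

      z : Carrier
      z = proj₁ (complete a a-cauchy)

      z-near : ∀ n → v (π ^ n) ≤∞ v (z - a n)
      z-near n = ≡.subst (_≤∞ v (z - a n)) (≡.sym (v-π^ n)) (⟶-bound n
        (λ m n≤m → ≡.subst (_≤∞ v (a m - a n)) (v-π^ n) (a-near′ n≤m))
        (⟶-+ (proj₂ (complete a a-cauchy)) (⟶-const (- a n))))

      z-integral : Integral z
      z-integral = ≤v-cong (solve 1 (λ z → z :- con (+ 0) := z) refl z)
        (≡.subst (_≤∞ v (z - 0#)) v-1 (z-near 0))

  Ball : Carrier → Pred Carrier 0ℓ
  Ball c x = v c ≤∞ v x

  ball-open : ∀ {c d} → c * d ≈ 1# → Open (Ball c)
  ball-open {c} cd≈1 {x} x∈ = let r , eq = v-finite (invertible⇒≉0 cd≈1) in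
    r , λ y r≤ → ≤v-cong (solve 2 (λ x y → x :+ (y :- x) := y) refl x y)
      (v-+-min x (y - x) x∈ (≡.subst (_≤∞ v (y - x)) (≡.sym eq) r≤))

  -- Division by c carries the ball to 𝔬, and `fan` is applied to the existence of a finite subcover
  -- of c(a + π^n 𝔬). Subcovers of the q smaller balls are concatenated; close to any given point a
  -- single open set suffices.
  ball-compact : ∀ {c d} → c * d ≈ 1# → Compact (Ball c)
  ball-compact {c} cd≈1 I V V-open cover = let is , covers = fan Covered split local in
    is , λ {x} x∈ → let y , iy , x≈cy = ≤v⇒∣ cd≈1 x∈ in
      Any.map (λ {i} → V-resp i (sym x≈cy))
        (covers y iy (≡.subst (_≤∞ v (y - 0#)) (≡.sym v-1) (v-+-neg y 0# iy 0-integral)))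
    where
    V-resp : ∀ i {x y} → x ≈ y → V i x → V i y
    V-resp i {x} {y} x≈y Vx = proj₂ (V-open i Vx) y (v-≈ y x (sym x≈y))

    Covered : ℕ → Carrier → Set
    Covered n a = Σ[ is ∈ List I ] (∀ x → Integral x → v (π ^ n) ≤∞ v (x - a) →
        Any (λ i → V i (c * x)) is)

    split : ∀ n a → (∀ i → Covered (suc n) (a + π ^ n * residues i)) → Covered n a
    split n a children = concat (List.tabulate (λ i → proj₁ (children i))) , λ x ix near →
      let y , iy , eq = π^-divides n near
          z , iz , eq′ = ~-step (digit-~ y iy)
      in Any.concat⁺ (Any.tabulate⁺ (digit y iy) (proj₂ (children (digit y iy)) x ix
        (≤v-cong (shrink x y (residues (digit y iy)) z eq eq′)
          (v-*≥ˡ (π * π ^ n) iz))))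
      where
      shrink : ∀ x y r z → x - a ≈ π ^ n * y → y ≈ r + π * z → π * π ^ n * z ≈ x - (a + π ^ n * r)
      shrink x y r z eq eq′ = begin
        π * π ^ n * z                     ≈⟨ solve 4
            (λ p t z r → p :* t :* z := t :* (r :+ p :* z) :- t :* r) refl π (π ^ n) z r ⟩
        π ^ n * (r + π * z) - π ^ n * r   ≈⟨ +-congʳ (*-congˡ eq′) ⟨
        π ^ n * y - π ^ n * r             ≈⟨ +-congʳ eq ⟨
        x - a - π ^ n * r                 ≈⟨ solve 3
            (λ x a t → x :- a :- t := x :- (a :+ t)) refl x a (π ^ n * r) ⟩
        x - (a + π ^ n * r)               ∎
        where open SetoidReasoning setoid

    local : ∀ z → Integral z → ∃[ n ] ∀ a → v (π ^ n) ≤∞ v (z - a) → Covered n a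
    local z iz =
      let i , Vz = cover (v-*≥ˡ c iz)
          s , near = V-open i Vz
          t , scaled = scale (v c) s
          n , t≤ = π^-deep t
      in n , λ a z-a → (i ∷ []) , λ x ix x-a → here (near (c * x)
        (≤v-cong (x[y-z]≈xy-xz c x z) (≡.subst ([ s ] ≤∞_) (≡.sym (v-* c (x - z)))
          (scaled (≤∞-trans t≤ (v-trans x a z x-a (v-swap _ _ z-a)))))))

  -- The fractional ideals π^(-M) 𝔬 exhaust K, and every compact set lies in one of them; they stand
  -- in for arbitrary compact open sets in all estimates.
  Disc : ℕ → Pred Carrier 0ℓ
  Disc M x = Integral (π ^ M * x)

  disc⇔ball : ∀ M {x} → Disc M x ⇔ Ball (ϖ ^ M) x
  disc⇔ball M {x} = mk⇔
    (λ i → ≤v-cong (inverse-cancelˡ x (trans (*-comm _ _) (π^ϖ^≈1 M))) (v-*≥ˡ (ϖ ^ M) i))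
    (λ le → ≡.subst₂ _≤∞_ (v-inverse (π^ϖ^≈1 M)) (≡.sym (v-* (π ^ M) x))
        (+∞-mono (≤∞-refl {v (π ^ M)}) le))

  ϖ^π^≈1 : ∀ n → ϖ ^ n * π ^ n ≈ 1#
  ϖ^π^≈1 n = trans (*-comm _ _) (π^ϖ^≈1 n)

  disc-compactOpen : ∀ M → CompactOpen (Disc M)
  disc-compactOpen M = (λ I V V-open cover → let is , covers = ball-compact (ϖ^π^≈1 M) I V V-open
                                                   (λ x∈ → cover (Equivalence.from
                                                   (disc⇔ball M) x∈))
                          in is , λ x∈ → covers (Equivalence.to (disc⇔ball M) x∈))
    , λ {x} x∈ → let s , near = ball-open (ϖ^π^≈1 M) (Equivalence.to (disc⇔ball M) x∈) in
        s , λ y y-x → Equivalence.from (disc⇔ball M) (near y y-x)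

  disc-weaken : ∀ {M N x} → M ℕ.≤ N → Disc M x → Disc N x
  disc-weaken {M} {N} {x} M≤N i = ≤∞-trans i (≡.subst₂ _≤∞_ (≡.sym (v-* (π ^ M) x))
      (≡.sym (v-* (π ^ N) x))
      (+∞-mono (π^-mono M≤N) ≤∞-refl))

  -- The discs form an open cover of K, and the sum of the finitely many chosen indices bounds each
  -- of them.
  compact-bounded : ∀ {U} → Compact U → ∃[ N ] ∀ {x} → U x → Integral (π ^ N * x)
  compact-bounded cU =
    let is , covers = cU ℕ (λ n x → Integral (π ^ n * x)) integral-open (λ {x} _ →
          let N , p = bounded x in N , p N ℕ.≤-refl)
    in ℕ.sum is , λ x∈ → any⇒sum is (covers x∈)
    where
    integral-open : ∀ n → Open (λ x → Integral (π ^ n * x))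
    integral-open n {x} ix = 0ℚ , λ y y-x → ≤v-cong
      (solve 3 (λ t x y → t :* x :+ t :* (y :- x) := t :* y) refl (π ^ n) x y)
      (+-integral ix (*-integral (^-integral n π-integral) y-x))

    any⇒sum : ∀ is {x} → Any (λ n → Integral (π ^ n * x)) is → Integral (π ^ ℕ.sum is * x)
    any⇒sum (n ∷ is) (here i)  = disc-weaken (ℕ.m≤m+n n (ℕ.sum is)) i
    any⇒sum (n ∷ is) (there i) = disc-weaken (ℕ.m≤n+m (ℕ.sum is) n) (any⇒sum is i)

  -- Every point of an ultrametric ball is a centre, so the smallest of the finitely many radii is
  -- already a Lebesgue number. `R` is closeness up to r for continuous functions and equality for
  -- locally constant ones.
  compact-uniform : ∀ {U} {A : Set} (f : Carrier → A) (R : A → A → Set) →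
    (∀ {x y z} → R x z → R y z → R x y) →
    (∀ x → ∃[ s ] ∀ y → [ s ] ≤∞ v (y - x) → R (f y) (f x)) → Compact U →
    ∃[ s ] ∀ x y → U x → [ s ] ≤∞ v (x - y) → R (f x) (f y)
  compact-uniform {U} f R R-trans cont cU = mesh is , λ x y x∈ x-y → uniform is x-y (covers x∈)
    where
    near : Carrier → Pred Carrier 0ℓ
    near i x = [ proj₁ (cont i) ] ≤∞ v (x - i)
    finite : Σ[ is ∈ List Carrier ] (∀ {x} → U x → Any (λ i → near i x) is)
    finite = cU Carrier near
      (λ i {x} x∈ → proj₁ (cont i) , λ y y-x → v-trans y x i y-x x∈)
      (λ {x} _ → x , v-≈ x x refl)
    is = proj₁ finite
    covers = proj₂ finite
    mesh : List Carrier → ℚ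
    mesh []       = 0ℚ
    mesh (i ∷ is) = proj₁ (cont i) ℚ.⊔ mesh is
    uniform : ∀ is {x y} → [ mesh is ] ≤∞ v (x - y) → Any (λ i → near i x) is → R (f x) (f y)
    uniform (i ∷ is) {x} {y} x-y (here x-i) = R-trans (proj₂ (cont i) x x-i)
      (proj₂ (cont i) y (v-trans y x i (v-swap x y (⊔-≤∞ˡ {proj₁ (cont i)} {mesh is} x-y)) x-i))
    uniform (i ∷ is) x-y (there any) = uniform is (⊔-≤∞ʳ {proj₁ (cont i)} {mesh is} x-y) any

  -- The additive group of the residue field is killed by n when v(n) > 0.
  q∣n^q : ∀ n .{{_ : ℕ.NonZero n}} → ¬ v (n • 1#) ≤∞ 0∞ → q ∣.∣ n ℕ.^ q
  q∣n^q n n≰0 = CommutingPermutations.cardinality-∣ n q τ τ-comm τ-order τ-transitive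
      (digit 0# 0-integral)
    where
    τ : Fin q → Fin q → Fin q
    τ a = translate (residues a) (residues-integral a)

    τ-~ : ∀ a i → residues (τ a i) ~ residues i + residues a
    τ-~ a = translate-~ (residues a) (residues-integral a)

    τ-comm : ∀ a b i → τ a (τ b i) ≡ τ b (τ a i)
    τ-comm a b i = translate-unique _ _ _ (v-trans (residues (τ b (τ a i)))
      (residues i + residues a + residues b) (residues (τ b i) + residues a)
      (v-trans _ (residues (τ a i) + residues b) _ (τ-~ b (τ a i)) (~-+ (τ-~ a i) ~-refl))
      (v-swap _ _ (v-trans _ (residues i + residues b + residues a) _ (~-+ (τ-~ b i) ~-refl)
        (~-reflexive (solve 3 (λ x a b → x :+ a :+ b := x :+ b :+ a)
            refl (residues i) (residues b) (residues a))))))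

    fold-~ : ∀ a i m → residues (fold i (τ a) m) ~ residues i + m • residues a
    fold-~ a i zero    = ~-reflexive (sym (+-identityʳ (residues i)))
    fold-~ a i (suc m) = v-trans _ (residues (fold i (τ a) m) + residues a) _
        (τ-~ a (fold i (τ a) m))
      (v-trans _ (residues i + m • residues a + residues a) _ (~-+ (fold-~ a i m) ~-refl)
        (~-reflexive (solve 3 (λ x m a → x :+ m :+ a := x :+ (a :+ m))
            refl (residues i) (m • residues a) (residues a))))

    n•-~0 : ∀ {x} → Integral x → n • x ~ 0#
    n•-~0 {x} ix = let y , iy , eq = Equivalence.to (π-generates (n • 1#)) n≰0 in
      ≤v-cong (trans (n•≈ y eq) (sym (trans (+-congˡ (-0#≈0#)) (+-identityʳ (n • x)))))
          (v-*≥ˡ π (*-integral iy ix))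
      where
      open RingProperties ring using (-0#≈0#)
      n•≈ : ∀ y → n • 1# ≈ π * y → π * (y * x) ≈ n • x
      n•≈ y eq = begin
        π * (y * x)     ≈⟨ *-assoc π y x ⟨
        π * y * x       ≈⟨ *-congʳ eq ⟨
        n • 1# * x      ≈⟨ Mult.×-assoc-* semiring n 1# x ⟩
        n • (1# * x)    ≈⟨ Mult.×-congʳ semiring n (*-identityˡ x) ⟩
        n • x           ∎
        where open SetoidReasoning setoid

    τ-order : ∀ a i → fold i (τ a) n ≡ i
    τ-order a i = ≡.trans (≡.sym (digit-unique (residues (fold i (τ a) n))
        (residues-integral _) ~-refl))
      (digit-unique _ _ (v-trans _ (residues i + n • residues a) _ (fold-~ a i n)
        (v-trans _ (residues i + 0#) _ (~-+ ~-refl (n•-~0 (residues-integral a)))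
          (~-reflexive (+-identityʳ (residues i))))))

    τ-transitive : ∀ i j → ∃[ a ] τ a i ≡ j
    τ-transitive i j = let d = residues j - residues i
                           d-integral = v-+-neg _ _ (residues-integral j) (residues-integral i)
      in digit d d-integral , translate-unique _ _ i (v-trans (residues j) (residues i + d) _
        (~-reflexive (solve 2 (λ x y → y := x :+ (y :- x)) refl (residues i) (residues j)))
        (~-+ ~-refl (digit-~ d d-integral)))

-- Embeddings and residues of ℓ-integral rational numbers

module EmbeddingProperties {F E : ValuedField} {ι} (isEmbedding : IsEmbedding F E ι) where
  private
    module F = ValuedField F
    module E = ValuedField E
  open IsEmbedding isEmbedding
  open IsRingHomomorphism isRingHomomorphism

  ι-• : ∀ n → ι (n F.• F.1#) E.≈ n E.• E.1#
  ι-• zero    = 0#-homo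
  ι-• (suc n) = E.trans (+-homo F.1# (n F.• F.1#)) (E.+-cong 1#-homo (ι-• n))

  ι-- : ∀ x y → ι (x F.- y) E.≈ ι x E.- ι y
  ι-- x y = E.trans (+-homo x (F.- y)) (E.+-congˡ (-‿homo y))

  v-• : ∀ n → E.v (n E.• E.1#) ≡ F.v (n F.• F.1#)
  v-• n = ≡.trans (E.v-cong (E.sym (ι-• n))) (isometric (n F.• F.1#))

∤⇒coprime : ∀ {ℓ n} → Prime ℓ → ¬ ℓ ∣ n → Coprimality.Coprime n ℓ
∤⇒coprime ℓ-prime ℓ∤n (d∣n , d∣ℓ) with Primality.prime⇒irreducible ℓ-prime d∣ℓ
... | inj₁ d≡1    = d≡1
... | inj₂ ≡.refl = contradiction d∣n ℓ∤n

module RationalResidues {ℓ} (ℓ-prime : Prime ℓ) (V : PAdicValuation ℓ) where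
  private module Q = ValuedField (PAdicValuation.valuedField V)
  open PAdicValuation V using (v-p; v-unit)
  open IntegerSolver ℚ.+-*-commutativeRing
  open Q using (v; _•_)

  v-∣ : ∀ {n} → ℓ ∣ n → [ 1ℚ ] ≤∞ v (n • 1ℚ)
  v-∣ (∣.divides c ≡.refl) = ≡.subst ([ 1ℚ ] ≤∞_) (Q.v-cong (≡.sym (Mult.×1-homo-* Q.semiring c ℓ)))
    (Q.v-*ˡ (c • 1ℚ) (ℓ • 1ℚ) (•-integral c) (≡⇒≤∞ (≡.sym v-p)))
    where
    •-integral : ∀ c → Q.Integral (c • 1ℚ)
    •-integral zero    = Q.0-integral
    •-integral (suc c) = Q.+-integral Q.1-integral (•-integral c)

  1≰0 : ¬ [ 1ℚ ] ≤∞ 0∞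
  1≰0 [ ℚ.*≤* (ℤ.+≤+ ()) ]

  ∣-v : ∀ {n} → [ 1ℚ ] ≤∞ v (n • 1ℚ) → ℓ ∣ n
  ∣-v {n} h with ℓ ∣.∣? n
  ... | yes ℓ∣n = ℓ∣n
  ... | no ℓ∤n = contradiction (≡.subst ([ 1ℚ ] ≤∞_) (v-unit n ℓ∤n) h) 1≰0

  HasResidue : ℚ → Set
  HasResidue x = ∃[ m ] [ 1ℚ ] ≤∞ v (x ℚ.- m • 1ℚ)

  instance
    ℓ-nonZero : ℕ.NonZero ℓ
    ℓ-nonZero = Primality.prime⇒nonZero ℓ-prime

  -- The factor ℓ - 1 acts as -1 modulo ℓ and keeps the residue a natural number.
  hasResidue-neg : ∀ {x} → HasResidue (ℚ.- x) → HasResidue x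
  hasResidue-neg {x} (m , h) = ℕ.pred ℓ ℕ.* m , ≡.subst ([ 1ℚ ] ≤∞_) (Q.v-cong eq)
    (Q.v-+-min _ _ (Q.v-neg (ℚ.- x ℚ.- m • 1ℚ) h) (Q.v-neg _ (v-∣ (∣.m∣m*n {ℓ} m))))
    where
    open ≡.≡-Reasoning
    eq : ℚ.- (ℚ.- x ℚ.- m • 1ℚ) ℚ.- (ℓ ℕ.* m) • 1ℚ ≡ x ℚ.- (ℕ.pred ℓ ℕ.* m) • 1ℚ
    eq = begin
      ℚ.- (ℚ.- x ℚ.- m • 1ℚ) ℚ.- (ℓ ℕ.* m) • 1ℚ
        ≡⟨ ≡.cong (λ l → ℚ.- (ℚ.- x ℚ.- m • 1ℚ) ℚ.- (l ℕ.* m) • 1ℚ) (ℕ.suc-pred ℓ) ⟨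
      ℚ.- (ℚ.- x ℚ.- m • 1ℚ) ℚ.- (m ℕ.+ ℕ.pred ℓ ℕ.* m) • 1ℚ
        ≡⟨ ≡.cong (λ y → ℚ.- (ℚ.- x ℚ.- m • 1ℚ) ℚ.- y)
            (Mult.×-homo-+ Q.semiring 1ℚ m (ℕ.pred ℓ ℕ.* m)) ⟩
      ℚ.- (ℚ.- x ℚ.- m • 1ℚ) ℚ.- (m • 1ℚ ℚ.+ (ℕ.pred ℓ ℕ.* m) • 1ℚ)
        ≡⟨ cancel x (m • 1ℚ) ((ℕ.pred ℓ ℕ.* m) • 1ℚ) ⟩
      x ℚ.- (ℕ.pred ℓ ℕ.* m) • 1ℚ ∎
      where
      cancel : ∀ x m n → ℚ.- (ℚ.- x ℚ.- m) ℚ.- (m ℚ.+ n) ≡ x ℚ.- n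
      cancel = solve 3 (λ x m n → :- (:- x :- m) :- (m :+ n) := x :- n) ≡.refl

  clear-denominator : ∀ k d .(c : Coprimality.Coprime k (suc d)) →
    ℚ.mkℚ (+ k) d c ℚ.* (suc d • 1ℚ) ≡ k • 1ℚ
  clear-denominator k d c = ≡.trans (≡.cong (ℚ.mkℚ (+ k) d c ℚ.*_) (•1≡fromℕ (suc d)))
    (≡.trans (ℚ.toℚᵘ-injective (ℚᵘ.≃-trans (ℚ.toℚᵘ-homo-* (ℚ.mkℚ (+ k) d c) (fromℕ (suc d)))
      (ℚᵘ.*≡* (ℤ.*-assoc (+ k) (+ suc d) (+ 1))))) (≡.sym (•1≡fromℕ k)))

  -- Let x = k / D in lowest terms. Integrality forces D to be prime to ℓ, since otherwise ℓ would
  -- also divide k = x D. A Bézout relation e D ≡ ±1 modulo ℓ then gives x ≡ ±k e.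
  hasResidue-+ : ∀ k d .(c : Coprimality.Coprime k (suc d)) →
    Q.Integral (ℚ.mkℚ (+ k) d c) → HasResidue (ℚ.mkℚ (+ k) d c)
  hasResidue-+ k d c ix = result (Coprimality.coprime-Bézout (∤⇒coprime ℓ-prime ℓ∤d))
    where
    x : ℚ
    x = ℚ.mkℚ (+ k) d c
    D : ℚ
    D = suc d • 1ℚ
    xd≡k : x ℚ.* D ≡ k • 1ℚ
    xd≡k = clear-denominator k d c
    ℓ∤d : ¬ ℓ ∣ suc d
    ℓ∤d ℓ∣d = Primality.¬prime[1] (≡.subst Prime (Coprimality.recompute c (∣-v
      (≡.subst ([ 1ℚ ] ≤∞_) (Q.v-cong xd≡k) (Q.v-*ˡ x _ ix (v-∣ ℓ∣d))) , ℓ∣d)) ℓ-prime)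
    ke≡ : ∀ e → (k ℕ.* e) • 1ℚ ≡ x ℚ.* (e ℕ.* suc d) • 1ℚ
    ke≡ e = begin
      (k ℕ.* e) • 1ℚ               ≡⟨ Mult.×1-homo-* Q.semiring k e ⟩
      k • 1ℚ ℚ.* e • 1ℚ            ≡⟨ ≡.cong (ℚ._* e • 1ℚ) xd≡k ⟨
      x ℚ.* D ℚ.* e • 1ℚ           ≡⟨ ℚ.*-assoc x D (e • 1ℚ) ⟩
      x ℚ.* (D ℚ.* e • 1ℚ)         ≡⟨ ≡.cong (x ℚ.*_) (ℚ.*-comm D (e • 1ℚ)) ⟩
      x ℚ.* (e • 1ℚ ℚ.* D)         ≡⟨ ≡.cong (x ℚ.*_) (Mult.×1-homo-* Q.semiring e (suc d)) ⟨
      x ℚ.* (e ℕ.* suc d) • 1ℚ     ∎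
      where open ≡.≡-Reasoning
    small : ∀ f → [ 1ℚ ] ≤∞ v (x ℚ.* (f ℕ.* ℓ) • 1ℚ)
    small f = Q.v-*ˡ x _ ix (v-∣ (∣.n∣m*n f {ℓ}))
    result : Bézout.Identity 1 (suc d) ℓ → HasResidue x
    result (Bézout.+- e f eq) = k ℕ.* e , ≡.subst ([ 1ℚ ] ≤∞_)
      (Q.v-cong (≡.sym (≡.trans (≡.cong (λ y → x ℚ.- y) (≡.trans (ke≡ e)
        (≡.cong (λ n → x ℚ.* n • 1ℚ) (≡.sym eq)))) (expand x ((f ℕ.* ℓ) • 1ℚ)))))
            (Q.v-neg (x ℚ.* (f ℕ.* ℓ) • 1ℚ) (small f))
      where
      expand : ∀ x y → x ℚ.- x ℚ.* (1ℚ ℚ.+ y) ≡ ℚ.- (x ℚ.* y)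
      expand x y = ≡.trans (≡.cong (λ z → x ℚ.- z)
          (≡.trans (ℚ.*-distribˡ-+ x 1ℚ y) (≡.cong (ℚ._+ x ℚ.* y) (ℚ.*-identityʳ x))))
        (solve 2 (λ x z → x :- (x :+ z) := :- z) ≡.refl x (x ℚ.* y))
    result (Bézout.-+ e f eq) = hasResidue-neg {x} (k ℕ.* e , ≡.subst ([ 1ℚ ] ≤∞_)
      (Q.v-cong (≡.trans (≡.cong (λ n → ℚ.- (x ℚ.* n • 1ℚ)) (≡.sym eq))
          (≡.trans (expand x ((e ℕ.* suc d) • 1ℚ))
        (≡.cong (λ y → ℚ.- x ℚ.- y) (≡.sym (ke≡ e)))))) (Q.v-neg (x ℚ.* (f ℕ.* ℓ) • 1ℚ) (small f)))
      where
      expand : ∀ x y → ℚ.- (x ℚ.* (1ℚ ℚ.+ y)) ≡ ℚ.- x ℚ.- x ℚ.* y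
      expand x y = ≡.trans (≡.cong ℚ.-_ (≡.trans (ℚ.*-distribˡ-+ x 1ℚ y)
          (≡.cong (ℚ._+ x ℚ.* y) (ℚ.*-identityʳ x))))
        (solve 2 (λ x z → :- (x :+ z) := :- x :- z) ≡.refl x (x ℚ.* y))

  hasResidue : ∀ x → Q.Integral x → HasResidue x
  hasResidue (ℚ.mkℚ (+ k) d c) ix = hasResidue-+ k d c ix
  hasResidue (ℚ.mkℚ -[1+ k ] d c) ix =
    hasResidue-neg {ℚ.mkℚ -[1+ k ] d c} (hasResidue-+ (suc k) d c (Q.v-neg (ℚ.mkℚ -[1+ k ] d c) ix))

search-finds : ∀ {P : Pred ℕ 0ℓ} (P? : ∀ m → Dec (P m)) n {m} → m ℕ.< n → P m → P (search P? n)
search-finds P? (suc n) {m} m<1+n Pm with P? n | ℕ.m≤n⇒m<n∨m≡n (ℕ.s≤s⁻¹ m<1+n)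
... | yes Pn | _ = Pn
... | no _   | inj₁ m<n = search-finds P? n m<n Pm
... | no ¬Pn | inj₂ ≡.refl = contradiction Pm ¬Pn

-- For negative r the exponent is the absolute value of the floor, and the floor is at most r. Hence
-- ℓ^n x is integral for the exponent n attached to v x.
-denominator≤ : ∀ r → ℚ.- fromℕ (denominator [ r ]) ℚ.≤ r
-denominator≤ r = cases r (0ℚ ℚ.≤? r)
  where
  lower-bound : ∀ n d .(c : Coprimality.Coprime ℤ.∣ n ∣ (suc d)) i → i ℤ.* + suc d ℤ.≤ n →
      ℚ.- fromℕ ℤ.∣ i ∣ ℚ.≤ ℚ.mkℚ n d c
  lower-bound n d c (+ zero)  le = ℚ.*≤* (ℤ.≤-trans le (ℤ.≤-reflexive (≡.sym (ℤ.*-identityʳ n))))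
  lower-bound n d c (+ suc k) le = ℚ.*≤* (ℤ.≤-trans (ℤ.≤-trans ℤ.-≤+ le)
      (ℤ.≤-reflexive (≡.sym (ℤ.*-identityʳ n))))
  lower-bound n d c -[1+ k ]  le = ℚ.*≤* (ℤ.≤-trans le (ℤ.≤-reflexive (≡.sym (ℤ.*-identityʳ n))))
  cases : ∀ r (0≤?r : Dec (0ℚ ℚ.≤ r)) → ℚ.- fromℕ (if does 0≤?r then 0 else ℤ.∣ ℚ.floor r ∣) ℚ.≤ r
  cases r (yes 0≤r) = 0≤r
  cases (ℚ.mkℚ n d c) (no _) = lower-bound n d c (n ℤ./ (+ suc d)) (ℤ.[n/d]*d≤n n (+ suc d))

-- The additive character x ↦ ζ^x of ℚ_ℓ

module AdditiveCharacter (em : Classical) {ℓ : ℕ} (ℓ-prime : Prime ℓ) (ℚₗ : PAdicNumbers ℓ)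
  {ℂ : ValuedField} (roots : CompatibleRoots ℓ ℂ) where
  open PAdicNumbers ℚₗ
  open ValuedField valuedField hiding (zero)
  open ValuedFieldProperties em valuedField
  open IntegerSolver commutativeRing
  open IsCompletion isCompletion using (isEmbedding; dense)
  open EmbeddingProperties isEmbedding
  open Exponential ℚₗ roots
  open CompatibleRoots roots
  open PAdicValuation rationals using (v-p; v-unit)
  private
    module Q = ValuedField (PAdicValuation.valuedField rationals)
    module ℂ = ValuedField ℂ
  open RationalResidues ℓ-prime rationals using (hasResidue; 1≰0; ℓ-nonZero)

  vℓ≡1 : v (ℓ • 1#) ≡ [ 1ℚ ]
  vℓ≡1 = ≡.trans (v-• ℓ) v-p

  ℓ-inverse : ∃[ y ] ℓ • 1# * y ≈ 1#
  ℓ-inverse = inverse {ℓ • 1#} λ ℓ≈0 → contradiction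
      (≡.trans (≡.sym vℓ≡1) (≡.trans (v-cong ℓ≈0) v-0)) λ ()

  v-ℓ^ : ∀ n → v (ℓ^ n) ≡ [ n ℚ• 1ℚ ]
  v-ℓ^ = v-^ vℓ≡1

  •-integral : ∀ m → Integral (m • 1#)
  •-integral zero    = 0-integral
  •-integral (suc m) = +-integral 1-integral (•-integral m)

  •-+ : ∀ m n → (m ℕ.+ n) • 1# ≈ m • 1# + n • 1#
  •-+ = Mult.×-homo-+ semiring 1#

  •-* : ∀ m n → (m ℕ.* n) • 1# ≈ m • 1# * n • 1#
  •-* = Mult.×1-homo-* semiring

  ℓ^-integral : ∀ n → Integral (ℓ^ n)
  ℓ^-integral zero    = 1-integral
  ℓ^-integral (suc n) = *-integral (•-integral ℓ) (ℓ^-integral n)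

  ℓ^≈ : ∀ n → ℓ^ n ≈ (ℓ ℕ.^ n) • 1#
  ℓ^≈ zero    = sym (+-identityʳ 1#)
  ℓ^≈ (suc n) = trans (*-congˡ (ℓ^≈ n)) (sym (•-* ℓ (ℓ ℕ.^ n)))

  v-ℓ^≤⇒∣ : ∀ n m → v (ℓ^ n) ≤∞ v (m • 1#) → ℓ ℕ.^ n ∣ m
  v-ℓ^≤⇒∣ zero    m le = ∣.1∣ m
  v-ℓ^≤⇒∣ (suc n) m le with ℓ ∣.∣? m
  ... | no ℓ∤m = contradiction (≡.subst₂ _≤∞_ vℓ≡1 (≡.trans (v-• m) (v-unit m ℓ∤m))
    (≤∞-trans (v-*≥ˡ (ℓ • 1#) (ℓ^-integral n)) le)) 1≰0
  ... | yes (∣.divides k ≡.refl) = ≡.subst (ℓ ℕ.* ℓ ℕ.^ n ∣_) (ℕ.*-comm ℓ k)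
      (∣.*-monoʳ-∣ ℓ (v-ℓ^≤⇒∣ n k
    (v-*-cancel (ℓ^ n) (k • 1#) (proj₂ ℓ-inverse) (≡.subst (v (ℓ • 1# * ℓ^ n) ≤∞_)
      (v-cong (trans (•-* k ℓ) (*-comm _ _))) le))))

  -- By density some rational number agrees with u to precision 1, and it has a residue by the
  -- Bézout argument. Reducing that residue below ℓ moves the quotient into y.
  residue₁ : ∀ u → Integral u → ∃[ m ] m ℕ.< ℓ × (∃[ y ] Integral y × u ≈ m • 1# + ℓ • 1# * y)
  residue₁ u iu =
    let x , u-x = dense u 1ℚ
        ix : Q.Integral x
        ix = ≡.subst (0∞ ≤∞_) (IsEmbedding.isometric isEmbedding x)
          (≤v-cong (solve 2 (λ u x → u :- (u :- x) := x) refl u (ι x))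
            (v-+-neg u (u - ι x) iu (≤∞-trans [ ℚ.<⇒≤ (ℚ.positive⁻¹ 1ℚ) ] u-x)))
        m , x-m = hasResidue x ix
        r = m ℕ.% ℓ
        u-m : [ 1ℚ ] ≤∞ v (u - m • 1#)
        u-m = v-trans u (ι x) (m • 1#) u-x (≤v-cong
            (trans (ι-- x (m Q.• Q.1#)) (+-congˡ (-‿cong (ι-• m))))
          (≡.subst ([ 1ℚ ] ≤∞_) (≡.sym (IsEmbedding.isometric isEmbedding _)) x-m))
        y , iy , eq = ≤v⇒∣ {ℓ • 1#} (proj₂ ℓ-inverse)
            (≡.subst (_≤∞ v (u - m • 1#)) (≡.sym vℓ≡1) u-m)
    in r , ℕ.m%n<n m ℓ , y + (m ℕ./ ℓ) • 1# , +-integral iy (•-integral (m ℕ./ ℓ)) , carry u m y eq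
    where
    carry : ∀ u m y → u - m • 1# ≈ ℓ • 1# * y → u ≈ (m ℕ.% ℓ) • 1# + ℓ • 1# * (y + (m ℕ./ ℓ) • 1#)
    carry u m y eq = begin
      u
          ≈⟨ solve 2 (λ u m → u := m :+ (u :- m)) refl u (m • 1#) ⟩
      m • 1# + (u - m • 1#)
          ≈⟨ +-cong (reflexive (≡.cong (_• 1#) (ℕ.m≡m%n+[m/n]*n m ℓ))) eq ⟩
      (r ℕ.+ d ℕ.* ℓ) • 1# + ℓ • 1# * y
          ≈⟨ +-congʳ (trans (•-+ r (d ℕ.* ℓ)) (+-congˡ (•-* d ℓ))) ⟩
      r • 1# + d • 1# * ℓ • 1# + ℓ • 1# * y
          ≈⟨ solve 4 (λ r d l y → r :+ d :* l :+ l :* y := r :+ l :* (y :+ d))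
          refl (r • 1#) (d • 1#) (ℓ • 1#) y ⟩
      r • 1# + ℓ • 1# * (y + d • 1#)             ∎
      where
      open SetoidReasoning setoid
      r d : ℕ
      r = m ℕ.% ℓ
      d = m ℕ./ ℓ

  -- This is the base-ℓ expansion of u, with lowest digit from `residue₁` and the others from the
  -- integral remainder. It guarantees that the `search` defining `residue` succeeds.
  residue-exists : ∀ n u → Integral u → ∃[ m ] m ℕ.< ℓ ℕ.^ n × Congruent n u m
  residue-exists zero u iu = 0 , ℕ.s≤s ℕ.z≤n ,
      ≡.subst (_≤∞ v (u - 0#)) (≡.sym v-1) (v-+-neg u 0# iu 0-integral)
  residue-exists (suc n) u iu =
    let r , r<ℓ , y , iy , eq = residue₁ u iu
        m , m<ℓ^n , y-m = residue-exists n y iy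
    in r ℕ.+ ℓ ℕ.* m , bound r<ℓ m<ℓ^n , ≤v-cong (factor r m y u eq)
      (v-*-monoʳ (ℓ • 1#) y-m)
    where
    bound : ∀ {r m} → r ℕ.< ℓ → m ℕ.< ℓ ℕ.^ n → r ℕ.+ ℓ ℕ.* m ℕ.< ℓ ℕ.* ℓ ℕ.^ n
    bound {r} {m} r<ℓ m<ℓ^n = ℕ.<-≤-trans (ℕ.+-monoˡ-< (ℓ ℕ.* m) r<ℓ)
      (ℕ.≤-trans (ℕ.≤-reflexive (≡.sym (ℕ.*-suc ℓ m))) (ℕ.*-monoʳ-≤ ℓ m<ℓ^n))
    factor : ∀ r m y u → u ≈ r • 1# + ℓ • 1# * y → ℓ • 1# * (y - m • 1#) ≈ u - (r ℕ.+ ℓ ℕ.* m) • 1#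
    factor r m y u eq = begin
      ℓ • 1# * (y - m • 1#)
          ≈⟨ solve 4 (λ r l y m → l :* (y :- m) := r :+ l :* y :- (r :+ l :* m))
          refl (r • 1#) (ℓ • 1#) y (m • 1#) ⟩
      r • 1# + ℓ • 1# * y - (r • 1# + ℓ • 1# * m • 1#)
          ≈⟨ +-cong eq (-‿cong (trans (•-+ r (ℓ ℕ.* m)) (+-congˡ (•-* ℓ m)))) ⟨
      u - (r ℕ.+ ℓ ℕ.* m) • 1#                     ∎
      where open SetoidReasoning setoid

  residue-congruent : ∀ n u → Integral u → Congruent n u (residue n u)
  residue-congruent n u iu = let m , m< , c = residue-exists n u iu in
    search-finds (λ m → v (ℓ^ n) ≤∞? v (u - m • 1#)) (ℓ ℕ.^ n) m< c

  denominator-clears : ∀ x → Integral (ℓ^ (denominator (v x)) * x)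
  denominator-clears x = ≡.subst (0∞ ≤∞_) (≡.sym
      (≡.trans (v-* _ x) (≡.cong (_+∞ v x) (v-ℓ^ (denominator (v x))))))
    (clears (v x))
    where
    clears : ∀ a → 0∞ ≤∞ [ denominator a ℚ• 1ℚ ] +∞ a
    clears ⊤⁺    = _ ≤⊤⁺
    clears [ r ] = [ ≡.subst₂ ℚ._≤_ (ℚ.+-inverseʳ (fromℕ n)) (≡.cong (ℚ._+ r) (≡.sym (•1≡fromℕ n)))
                      (ℚ.+-monoʳ-≤ (fromℕ n) (-denominator≤ r)) ]
      where n = denominator [ r ]

  -- ζ^ x = ζₙ^m, without n being minimal or m reduced.
  Represents : ℕ → ℕ → Carrier → Set
  Represents n m x = Congruent n (ℓ^ n * x) m

  represents-canonical : ∀ x → Represents (denominator (v x))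
      (residue (denominator (v x)) (ℓ^ (denominator (v x)) * x)) x
  represents-canonical x = residue-congruent (denominator (v x)) (ℓ^ (denominator (v x)) * x)
      (denominator-clears x)

  -- The fraction m / ℓ^n is expanded by ℓ^j, and compatibility of the roots leaves its value
  -- unchanged. Any two elements thus acquire a common denominator.
  represents-lift : ∀ j {n m x} → Represents n m x →
    Represents (j ℕ.+ n) (ℓ ℕ.^ j ℕ.* m) x × ζ (j ℕ.+ n) ℂ.^ (ℓ ℕ.^ j ℕ.* m) ℂ.≈ ζ n ℂ.^ m
  represents-lift zero {n} {m} {x} rep = ≡.subst
      (λ m → Represents n m x) (≡.sym (ℕ.*-identityˡ m)) rep ,
    ℂ.reflexive (≡.cong (ζ n ℂ.^_) (ℕ.*-identityˡ m))
  represents-lift (suc j) {n} {m} {x} rep =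
    let rep′ , eq = represents-lift j rep in
    ≤v-cong factor (v-*-monoʳ (ℓ • 1#) rep′) , ℂ.trans power eq
    where
    k l : ℕ
    k = j ℕ.+ n
    l = ℓ ℕ.^ j ℕ.* m
    factor : ℓ • 1# * (ℓ^ k * x - l • 1#) ≈ ℓ^ suc k * x - (ℓ ℕ.* ℓ ℕ.^ j ℕ.* m) • 1#
    factor = begin
      ℓ • 1# * (ℓ^ k * x - l • 1#)
        ≈⟨ solve 4 (λ p t x l → p :* (t :* x :- l) := p :* t :* x :- p :* l)
            refl (ℓ • 1#) (ℓ^ k) x (l • 1#) ⟩
      ℓ^ suc k * x - ℓ • 1# * l • 1#
        ≈⟨ +-congˡ (-‿cong (•-* ℓ l)) ⟨
      ℓ^ suc k * x - (ℓ ℕ.* l) • 1#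
        ≈⟨ +-congˡ (-‿cong (reflexive (≡.cong (_• 1#) (≡.sym (ℕ.*-assoc ℓ (ℓ ℕ.^ j) m))))) ⟩
      ℓ^ suc k * x - (ℓ ℕ.* ℓ ℕ.^ j ℕ.* m) • 1#    ∎
      where open SetoidReasoning setoid
    power : ζ (suc k) ℂ.^ (ℓ ℕ.* ℓ ℕ.^ j ℕ.* m) ℂ.≈ ζ k ℂ.^ l
    power = ℂ.trans (ℂ.reflexive (≡.cong (ζ (suc k) ℂ.^_) (ℕ.*-assoc ℓ (ℓ ℕ.^ j) m)))
      (ℂ.trans (ℂ.sym (Exp.^-assocʳ ℂ.semiring (ζ (suc k)) ℓ l))
          (Exp.^-congˡ ℂ.semiring l (compatible k)))

  ζ-periodic : ∀ n m d → ℓ ℕ.^ n ∣ d → ζ n ℂ.^ (m ℕ.+ d) ℂ.≈ ζ n ℂ.^ m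
  ζ-periodic n m d (∣.divides c ≡.refl) = begin
    ζ n ℂ.^ (m ℕ.+ c ℕ.* ℓ ℕ.^ n)            ≈⟨ Exp.^-homo-* ℂ.semiring (ζ n) m _ ⟩
    ζ n ℂ.^ m ℂ.* ζ n ℂ.^ (c ℕ.* ℓ ℕ.^ n)    ≈⟨ ℂ.*-congˡ (one c) ⟩
    ζ n ℂ.^ m ℂ.* ℂ.1#                       ≈⟨ ℂ.*-identityʳ _ ⟩
    ζ n ℂ.^ m                                ∎
    where
    open SetoidReasoning ℂ.setoid
    one : ∀ c → ζ n ℂ.^ (c ℕ.* ℓ ℕ.^ n) ℂ.≈ ℂ.1#
    one zero    = ℂ.refl
    one (suc c) = ℂ.trans (Exp.^-homo-* ℂ.semiring (ζ n) (ℓ ℕ.^ n) _)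
      (ℂ.trans (ℂ.*-cong (ζ-root n) (one c)) (ℂ.*-identityˡ ℂ.1#))

  represents-unique-≤ : ∀ n x {m m′} → m ℕ.≤ m′ → Represents n m x → Represents n m′ x → ζ n ℂ.^ m
      ℂ.≈ ζ n ℂ.^ m′
  represents-unique-≤ n x {m} {m′} m≤m′ rep rep′ = ℂ.trans
      (ℂ.sym (ζ-periodic n m d (v-ℓ^≤⇒∣ n d (≤v-cong difference
      (v-trans (m′ • 1#) (ℓ^ n * x) (m • 1#) (v-swap (ℓ^ n * x) (m′ • 1#) rep′) rep)))))
    (ℂ.reflexive (≡.cong (ζ n ℂ.^_) (ℕ.m+[n∸m]≡n m≤m′)))
    where
    d : ℕ
    d = m′ ℕ.∸ m
    difference : m′ • 1# - m • 1# ≈ d • 1#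
    difference = trans (+-congʳ (trans (reflexive
        (≡.cong (_• 1#) (≡.sym (ℕ.m+[n∸m]≡n m≤m′)))) (•-+ m d)))
      (solve 2 (λ m d → m :+ d :- m := d) refl (m • 1#) (d • 1#))

  represents-unique : ∀ {n m m′ x} → Represents n m x → Represents n m′ x → ζ n ℂ.^ m ℂ.≈ ζ n ℂ.^ m′
  represents-unique {n} {m} {m′} {x} rep rep′ with ℕ.≤-total m m′
  ... | inj₁ m≤m′ = represents-unique-≤ n x m≤m′ rep rep′
  ... | inj₂ m′≤m = ℂ.sym (represents-unique-≤ n x m′≤m rep′ rep)

  -- The canonical representation at level n₀ and the given one at level n are lifted to level n +
  -- n₀, where the exponents differ only by a multiple of ℓ^(n + n₀).
  represents⇒ζ^ : ∀ {n m x} → Represents n m x → ζ^ x ℂ.≈ ζ n ℂ.^ m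
  represents⇒ζ^ {n} {m} {x} rep =
    let n₀ = denominator (v x)
        rep₁ , eq₁ = represents-lift n (represents-canonical x)
        rep₂ , eq₂ = represents-lift n₀ {n} {m} rep
    in ℂ.trans (ℂ.sym eq₁) (ℂ.trans (represents-unique {n ℕ.+ n₀}
        {ℓ ℕ.^ n ℕ.* residue n₀ (ℓ^ n₀ * x)} {ℓ ℕ.^ n₀ ℕ.* m} rep₁
        (≡.subst (λ k → Represents k (ℓ ℕ.^ n₀ ℕ.* m) x) (ℕ.+-comm n₀ n) rep₂))
      (ℂ.trans (ℂ.reflexive (≡.cong (λ k → ζ k ℂ.^ (ℓ ℕ.^ n₀ ℕ.* m)) (ℕ.+-comm n n₀))) eq₂))

  represents-+ : ∀ {n m m′ x y} → Represents n m x → Represents n m′ y →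
      Represents n (m ℕ.+ m′) (x + y)
  represents-+ {n} {m} {m′} {x} {y} rep rep′ = ≤v-cong
    (+-cong (sym (distribˡ (ℓ^ n) x y)) (-‿cong (sym (•-+ m m′)))) (v-+-diff _ _ _ _ rep rep′)

  -- Over a common denominator the exponents add.
  ζ^-+ : ∀ x y → ζ^ (x + y) ℂ.≈ ζ^ x ℂ.* ζ^ y
  ζ^-+ x y = ℂ.trans (represents⇒ζ^ {N} {k ℕ.+ l} (represents-+ {N} {k} {l} rep-x rep-y))
    (ℂ.trans (Exp.^-homo-* ℂ.semiring (ζ N) k l)
      (ℂ.*-cong (ℂ.sym (represents⇒ζ^ {N} {k} rep-x)) (ℂ.sym (represents⇒ζ^ {N} {l} rep-y))))
    where
    n m N k l : ℕ
    n = denominator (v x)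
    m = denominator (v y)
    N = m ℕ.+ n
    k = ℓ ℕ.^ m ℕ.* residue n (ℓ^ n * x)
    l = ℓ ℕ.^ n ℕ.* residue m (ℓ^ m * y)
    rep-x : Represents N k x
    rep-x = proj₁ (represents-lift m (represents-canonical x))
    rep-y : Represents N l y
    rep-y = ≡.subst (λ N → Represents N l y) (ℕ.+-comm n m)
        (proj₁ (represents-lift n (represents-canonical y)))

  integral⇒ζ^≈1 : ∀ {x} → Integral x → ζ^ x ℂ.≈ ℂ.1#
  integral⇒ζ^≈1 {x} ix = represents⇒ζ^ {0} {0} (≡.subst (_≤∞ v (1# * x - 0#)) (≡.sym v-1)
    (v-+-neg (1# * x) 0# (*-integral 1-integral ix) 0-integral))

  -- Primitivity of the root makes ℓ^n divide the exponent m, and m is congruent to ℓ^n x modulo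
  -- ℓ^n. This is the half of duality that makes the conductor exact.
  ζ^≈1⇒integral : ∀ {x} → ζ^ x ℂ.≈ ℂ.1# → Integral x
  ζ^≈1⇒integral {x} eq =
    let n = denominator (v x)
        m = residue n (ℓ^ n * x)
        y , ℓ^y≈1 = ℓ^-inverse n
    in ≡.subst (_≤∞ v x) v-1 (v-*-cancel 1# x ℓ^y≈1 (≤v-cong
         (solve 2 (λ x m → (x :- m) :+ m := x) refl (ℓ^ n * x) (m • 1#))
         (≡.subst (_≤∞ v (ℓ^ n * x - m • 1# + m • 1#)) (v-cong (sym (*-identityʳ (ℓ^ n))))
           (v-+-min _ _ (represents-canonical x) (∣⇒v-ℓ^≤ n m (ζ-primitive n m eq))))))
    where
    ℓ^-inverse : ∀ n → ∃[ y ] ℓ^ n * y ≈ 1#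
    ℓ^-inverse n = inverse {ℓ^ n} λ ℓ^≈0 → contradiction
        (≡.trans (≡.sym (v-ℓ^ n)) (≡.trans (v-cong ℓ^≈0) v-0)) λ ()
    ∣⇒v-ℓ^≤ : ∀ n m → ℓ ℕ.^ n ∣ m → v (ℓ^ n) ≤∞ v (m • 1#)
    ∣⇒v-ℓ^≤ n m (∣.divides c ≡.refl) = ≤v-cong
      (trans (*-congʳ (ℓ^≈ n)) (trans (*-comm _ _) (sym (•-* c (ℓ ℕ.^ n)))))
          (v-*≥ˡ (ℓ^ n) (•-integral c))

-- Approximate sums and linear functionals

-- The coset-sum identities for this monoid are the identities up to an error
-- of valuation at least r.
nearMonoid : ValuedField → ℚ∞ → CommutativeMonoid 0ℓ 0ℓ
nearMonoid L r = record
  { Carrier = Carrier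
  ; _≈_ = λ x y → r ≤∞ v (x - y)
  ; _∙_ = _+_
  ; ε = 0#
  ; isCommutativeMonoid = record
    { isMonoid = record
      { isSemigroup = record
        { isMagma = record
          { isEquivalence = record { refl = v-≈ _ _
              refl ; sym = v-swap _ _ ; trans = v-trans _ _ _ }
          ; ∙-cong = v-+-diff _ _ _ _ }
        ; assoc = λ x y z → v-≈ _ _ (+-assoc x y z) }
      ; identity = (λ x → v-≈ _ _ (+-identityˡ x)) , (λ x → v-≈ _ _ (+-identityʳ x)) }
    ; comm = λ x y → v-≈ _ _ (+-comm x y) }
  }
  where open ValuedField L

module Functionals (K ℂ : ValuedField) where
  open FunctionSpaces K ℂ
  open ValuedField ℂ

  linear : ∀ {m} {M : RawLeftModule 𝔬 m 0ℓ} (let open RawLeftModule M) {φ : Carrierᴹ → Carrier} →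
    (∀ {f g} → f ≈ᴹ g → φ f ≈ φ g) → (∀ f g → φ (f +ᴹ g) ≈ φ f + φ g) → φ 0ᴹ ≈ 0# →
    (∀ f → φ (-ᴹ f) ≈ - φ f) → (∀ c f → φ (c *ₗ f) ≈ proj₁ c * φ f) →
    IsLeftModuleHomomorphism M ℂ-module φ
  linear φ-cong φ-+ φ-0 φ-- φ-* = record
    { +ᴹ-isGroupHomomorphism = record
      { isMonoidHomomorphism = record
        { isMagmaHomomorphism = record
          { isRelHomomorphism = record { cong = φ-cong }
          ; homo = φ-+ }
        ; ε-homo = φ-0 }
      ; ⁻¹-homo = φ-- }
    ; *ₗ-homo = φ-* }

  -- A common interface to `𝒞` and `𝒞₀`, so that linearity of finite weighted sums is shown once for
  -- measures and Riemann sums alike.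
  record Evaluation {m} (M : RawLeftModule 𝔬 m 0ℓ) : Set m where
    open RawLeftModule M
    field
      eval      : Carrierᴹ → ValuedField.Carrier K → Carrier
      eval-≈    : ∀ {f g} → f ≈ᴹ g → ∀ x → eval f x ≈ eval g x
      eval-+    : ∀ f g x → eval (f +ᴹ g) x ≈ eval f x + eval g x
      eval-0    : ∀ x → eval 0ᴹ x ≈ 0#
      eval-neg  : ∀ f x → eval (-ᴹ f) x ≈ - eval f x
      eval-*    : ∀ c f x → eval (c *ₗ f) x ≈ proj₁ c * eval f x

  𝒞-evaluation : Evaluation 𝒞-module
  𝒞-evaluation = record { eval = 𝒞.to ; eval-≈ = λ e → e ; eval-+ = λ _ _ _ →
      refl ; eval-0 = λ _ → refl
    ; eval-neg = λ _ _ → refl ; eval-* = λ _ _ _ → refl }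

  𝒞₀-evaluation : Evaluation 𝒞₀-module
  𝒞₀-evaluation = record { eval = 𝒞₀.to ; eval-≈ = λ e → e ; eval-+ = λ _ _ _ →
      refl ; eval-0 = λ _ → refl
    ; eval-neg = λ _ _ → refl ; eval-* = λ _ _ _ → refl }

  module Limit (em : Classical) {m} (M : RawLeftModule 𝔬 m 0ℓ) where
    open RawLeftModule M
    open ValuedFieldProperties em ℂ
    private module L {φ} (l : IsLeftModuleHomomorphism M ℂ-module φ) = IsLeftModuleHomomorphism l

    limit-linear : ∀ {Λ : ℕ → Carrierᴹ → Carrier} {λ∞ : Carrierᴹ → Carrier} →
      (∀ n → IsLeftModuleHomomorphism M ℂ-module (Λ n)) → (∀ f → (λ n → Λ n f) ⟶ λ∞ f) →
      IsLeftModuleHomomorphism M ℂ-module λ∞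
    limit-linear {Λ} {λ∞} lin lim = linear
      (λ {f} {g} f≈g → ⟶-unique (⟶-cong (λ n → L.⟦⟧-cong (lin n) f≈g) (lim f)) (lim g))
      (λ f g → ⟶-unique (lim (f +ᴹ g)) (⟶-cong
          (λ n → sym (L.+ᴹ-homo (lin n) f g)) (⟶-+ (lim f) (lim g))))
      (⟶-unique (lim 0ᴹ) (⟶-cong (λ n → sym (L.0ᴹ-homo (lin n))) (⟶-const 0#)))
      (λ f → ⟶-unique (lim (-ᴹ f)) (⟶-cong (λ n → sym (L.-ᴹ-homo (lin n) f)) (⟶-neg (lim f))))
      (λ c f → ⟶-unique (lim (c *ₗ f)) (⟶-cong
          (λ n → sym (L.*ₗ-homo (lin n) c f)) (⟶-* (proj₁ c) (lim f))))

-- Finite Fourier inversion and density of characters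

module Analysis (em : Classical) {F : ValuedField} (K : FiniteExtension F)
  (complete : ValuedField.Complete (FiniteExtension.valuedField K)) (localData : LocalData K)
  (ϖ : ValuedField.Carrier (FiniteExtension.valuedField K))
  (πϖ≈1 : Inverses (FiniteExtension.valuedField K) (LocalData.π localData) ϖ)
  (ℂ : ValuedField) (ℂ-complete : ValuedField.Complete ℂ)
  (q⁻¹ : ValuedField.Carrier ℂ)
  (qq⁻¹≈1 : Inverses ℂ (ValuedField._•_ ℂ (LocalData.q localData) (ValuedField.1# ℂ)) q⁻¹)
  (q⁻¹-integral : ValuedField.Integral ℂ q⁻¹)
  where
  open LocalField em K complete localData ϖ πϖ≈1
  open LocalData localData hiding (different)
  private
    module K = ValuedField (FiniteExtension.valuedField K)
    module KP = ValuedFieldProperties em (FiniteExtension.valuedField K)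
    module KS = IntegerSolver K.commutativeRing
    module ℂ = ValuedField ℂ
    module ℂP = ValuedFieldProperties em ℂ
    module ℂS = IntegerSolver ℂ.commutativeRing
  open ℂ using (_≈_; _+_; _*_; _-_; 0#; 1#; v; Integral; _⟶_; Cauchy)
  open CosetSumProperties ℂ.+-commutativeMonoid
  open Concentration ℂ
  open Topology (FiniteExtension.valuedField K) using (CompactOpen)
  open FunctionSpaces (FiniteExtension.valuedField K) ℂ
  open Functionals (FiniteExtension.valuedField K) ℂ

  q^ q⁻^ : ℕ → ℂ.Carrier
  q^  k = (q ℂ.• 1#) ℂ.^ k
  q⁻^ k = q⁻¹ ℂ.^ k

  q⁻^-integral : ∀ k → Integral (q⁻^ k)
  q⁻^-integral zero    = ℂ.1-integral
  q⁻^-integral (suc k) = ℂ.*-integral q⁻¹-integral (q⁻^-integral k)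

  q⁻^q^≈1 : ∀ k → q⁻^ k * q^ k ≈ 1#
  q⁻^q^≈1 zero    = ℂ.*-identityˡ 1#
  q⁻^q^≈1 (suc k) = begin
    q⁻¹ * q⁻^ k * (q ℂ.• 1# * q^ k)    ≈⟨ ℂS.solve 4
        (λ p t x y → p ℂS.:* t ℂS.:* (x ℂS.:* y) ℂS.:= x ℂS.:* p ℂS.:* (t ℂS.:* y))
        ℂ.refl q⁻¹ (q⁻^ k) (q ℂ.• 1#) (q^ k) ⟩
    q ℂ.• 1# * q⁻¹ * (q⁻^ k * q^ k)    ≈⟨ ℂ.*-cong qq⁻¹≈1 (q⁻^q^≈1 k) ⟩
    1# * 1#                            ≈⟨ ℂ.*-identityˡ 1# ⟩
    1#                                 ∎
    where open SetoidReasoning ℂ.setoid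

  S-const : ∀ k c → S k (λ _ → c) ≈ q^ k * c
  S-const zero    c = ℂ.sym (ℂ.*-identityˡ c)
  S-const (suc k) c = begin
    ℂ.sum {q} (λ _ → S k (λ _ → c))  ≈⟨ sum-replicate q ⟩
    q ℂ.• S k (λ _ → c)              ≈⟨ Mult.×-congʳ ℂ.semiring q
        (ℂ.trans (S-const k c) (ℂ.sym (ℂ.*-identityˡ _))) ⟩
    q ℂ.• (1# * (q^ k * c))          ≈⟨ Mult.×-assoc-* ℂ.semiring q 1# (q^ k * c) ⟨
    q ℂ.• 1# * (q^ k * c)            ≈⟨ ℂ.*-assoc _ _ _ ⟨
    q^ (suc k) * c                   ∎
    where
    open SetoidReasoning ℂ.setoid
    open Sums ℂ.semiring using (sum-replicate)

  module NearSums (r : ℚ∞) where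
    open CosetSumProperties (nearMonoid ℂ r) using () renaming
        (S to S′; S-shift to S′-shift; S-cong to S′-cong)

    private
      near-S : ∀ k φ → S′ k φ ≡ S k φ
      near-S k φ = cosetSum-rel (CommutativeMonoid.rawMonoid (nearMonoid ℂ r)) ℂ.+-rawMonoid _≡_
          ≡.refl (≡.cong₂ _+_) k (λ _ _ → ≡.refl)

    -- `nearMonoid` has the operations of ℂ and only a coarser equality, so its coset sums are the
    -- original ones; shift invariance there is approximate shift invariance here.
    S-shift-near : ∀ k {φ b} → K.Integral b →
      (∀ {x y} → K.Integral x → K.Integral y → K.v (π K.^ k) ≤∞ K.v (x K.- y) →
          r ≤∞ v (φ x - φ y)) →
      r ≤∞ v (S k (λ x → φ (x K.+ b)) - S k φ)
    S-shift-near k {φ} {b} ib per = ≡.subst₂ (λ x y → r ≤∞ v (x - y)) (near-S k _) (near-S k φ)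
        (S′-shift k {φ} ib per)
  open NearSums public

  ϖ^π^-cancel : ∀ m n → ϖ K.^ m K.* π K.^ (m ℕ.+ n) K.≈ π K.^ n
  ϖ^π^-cancel m n = begin
    ϖ K.^ m K.* π K.^ (m ℕ.+ n)          ≈⟨ K.*-congˡ (π^-+ m n) ⟩
    ϖ K.^ m K.* (π K.^ m K.* π K.^ n)    ≈⟨ KS.solve 3
        (λ a b c → a KS.:* (b KS.:* c) KS.:= b KS.:* a KS.:* c)
        K.refl (ϖ K.^ m) (π K.^ m) (π K.^ n) ⟩
    π K.^ m K.* ϖ K.^ m K.* π K.^ n      ≈⟨ K.*-congʳ (π^ϖ^≈1 m) ⟩
    K.1# K.* π K.^ n                     ≈⟨ K.*-identityˡ _ ⟩
    π K.^ n                              ∎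
    where open SetoidReasoning K.setoid

  ϖ^-integral⇔ : ∀ k {x} → K.Integral (ϖ K.^ k K.* x) ⇔ K.v (π K.^ k) ≤∞ K.v x
  ϖ^-integral⇔ k {x} = mk⇔
    (λ i → KP.≤v-cong (KP.inverse-cancelˡ x (π^ϖ^≈1 k)) (KP.v-*≥ˡ (π K.^ k) i))
    (λ le → ≡.subst (_≤∞ K.v (ϖ K.^ k K.* x)) KP.v-1 (KP.≤v-cong K.refl (≡.subst₂ _≤∞_
      (≡.trans (≡.sym (K.v-* (ϖ K.^ k) (π K.^ k))) (K.v-cong (K.trans (K.*-comm _ _) (π^ϖ^≈1 k))))
      (≡.sym (K.v-* (ϖ K.^ k) x)) (+∞-mono (≤∞-refl {K.v (ϖ K.^ k)}) le))))

  uniform-on-disc : ∀ (f : Fun) → Continuous f → ∀ M r →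
    ∃[ n ] ∀ x y → Disc M x → K.v (π K.^ n) ≤∞ K.v (x K.- y) → near r (Func.to f x) (Func.to f y)
  uniform-on-disc f continuous M r =
    let s , uniform = compact-uniform (Func.to f) (near r)
          (λ p q → ℂ.v-trans _ _ _ p (ℂ.v-swap _ _ q))
                        (λ x → continuous x r) (proj₁ (disc-compactOpen M))
        n , s≤ = π^-deep s
    in n , λ x y x∈ x-y → uniform x y x∈ (≤∞-trans s≤ x-y)

  module _ {m} {M : RawLeftModule ℂ.𝔬 m 0ℓ} (E : Evaluation M) where
    open RawLeftModule M
    open Evaluation E

    weightedSum : ℕ → K.Carrier → (K.Carrier → ℂ.Carrier) → Carrierᴹ → ℂ.Carrier
    weightedSum k c w f = S k (λ x → eval f (c K.* x) * w x)

    weightedSum-linear : ∀ k c w → IsLeftModuleHomomorphism M ℂ-module (weightedSum k c w)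
    weightedSum-linear k c w = linear
      (λ f≈g → S-cong k λ x _ → ℂ.*-congʳ (eval-≈ f≈g (c K.* x)))
      (λ f g → ℂ.trans (S-cong k λ x _ → ℂ.trans (ℂ.*-congʳ (eval-+ f g (c K.* x)))
          (ℂ.distribʳ (w x) _ _)) (S-∙ k _ _))
      (begin
        S k (λ x → eval 0ᴹ (c K.* x) * w x)    ≈⟨ S-cong k (λ x _ → ℂ.*-congʳ (eval-0 (c K.* x))) ⟩
        S k (λ x → 0# * w x)                   ≈⟨ cosetSum-*ˡ k 0# ⟨
        0# * S k w                             ≈⟨ ℂ.zeroˡ _ ⟩
        0#                                     ∎)
      (λ f → begin
        S k (λ x → eval (-ᴹ f) (c K.* x) * w x)
          ≈⟨ S-cong k (λ x _ → ℂ.trans (ℂ.*-congʳ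
              (ℂ.trans (eval-neg f (c K.* x)) (ℂ.sym (ℂ.-1*x≈-x _)))) (ℂ.*-assoc _ _ _)) ⟩
        S k (λ x → (ℂ.- 1#) * (eval f (c K.* x) * w x))   ≈⟨ cosetSum-*ˡ k (ℂ.- 1#) ⟨
        (ℂ.- 1#) * S k (λ x → eval f (c K.* x) * w x)     ≈⟨ ℂ.-1*x≈-x _ ⟩
        ℂ.- S k (λ x → eval f (c K.* x) * w x)          ∎)
      (λ a f → begin
        S k (λ x → eval (a *ₗ f) (c K.* x) * w x)
          ≈⟨ S-cong k (λ x _ → ℂ.trans (ℂ.*-congʳ (eval-* a f (c K.* x))) (ℂ.*-assoc _ _ _)) ⟩
        S k (λ x → proj₁ a * (eval f (c K.* x) * w x))    ≈⟨ cosetSum-*ˡ k (proj₁ a) ⟨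
        proj₁ a * S k (λ x → eval f (c K.* x) * w x)      ∎)
      where open SetoidReasoning ℂ.setoid

  -- `e-conductor` says that e is trivial on b𝔬 exactly for b in π^(-δ) 𝔬. One direction gives
  -- periodicity of x ↦ e (b x); the other supplies a point where a nontrivial character differs
  -- from 1.
  module Duality (e : K.Carrier → ℂ.Carrier)
    (e-cong : ∀ {x y} → x K.≈ y → e x ≈ e y)
    (e-+ : ∀ x y → e (x K.+ y) ≈ e x * e y)
    (e-integral : ∀ x → Integral (e x))
    (e-conductor : ∀ b → (∀ y → K.Integral y → e (b K.* y) ≈ 1#) ⇔ K.Integral (π K.^ δ K.* b))
    (χ : K.Carrier → 𝒞) (χ-to : ∀ r x → 𝒞.to (χ r) x ≈ e (r K.* x))
    where
    private module M = RawLeftModule 𝒞-module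

    e-shift : ∀ k b {x y} → K.Integral (π K.^ δ K.* (b K.* π K.^ k)) →
        K.v (π K.^ k) ≤∞ K.v (x K.- y) →
      e (b K.* x) ≈ e (b K.* y)
    e-shift k b {x} {y} ib near =
      let z , iz , eq = π^-divides k near in begin
      e (b K.* x)
          ≈⟨ e-cong (KS.solve 3 (λ b x y → b KS.:* x KS.:= b KS.:* y KS.:+ b KS.:* (x KS.:- y))
          K.refl b x y) ⟩
      e (b K.* y K.+ b K.* (x K.- y))                ≈⟨ e-+ (b K.* y) (b K.* (x K.- y)) ⟩
      e (b K.* y) * e (b K.* (x K.- y))
          ≈⟨ ℂ.*-congˡ (e-cong (K.trans (K.*-congˡ eq) (K.sym (K.*-assoc b (π K.^ k) z)))) ⟩
      e (b K.* y) * e (b K.* π K.^ k K.* z)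
          ≈⟨ ℂ.*-congˡ (Equivalence.from (e-conductor _) ib z iz) ⟩
      e (b K.* y) * 1#                               ≈⟨ ℂ.*-identityʳ _ ⟩
      e (b K.* y)                                    ∎
      where open SetoidReasoning ℂ.setoid

    orthogonality-1 : ∀ k b → K.Integral (π K.^ δ K.* b) → S k (λ x → e (b K.* x)) ≈ q^ k
    orthogonality-1 k b ib = ℂ.trans (S-cong k (Equivalence.from (e-conductor b) ib))
      (ℂ.trans (S-const k 1#) (ℂ.*-identityʳ _))

    -- The first hypothesis makes the summand periodic modulo π^k. Translation by a y with e (b y)
    -- different from 1 then preserves the sum and also multiplies it by e (b y).
    orthogonality-0 : ∀ k b → K.Integral (π K.^ δ K.* (b K.* π K.^ k)) →
        ¬ K.Integral (π K.^ δ K.* b) →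
      S k (λ x → e (b K.* x)) ≈ 0#
    orthogonality-0 k b ib ¬ib = ℂP.*-cancel-0 {1# - e (b K.* y)} {D}
        (ℂ.trans (ℂS.solve 3 (λ o c d → (o ℂS.:- c) ℂS.:* d ℂS.:= o ℂS.:* d ℂS.:- c ℂS.:* d)
            ℂ.refl 1# (e (b K.* y)) D)
          (ℂ.x≈y⇒x∙y⁻¹≈ε (ℂ.trans (ℂ.*-identityˡ D) D≈cD)))
        (λ 1-c≈0 → ey≉1 (ℂ.sym (ℂ.x∙y⁻¹≈ε⇒x≈y 1# (e (b K.* y)) 1-c≈0)))
      where
      open SetoidReasoning ℂ.setoid
      nontrivial : ∃[ y ] ¬ (e (b K.* proj₁ {B = K.Integral} y) ≈ 1#)
      nontrivial = ¬∀⇒∃¬ em (λ h → ¬ib (Equivalence.to (e-conductor b) (λ y iy → h (y , iy))))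
      y : K.Carrier
      y = proj₁ (proj₁ nontrivial)
      ey≉1 : ¬ e (b K.* y) ≈ 1#
      ey≉1 = proj₂ nontrivial
      D : ℂ.Carrier
      D = S k (λ x → e (b K.* x))
      D≈cD : D ≈ e (b K.* y) * D
      D≈cD = begin
        D
            ≈⟨ S-shift k {λ x → e (b K.* x)} {y} (proj₂ (proj₁ nontrivial))
            (λ _ _ → e-shift k b ib) ⟨
        S k (λ x → e (b K.* (x K.+ y)))
            ≈⟨ S-cong k (λ x _ → ℂ.trans (e-cong (K.trans (K.distribˡ b x y) (K.+-comm _ _)))
            (e-+ (b K.* y) (b K.* x))) ⟩
        S k (λ x → e (b K.* y) * e (b K.* x))        ≈⟨ cosetSum-*ˡ k (e (b K.* y)) ⟨
        e (b K.* y) * D                              ∎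

    -- With this scaling (x , y) ↦ e (κ k x y) is a perfect pairing on 𝔬/π^k.
    κ : ℕ → K.Carrier
    κ k = ϖ K.^ k K.* ϖ K.^ δ

    π^δκ : ∀ k b → π K.^ δ K.* (κ k K.* b) K.≈ ϖ K.^ k K.* b
    π^δκ k b = begin
      π K.^ δ K.* (κ k K.* b)
          ≈⟨ KS.solve 4 (λ p t d b → p KS.:* (t KS.:* d KS.:* b) KS.:= p KS.:* d KS.:* (t KS.:* b))
          K.refl (π K.^ δ) (ϖ K.^ k) (ϖ K.^ δ) b ⟩
      π K.^ δ K.* ϖ K.^ δ K.* (ϖ K.^ k K.* b)        ≈⟨ K.*-congʳ (π^ϖ^≈1 δ) ⟩
      K.1# K.* (ϖ K.^ k K.* b)                       ≈⟨ K.*-identityˡ _ ⟩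
      ϖ K.^ k K.* b                                  ∎
      where open SetoidReasoning K.setoid

    -- On 𝔬 this is the indicator function of π^k 𝔬, which acts as the reproducing kernel of
    -- inversion.
    kernel : ℕ → K.Carrier → ℂ.Carrier
    kernel k b = q⁻^ k * S k (λ y → e (κ k K.* b K.* y))

    kernel-1 : ∀ k b → K.v (π K.^ k) ≤∞ K.v b → kernel k b ≈ 1#
    kernel-1 k b k≤b = ℂ.trans (ℂ.*-congˡ (orthogonality-1 k (κ k K.* b)
      (KP.≤v-cong (K.sym (π^δκ k b)) (Equivalence.from (ϖ^-integral⇔ k) k≤b)))) (q⁻^q^≈1 k)

    kernel-0 : ∀ k b → K.Integral b → ¬ K.v (π K.^ k) ≤∞ K.v b → kernel k b ≈ 0#
    kernel-0 k b ib k≰b = ℂ.trans (ℂ.*-congˡ (orthogonality-0 k (κ k K.* b)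
      (KP.≤v-cong (K.sym (K.trans (K.*-congˡ (K.*-assoc (κ k) b (π K.^ k)))
          (K.trans (π^δκ k (b K.* π K.^ k)) undo))) ib)
      (λ i → k≰b (Equivalence.to (ϖ^-integral⇔ k) (KP.≤v-cong (π^δκ k b) i))))) (ℂ.zeroʳ _)
      where
      undo : ϖ K.^ k K.* (b K.* π K.^ k) K.≈ b
      undo = K.trans (KS.solve 3 (λ w b p → w KS.:* (b KS.:* p) KS.:= p KS.:* w KS.:* b)
          K.refl (ϖ K.^ k) b (π K.^ k))
        (K.trans (K.*-congʳ (π^ϖ^≈1 k)) (K.*-identityˡ b))

    fourierCoefficient : ℕ → (K.Carrier → ℂ.Carrier) → K.Carrier → ℂ.Carrier
    fourierCoefficient k φ y = q⁻^ k * S k (λ x → φ x * e (κ k K.* (K.- x) K.* y))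

    fourierCoefficient-integral : ∀ k {φ} → (∀ x → Integral (φ x)) → ∀ y →
        Integral (fourierCoefficient k φ y)
    fourierCoefficient-integral k iφ y = ℂ.*-integral (q⁻^-integral k)
      (cosetSum-≤v k (λ x _ → ℂ.*-integral (iφ x) (e-integral _)))

    -- Interchanging the sums gives the sum over x of φ x * kernel k (t - x), in which only the
    -- representative of the class of t survives. That representative need not be t, so the error is
    -- the oscillation of `φ` on the class.
    inversion : ∀ k {φ r t} → (∀ x → Integral (φ x)) → K.Integral t →
      (∀ x → K.Integral x → K.v (π K.^ k) ≤∞ K.v (x K.- t) → r ≤∞ v (φ x - φ t)) →
      r ≤∞ v (S k (λ y → e (κ k K.* t K.* y) * fourierCoefficient k φ y) - φ t)
    inversion k {φ} {r} {t} iφ it near = ≡.subst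
        (λ z → r ≤∞ z) (ℂ.v-cong (ℂ.+-congʳ (ℂ.sym rearrange)))
      (cosetSum-single k {t} it
        (λ x ix x≁t → ℂP.≈0⇒≤v (ℂ.trans (ℂ.*-congˡ
            (kernel-0 k (t K.- x) (KP.v-+-neg t x it ix) (λ le → x≁t (K.v-swap t x le))))
            (ℂ.zeroʳ _)))
        (λ x ix x~t → ℂP.≤v-cong (ℂ.+-congʳ (ℂ.sym
            (ℂ.trans (ℂ.*-congˡ (kernel-1 k (t K.- x) (K.v-swap x t x~t))) (ℂ.*-identityʳ _))))
            (near x ix x~t)))
      where
      open SetoidReasoning ℂ.setoid
      term : ∀ x y → e (κ k K.* t K.* y) * (q⁻^ k * (φ x * e (κ k K.* (K.- x) K.* y))) ≈
        φ x * (q⁻^ k * e (κ k K.* (t K.- x) K.* y))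
      term x y = begin
        e (κ k K.* t K.* y) * (q⁻^ k * (φ x * e (κ k K.* (K.- x) K.* y)))
          ≈⟨ ℂS.solve 4 (λ a b c d → a ℂS.:* (b ℂS.:* (c ℂS.:* d)) ℂS.:=
              c ℂS.:* (b ℂS.:* (a ℂS.:* d))) ℂ.refl _ _ (φ x) _ ⟩
        φ x * (q⁻^ k * (e (κ k K.* t K.* y) * e (κ k K.* (K.- x) K.* y)))
          ≈⟨ ℂ.*-congˡ (ℂ.*-congˡ (e-+ _ _)) ⟨
        φ x * (q⁻^ k * e (κ k K.* t K.* y K.+ κ k K.* (K.- x) K.* y))
          ≈⟨ ℂ.*-congˡ (ℂ.*-congˡ (e-cong (KS.solve 4
              (λ c t x y → c KS.:* t KS.:* y KS.:+ c KS.:* (KS.:- x) KS.:* y KS.:=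
              c KS.:* (t KS.:- x) KS.:* y) K.refl (κ k) t x y))) ⟩
        φ x * (q⁻^ k * e (κ k K.* (t K.- x) K.* y)) ∎
      rearrange : S k (λ y → e (κ k K.* t K.* y) * fourierCoefficient k φ y) ≈ S k
          (λ x → φ x * kernel k (t K.- x))
      rearrange = begin
        S k (λ y → e (κ k K.* t K.* y) * (q⁻^ k * S k (λ x → φ x * e (κ k K.* (K.- x) K.* y))))
          ≈⟨ S-cong k (λ y _ → ℂ.trans (ℂ.*-congˡ (cosetSum-*ˡ k (q⁻^ k)))
              (cosetSum-*ˡ k (e (κ k K.* t K.* y)))) ⟩
        S k (λ y → S k (λ x → e (κ k K.* t K.* y) * (q⁻^ k * (φ x * e (κ k K.* (K.- x) K.* y)))))
          ≈⟨ S-cong k (λ y _ → S-cong k (λ x _ → term x y)) ⟩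
        S k (λ y → S k (λ x → φ x * (q⁻^ k * e (κ k K.* (t K.- x) K.* y))))
          ≈⟨ S-swap k k _ ⟩
        S k (λ x → S k (λ y → φ x * (q⁻^ k * e (κ k K.* (t K.- x) K.* y))))
          ≈⟨ S-cong k (λ x _ → ℂ.trans (ℂ.*-congˡ (cosetSum-*ˡ k (q⁻^ k))) (cosetSum-*ˡ k (φ x))) ⟨
        S k (λ x → φ x * kernel k (t K.- x)) ∎

    data Span : 𝒞 → Set where
      χ∈ : ∀ r → Span (χ r)
      0∈ : Span M.0ᴹ
      +∈ : ∀ {f g} → Span f → Span g → Span (f M.+ᴹ g)
      *∈ : ∀ c {f} → Span f → Span (c M.*ₗ f)

    eval-cosetSum : ∀ k φ z → 𝒞.to (cosetSum M.+ᴹ-rawMonoid k φ) z ≈ S k (λ y → 𝒞.to (φ y) z)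
    eval-cosetSum k φ z = cosetSum-rel M.+ᴹ-rawMonoid ℂ.+-rawMonoid (λ f a → 𝒞.to f z ≈ a) ℂ.refl
      (λ p q → ℂ.+-cong p q) k (λ _ _ → ℂ.refl)

    -- Multiplication by π^M carries the disc to 𝔬, where inversion applies to the rescaled
    -- function. The coefficients are integral because q⁻¹ is, so P is 𝔬_p-valued on all of K.
    trigonometric-approximation : ∀ (f : 𝒞) M r →
      ∃[ P ] Span P × (∀ z → Disc M z → near r (𝒞.to P z) (𝒞.to f z))
    trigonometric-approximation f M r = P , P∈ , approx
      where
      n k : ℕ
      n = proj₁ (uniform-on-disc (𝒞.fun f) (𝒞.continuous f) M r)
      -- Rescaling by ϖ^M costs M digits: congruence modulo π^(M+n) on 𝔬 becomes congruence modulo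
      -- π^n on the disc.
      k = M ℕ.+ n
      φ : K.Carrier → ℂ.Carrier
      φ x = 𝒞.to f (ϖ K.^ M K.* x)
      iφ : ∀ x → Integral (φ x)
      iφ x = 𝒞.integral f _
      term : K.Carrier → 𝒞
      term y = (fourierCoefficient k φ y , fourierCoefficient-integral k iφ y) M.*ₗ χ
          (π K.^ M K.* (κ k K.* y))
      P : 𝒞
      P = cosetSum M.+ᴹ-rawMonoid k term
      P∈ : Span P
      P∈ = cosetSum-rel M.+ᴹ-rawMonoid M.+ᴹ-rawMonoid (λ f _ → Span f) 0∈ +∈ k {ψ = term}
          (λ y _ → *∈ _ (χ∈ _))
      approx : ∀ z → Disc M z → near r (𝒞.to P z) (𝒞.to f z)
      approx z z∈ = ≡.subst ([ r ] ≤∞_) (ℂ.v-cong (ℂ.+-cong (ℂ.sym P≈) (ℂ.-‿cong φt≈)))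
        (inversion k {φ} {[ r ]} {t} iφ z∈ λ x ix x-t →
            proj₂ (uniform-on-disc (𝒞.fun f) (𝒞.continuous f) M r) _ _
          (≡.subst (0∞ ≤∞_) (K.v-cong (K.sym (KP.inverse-cancelˡ x (π^ϖ^≈1 M)))) ix)
          (≡.subst₂ _≤∞_ (K.v-cong (ϖ^π^-cancel M n)) (K.v-cong (K.x[y-z]≈xy-xz (ϖ K.^ M) x t))
            (KP.v-*-monoʳ (ϖ K.^ M) x-t)))
        where
        t : K.Carrier
        t = π K.^ M K.* z
        φt≈ : φ t ≈ 𝒞.to f z
        φt≈ = Func.cong (𝒞.fun f) (KP.inverse-cancelˡ z (ϖ^π^≈1 M))
        frequency : K.Carrier → K.Carrier
        frequency y = π K.^ M K.* (κ k K.* y)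
        term≈ : ∀ y → 𝒞.to (term y) z ≈ e (κ k K.* t K.* y) * fourierCoefficient k φ y
        term≈ y = begin
          fourierCoefficient k φ y * 𝒞.to (χ (frequency y)) z
              ≈⟨ ℂ.*-comm (fourierCoefficient k φ y) (𝒞.to (χ (frequency y)) z) ⟩
          𝒞.to (χ (frequency y)) z * fourierCoefficient k φ y
              ≈⟨ ℂ.*-congʳ (χ-to (frequency y) z) ⟩
          e (frequency y K.* z) * fourierCoefficient k φ y
              ≈⟨ ℂ.*-congʳ (e-cong (KS.solve 4 (λ p c y z →
            p KS.:* (c KS.:* y) KS.:* z KS.:= c KS.:* (p KS.:* z) KS.:* y)
                K.refl (π K.^ M) (κ k) y z)) ⟩
          e (κ k K.* t K.* y) * fourierCoefficient k φ y         ∎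
          where open SetoidReasoning ℂ.setoid
        P≈ : 𝒞.to P z ≈ S k (λ y → e (κ k K.* t K.* y) * fourierCoefficient k φ y)
        P≈ = ℂ.trans (eval-cosetSum k term z) (S-cong k {λ y → 𝒞.to (term y) z} λ y _ → term≈ y)

    module L (μ : 𝒟) = IsLeftModuleHomomorphism (𝒟.linear μ)

    -- Continuity of μ and of ν at f involves two compact sets and two precisions. One combination
    -- of characters, close enough to f on a disc containing both sets, serves for both.
    determined-by-characters : ∀ μ ν → (∀ r → 𝒟.∫ μ (χ r) ≈ 𝒟.∫ ν (χ r)) → ∀ f → 𝒟.∫ μ f ≈ 𝒟.∫ ν f
    determined-by-characters μ ν eq f = ℂP.-‿≈0⇒≈ λ r →
      let U , (cU , _) , s , contμ = 𝒟.continuous μ f r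
          W , (cW , _) , t , contν = 𝒟.continuous ν f r
          M , U⊆ = compact-bounded cU
          N , W⊆ = compact-bounded cW
          P , P∈ , approx = trigonometric-approximation f (M ℕ.+ N) (s ℚ.⊔ t)
      in ℂ.v-trans (𝒟.∫ μ f) (𝒟.∫ μ P) (𝒟.∫ ν f)
           (ℂ.v-swap (𝒟.∫ μ P) (𝒟.∫ μ f) (contμ P λ {x} x∈ →
               ⊔-≤∞ˡ {s} {t} (approx x (disc-weaken (ℕ.m≤m+n M N) (U⊆ x∈)))))
           (ℂ.v-trans (𝒟.∫ μ P) (𝒟.∫ ν P) (𝒟.∫ ν f) (ℂ.v-≈ _ _ (on-span P∈))
             (contν P λ {x} x∈ → ⊔-≤∞ʳ {s} {t} (approx x (disc-weaken (ℕ.m≤n+m N M) (W⊆ x∈)))))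
      where
      on-span : ∀ {P} → Span P → 𝒟.∫ μ P ≈ 𝒟.∫ ν P
      on-span (χ∈ r) = eq r
      on-span 0∈ = ℂ.trans (L.0ᴹ-homo μ) (ℂ.sym (L.0ᴹ-homo ν))
      on-span (+∈ {f} {g} p q) = ℂ.trans (L.+ᴹ-homo μ f g)
          (ℂ.trans (ℂ.+-cong (on-span p) (on-span q)) (ℂ.sym (L.+ᴹ-homo ν f g)))
      on-span (*∈ c {f} p) = ℂ.trans (L.*ₗ-homo μ c f)
          (ℂ.trans (ℂ.*-congˡ (on-span p)) (ℂ.sym (L.*ₗ-homo ν c f)))

    -- Continuity at the zero function provides a compact set, contained in some disc. On that disc
    -- χ x and χ y coincide once x - y is small, by a bound that depends on the disc and not on x
    -- and y.
    transform-uniform : ∀ μ r → ∃[ s ] ∀ x y → [ s ] ≤∞ K.v (x K.- y) →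
        near r (𝒟.∫ μ (χ x)) (𝒟.∫ μ (χ y))
    transform-uniform μ r =
      let U , (cU , _) , s , cont = 𝒟.continuous μ M.0ᴹ r
          M , U⊆ = compact-bounded cU
          t , scaled = scale (K.v (ϖ K.^ M)) 0ℚ
          t′ , scaled′ = scale (K.v (π K.^ δ)) t
      in t′ , λ x y x-y → ≡.subst ([ r ] ≤∞_) (ℂ.v-cong (difference x y))
           (cont (χ x M.+ᴹ (M.-ᴹ χ y)) λ {z} z∈ → ℂ.v-≈ _ _ (ℂ.x≈y⇒x∙y⁻¹≈ε (ℂ.trans (χ-to x z)
             (ℂ.trans (close x y z M (U⊆ z∈) (scaled
                 (≡.subst ([ t ] ≤∞_) (≡.sym (K.v-* (π K.^ δ) (x K.- y))) (scaled′ x-y))))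
                 (ℂ.sym (χ-to y z))))))
      where
      difference : ∀ x y → 𝒟.∫ μ (χ x M.+ᴹ (M.-ᴹ χ y)) - 𝒟.∫ μ M.0ᴹ ≈ 𝒟.∫ μ (χ x) - 𝒟.∫ μ (χ y)
      difference x y = begin
        𝒟.∫ μ (χ x M.+ᴹ (M.-ᴹ χ y)) - 𝒟.∫ μ M.0ᴹ
            ≈⟨ ℂ.+-cong (L.+ᴹ-homo μ (χ x) (M.-ᴹ χ y)) (ℂ.-‿cong (L.0ᴹ-homo μ)) ⟩
        𝒟.∫ μ (χ x) + 𝒟.∫ μ (M.-ᴹ χ y) - 0#
            ≈⟨ ℂ.+-congʳ (ℂ.+-congˡ (L.-ᴹ-homo μ (χ y))) ⟩
        𝒟.∫ μ (χ x) - 𝒟.∫ μ (χ y) - 0#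
            ≈⟨ ℂS.solve 2 (λ x y → x ℂS.:- y ℂS.:- ℂS.con (+ 0) ℂS.:= x ℂS.:- y) ℂ.refl _ _ ⟩
        𝒟.∫ μ (χ x) - 𝒟.∫ μ (χ y)                        ∎
        where open SetoidReasoning ℂ.setoid
      close : ∀ x y z M → Disc M z → 0∞ ≤∞ K.v (ϖ K.^ M) +∞ K.v (π K.^ δ K.* (x K.- y)) →
          e (x K.* z) ≈ e (y K.* z)
      close x y z M z∈ i =
        let t , it , eq = KP.≤v⇒∣ (ϖ^π^≈1 M) (Equivalence.to (disc⇔ball M) z∈)
            d = x K.- y in begin
        e (x K.* z)                        ≈⟨ e-cong
            (K.trans (KS.solve 3 (λ x y z → x KS.:* z KS.:= y KS.:* z KS.:+ (x KS.:- y) KS.:* z)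
            K.refl x y z)
                                                (K.+-congˡ (K.trans (K.*-congˡ eq)
                                                    (K.sym (K.*-assoc d (ϖ K.^ M) t))))) ⟩
        e (y K.* z K.+ d K.* ϖ K.^ M K.* t)    ≈⟨ e-+ _ _ ⟩
        e (y K.* z) * e (d K.* ϖ K.^ M K.* t)
            ≈⟨ ℂ.*-congˡ (Equivalence.from (e-conductor (d K.* ϖ K.^ M)) (KP.≤v-cong
                                                (KS.solve 3 (λ w p d → w KS.:* (p KS.:* d) KS.:=
                                                    p KS.:* (d KS.:* w))
                                                    K.refl (ϖ K.^ M) (π K.^ δ) d)
                                                (≡.subst (0∞ ≤∞_) (≡.sym
                                                    (K.v-* (ϖ K.^ M) (π K.^ δ K.* d))) i)) t it) ⟩
        e (y K.* z) * 1#                   ≈⟨ ℂ.*-identityʳ _ ⟩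
        e (y K.* z)                        ∎
        where open SetoidReasoning ℂ.setoid

    -- The measure with a prescribed uniformly continuous transform

    module Inverse (g : Fun) (g-integral : IntegralValued g)
        (g-uniform : UniformlyContinuous g) where
      private
        G : K.Carrier → ℂ.Carrier
        G = Func.to g

      -- The index y stands for the frequency ϖ^(N+δ) y. As κ (N + N) is ϖ^(2N+δ), pairing the
      -- indices x and y means applying e to the product of the point ϖ^N x and this frequency.
      sample : ℕ → K.Carrier → ℂ.Carrier
      sample N y = G (ϖ K.^ N K.* (ϖ K.^ δ K.* y))

      sample-cong : ∀ N {x y} → x K.≈ y → sample N x ≈ sample N y
      sample-cong N x≈y = Func.cong g (K.*-congˡ (K.*-congˡ x≈y))

      -- The mass of ϖ^N x + π^N 𝔬 for the measure with transform g.
      mass : ℕ → K.Carrier → ℂ.Carrier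
      mass N = fourierCoefficient (N ℕ.+ N) (sample N)

      mass-integral : ∀ N x → Integral (mass N x)
      mass-integral N = fourierCoefficient-integral (N ℕ.+ N) (λ y → g-integral _)

      approximant : ℕ → 𝒞 → ℂ.Carrier
      approximant N = weightedSum 𝒞-evaluation (N ℕ.+ N) (ϖ K.^ N) (mass N)

      level : ∀ r → ∃[ n ] ∀ x y → K.v (π K.^ n) ≤∞ K.v (x K.- y) → near r (G x) (G y)
      level r = let s , uniform = g-uniform r
                    n , s≤ = π^-deep s
                in n , λ x y x-y → uniform x y (≤∞-trans s≤ x-y)

      sample-near : ∀ {r n} → (∀ x y → K.v (π K.^ n) ≤∞ K.v (x K.- y) → near r (G x) (G y)) →
        ∀ N m {x y} → n ℕ.≤ m → K.v (π K.^ (N ℕ.+ (δ ℕ.+ m))) ≤∞ K.v (x K.- y) →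
            near r (sample N x) (sample N y)
      sample-near {r} {n} uniform N m {x} {y} n≤m x-y = uniform _ _ (≤∞-trans (π^-mono n≤m)
        (≡.subst₂ _≤∞_ (K.v-cong shrink) (K.v-cong
            (KS.solve 4 (λ a b x y → a KS.:* (b KS.:* (x KS.:- y)) KS.:=
            a KS.:* (b KS.:* x) KS.:- a KS.:* (b KS.:* y)) K.refl (ϖ K.^ N) (ϖ K.^ δ) x y))
          (KP.v-*-monoʳ (ϖ K.^ N) (KP.v-*-monoʳ (ϖ K.^ δ) x-y))))
        where
        shrink : ϖ K.^ N K.* (ϖ K.^ δ K.* π K.^ (N ℕ.+ (δ ℕ.+ m))) K.≈ π K.^ m
        shrink = K.trans (KS.solve 3 (λ a b p → a KS.:* (b KS.:* p) KS.:= b KS.:* (a KS.:* p))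
            K.refl (ϖ K.^ N) (ϖ K.^ δ) _)
          (K.trans (K.*-congˡ (ϖ^π^-cancel N (δ ℕ.+ m))) (ϖ^π^-cancel δ m))

      module Decay (r : ℚ) where
        n N₀ : ℕ
        n = proj₁ (level r)
        -- Up to r, g is constant on cosets of π^n 𝔬. The dual of this lattice under e is π^(-δ-n)
        -- 𝔬, the disc of index N₀.
        N₀ = δ ℕ.+ n

        module _ (i : ℕ) (x : K.Carrier) (ix : K.Integral x)
            (x∉ : ¬ Disc N₀ (ϖ K.^ (i ℕ.+ N₀) K.* x)) where
          private
            N j k : ℕ
            N = i ℕ.+ N₀
            j = N ℕ.+ N₀
            k = j ℕ.+ i
            k≡ : N ℕ.+ N ≡ k
            k≡ = ≡.trans (≡.cong (N ℕ.+_) (ℕ.+-comm i N₀)) (≡.sym (ℕ.+-assoc N N₀ i))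

            π^i∤x : ¬ K.v (π K.^ i) ≤∞ K.v x
            π^i∤x le = let z , iz , eq = π^-divides i le in x∉ (KP.≤v-cong (unscale z eq) iz)
              where
              unscale : ∀ z → x K.≈ π K.^ i K.* z → z K.≈ π K.^ N₀ K.* (ϖ K.^ N K.* x)
              unscale z eq = begin
                z                                                      ≈⟨ K.*-identityˡ z ⟨
                K.1# K.* z                                             ≈⟨ K.*-congʳ (ϖ^π^≈1 N) ⟨
                ϖ K.^ N K.* π K.^ N K.* z
                    ≈⟨ K.*-congʳ (K.*-congˡ (π^-+ i N₀)) ⟩
                ϖ K.^ N K.* (π K.^ i K.* π K.^ N₀) K.* z
                    ≈⟨ KS.solve 4 (λ w a b z → w KS.:* (a KS.:* b) KS.:* z KS.:=
                    b KS.:* (w KS.:* (a KS.:* z))) K.refl (ϖ K.^ N) (π K.^ i) (π K.^ N₀) z ⟩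
                π K.^ N₀ K.* (ϖ K.^ N K.* (π K.^ i K.* z))             ≈⟨ K.*-congˡ (K.*-congˡ eq) ⟨
                π K.^ N₀ K.* (ϖ K.^ N K.* x)                           ∎
                where open SetoidReasoning K.setoid

            b : K.Carrier
            b = κ k K.* (K.- x K.* π K.^ j)

            θ : K.Carrier → ℂ.Carrier
            θ y = sample N y * e (κ k K.* (K.- y) K.* x)

            θ-cong : ∀ {y z} → y K.≈ z → θ y ≈ θ z
            θ-cong y≈z = ℂ.*-cong (sample-cong N y≈z)
                (e-cong (K.*-congʳ (K.*-congˡ (K.-‿cong y≈z))))

            -- Here π^δ b = -ϖ^i x, and ϖ^i x = π^N₀ ϖ^N x is not integral because ϖ^N x lies
            -- outside the disc. So z ↦ e (b z) is nontrivial on 𝔬, while it is trivial on π^i 𝔬.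
            inner-zero : S i (λ y → e (b K.* y)) ≈ 0#
            inner-zero = orthogonality-0 i b
              (KP.≤v-cong (K.sym full) (K.v-neg x ix))
              (λ ib → π^i∤x (KP.v-*-cancel (π K.^ i) x (π^ϖ^≈1 j)
                  (≡.subst (K.v (π K.^ j K.* π K.^ i) ≤∞_)
                (K.v-cong (KS.solve 2 (λ x p → KS.:- (KS.:- x KS.:* p) KS.:= p KS.:* x)
                    K.refl x (π K.^ j)))
                (K.v-neg (K.- x K.* π K.^ j) (≡.subst (_≤∞ K.v (K.- x K.* π K.^ j))
                    (K.v-cong (π^-+ j i))
                  (Equivalence.to (ϖ^-integral⇔ k) (KP.≤v-cong (π^δκ k _) ib)))))))
              where
              full : π K.^ δ K.* (b K.* π K.^ i) K.≈ K.- x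
              full = begin
                π K.^ δ K.* (κ k K.* (K.- x K.* π K.^ j) K.* π K.^ i)
                    ≈⟨ K.*-congˡ (K.*-assoc (κ k) _ (π K.^ i)) ⟩
                π K.^ δ K.* (κ k K.* (K.- x K.* π K.^ j K.* π K.^ i))    ≈⟨ π^δκ k _ ⟩
                ϖ K.^ k K.* (K.- x K.* π K.^ j K.* π K.^ i)
                    ≈⟨ K.*-congˡ (K.trans (K.*-assoc _ _ _) (K.*-congˡ (K.sym (π^-+ j i)))) ⟩
                ϖ K.^ k K.* (K.- x K.* π K.^ k)
                    ≈⟨ KS.solve 3 (λ w x p → w KS.:* (KS.:- x KS.:* p) KS.:=
                    KS.:- x KS.:* (w KS.:* p)) K.refl (ϖ K.^ k) x (π K.^ k) ⟩
                K.- x K.* (ϖ K.^ k K.* π K.^ k)                          ≈⟨ K.*-congˡ (ϖ^π^≈1 k) ⟩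
                K.- x K.* K.1#                                           ≈⟨ K.*-identityʳ _ ⟩
                K.- x                                                    ∎
                where open SetoidReasoning K.setoid

            e-split : ∀ y z → e (κ k K.* (K.- (y K.+ π K.^ j K.* z)) K.* x)
                ≈ e (κ k K.* (K.- y) K.* x) * e (b K.* z)
            e-split y z = ℂ.trans (e-cong (KS.solve 5
                (λ c y p z x → c KS.:* (KS.:- (y KS.:+ p KS.:* z)) KS.:* x KS.:=
              c KS.:* (KS.:- y) KS.:* x KS.:+ c KS.:* (KS.:- x KS.:* p) KS.:* z)
                  K.refl (κ k) y (π K.^ j) z x)) (e-+ _ _)

            -- Since j = N + δ + n, the last i digits change `sample N` by at most r; only the
            -- character varies with them, and its sum vanishes.
            inner-small : ∀ y → [ r ] ≤∞ v (S i (λ z → θ (y K.+ π K.^ j K.* z)))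
            inner-small y = ℂP.≤v-cong (ℂ.trans (ℂ.+-congˡ (ℂ.-‿cong constant≈0))
                (ℂS.solve 1 (λ a → a ℂS.:- ℂS.con (+ 0) ℂS.:= a) ℂ.refl _))
              (cosetSum-near i {λ z → θ (y K.+ π K.^ j K.* z)} {λ z → c * e (b K.* z)} λ z iz →
                ℂP.≤v-cong (ℂ.+-cong (ℂ.*-congˡ (ℂ.sym (e-split y z)))
                    (ℂ.-‿cong (ℂ.sym (ℂ.*-assoc _ _ _))))
                  (ℂ.v-*-diff _ _ _ _ (g-integral _) (ℂ.*-integral (e-integral _) (e-integral _))
                    (sample-near (proj₂ (level r)) N n ℕ.≤-refl
                      (KP.≤v-cong (KS.solve 2
                          (λ y d → d KS.:= y KS.:+ d KS.:- y) K.refl y (π K.^ j K.* z))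
                          (KP.v-*≥ˡ (π K.^ j) iz)))
                    (ℂ.v-≈ _ _ ℂ.refl)))
              where
              c : ℂ.Carrier
              c = sample N y * e (κ k K.* (K.- y) K.* x)
              constant≈0 : S i (λ z → c * e (b K.* z)) ≈ 0#
              constant≈0 = ℂ.trans (ℂ.sym (cosetSum-*ˡ i c))
                  (ℂ.trans (ℂ.*-congˡ inner-zero) (ℂ.zeroʳ c))

          mass-small : [ r ] ≤∞ v (mass (i ℕ.+ N₀) x)
          mass-small = ≡.subst (λ l → [ r ] ≤∞ v (fourierCoefficient l (sample N) x)) (≡.sym k≡)
            (ℂ.v-*ˡ (q⁻^ k) (S k θ) (q⁻^-integral k)
              (ℂP.≤v-cong (ℂ.sym (S-split j i {θ} θ-cong)) (cosetSum-≤v j (λ y _ → inner-small y))))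

        -- On the disc f and h are close and masses are integral; off it the masses are small,
        -- whatever f and h are. As the disc does not depend on N, the approximants are
        -- equicontinuous.
        approximant-near : ∀ N → N₀ ℕ.≤ N → ∀ f h →
            (∀ {x} → Disc N₀ x → near r (𝒞.to f x) (𝒞.to h x)) →
          near r (approximant N f) (approximant N h)
        approximant-near N N₀≤N f h f-h = cosetSum-near (N ℕ.+ N) λ x ix → case x ix em
          where
          case : ∀ x → K.Integral x → Dec (Disc N₀ (ϖ K.^ N K.* x)) →
            [ r ] ≤∞ v (𝒞.to f (ϖ K.^ N K.* x) * mass N x - 𝒞.to h (ϖ K.^ N K.* x) * mass N x)
          case x ix (yes x∈) = ℂ.v-*-diff _ _ _ _ (𝒞.integral f _) (mass-integral N x) (f-h x∈)
              (ℂ.v-≈ _ _ ℂ.refl)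
          case x ix (no x∉) = ℂP.v-+-neg _ _ (ℂ.v-*ˡ _ _ (𝒞.integral f _) small)
              (ℂ.v-*ˡ _ _ (𝒞.integral h _) small)
            where
            N≡ : (N ℕ.∸ N₀) ℕ.+ N₀ ≡ N
            N≡ = ℕ.m∸n+n≡m N₀≤N
            small : [ r ] ≤∞ v (mass N x)
            small = ≡.subst (λ N → [ r ] ≤∞ v (mass N x)) N≡
              (mass-small (N ℕ.∸ N₀) x ix (≡.subst (λ N → ¬ Disc N₀ (ϖ K.^ N K.* x)) (≡.sym N≡) x∉))
      open Decay public

      -- Masses are Fourier coefficients of the samples, so integrating a character is inversion at
      -- one index, namely the η whose frequency is ρ. For η to be integral, ρ is placed in the disc
      -- of index N, whence the second bound on N.
      approximant-χ : ∀ ρ → (λ N → approximant N (χ ρ)) ⟶ G ρ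
      approximant-χ ρ r =
        let M , ρ∈ = bounded ρ in N₀ r ℕ.+ M , λ N le →
            close N (ℕ.≤-trans (ℕ.m≤m+n (N₀ r) M) le) (ρ∈ N (ℕ.≤-trans (ℕ.m≤n+m M (N₀ r)) le))
        where
        close : ∀ N → N₀ r ℕ.≤ N → K.Integral (π K.^ N K.* ρ) → near r (approximant N (χ ρ)) (G ρ)
        close N N₀≤N iρ = ≡.subst ([ r ] ≤∞_)
            (ℂ.v-cong (ℂ.+-cong (ℂ.sym sum≈) (ℂ.-‿cong (Func.cong g η≈))))
          (inversion (N ℕ.+ N) {sample N} {[ r ]} {η}
              (λ _ → g-integral _) (K.*-integral (^-integral δ π-integral) iρ)
            (λ x ix x-η → sample-near (proj₂ (level r)) N (n r ℕ.+ l) (ℕ.m≤m+n _ l)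
              (≡.subst (λ m → K.v (π K.^ (N ℕ.+ m)) ≤∞ K.v (x K.- η)) N≡ x-η)))
          where
          l : ℕ
          l = N ℕ.∸ N₀ r
          N≡ : N ≡ δ ℕ.+ (n r ℕ.+ l)
          N≡ = ≡.trans (≡.sym (ℕ.m+[n∸m]≡n N₀≤N)) (ℕ.+-assoc δ (n r) l)
          η : K.Carrier
          η = π K.^ δ K.* (π K.^ N K.* ρ)
          η≈ : ϖ K.^ N K.* (ϖ K.^ δ K.* η) K.≈ ρ
          η≈ = K.trans (K.*-congˡ (KP.inverse-cancelˡ _ (ϖ^π^≈1 δ)))
              (KP.inverse-cancelˡ ρ (ϖ^π^≈1 N))
          κη≈ : κ (N ℕ.+ N) K.* η K.≈ ρ K.* ϖ K.^ N
          κη≈ = begin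
            ϖ K.^ (N ℕ.+ N) K.* ϖ K.^ δ K.* η
                ≈⟨ K.*-congʳ (K.*-congʳ (Exp.^-homo-* K.semiring ϖ N N)) ⟩
            ϖ K.^ N K.* ϖ K.^ N K.* ϖ K.^ δ K.* η
                ≈⟨ KS.solve 3 (λ a d h → a KS.:* a KS.:* d KS.:* h KS.:=
                a KS.:* (d KS.:* h) KS.:* a) K.refl (ϖ K.^ N) (ϖ K.^ δ) η ⟩
            ϖ K.^ N K.* (ϖ K.^ δ K.* η) K.* ϖ K.^ N       ≈⟨ K.*-congʳ η≈ ⟩
            ρ K.* ϖ K.^ N                                 ∎
            where open SetoidReasoning K.setoid
          sum≈ : approximant N (χ ρ) ≈ S (N ℕ.+ N) (λ y → e (κ (N ℕ.+ N) K.* η K.* y) * mass N y)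
          sum≈ = S-cong (N ℕ.+ N) λ y _ → ℂ.*-congʳ (ℂ.trans (χ-to ρ (ϖ K.^ N K.* y))
            (e-cong (K.trans (K.sym (K.*-assoc ρ (ϖ K.^ N) y)) (K.*-congʳ (K.sym κη≈)))))

      private
        linear-N : ∀ N → IsLeftModuleHomomorphism 𝒞-module ℂ-module (approximant N)
        linear-N N = weightedSum-linear 𝒞-evaluation (N ℕ.+ N) (ϖ K.^ N) (mass N)
        module A (N : ℕ) = IsLeftModuleHomomorphism (linear-N N)

      approximant-span : ∀ {P} → Span P → ∃[ a ] (λ N → approximant N P) ⟶ a
      approximant-span (χ∈ ρ) = G ρ , approximant-χ ρ
      approximant-span 0∈ = 0# , ℂP.⟶-cong (λ N → ℂ.sym (A.0ᴹ-homo N)) (ℂP.⟶-const 0#)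
      approximant-span (+∈ {f} {h} p q) = let a , f⟶a = approximant-span p
                                              b , h⟶b = approximant-span q
        in a + b , ℂP.⟶-cong (λ N → ℂ.sym (A.+ᴹ-homo N f h)) (ℂP.⟶-+ f⟶a h⟶b)
      approximant-span (*∈ c {f} p) = let a , f⟶a = approximant-span p
        in proj₁ c * a , ℂP.⟶-cong (λ N → ℂ.sym (A.*ₗ-homo N c f)) (ℂP.⟶-* (proj₁ c) f⟶a)

      -- Masses at different levels are not compared with each other. A combination P of characters
      -- is close to f on the disc, the approximants converge on P, and equicontinuity carries the
      -- Cauchy property over to f.
      approximant-cauchy : ∀ f → Cauchy (λ N → approximant N f)
      approximant-cauchy f r =
        let P , P∈ , P-f = trigonometric-approximation f (N₀ r) r
            a , P⟶a = approximant-span P∈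
            M , cauchy = ℂP.⟶⇒Cauchy P⟶a r
            close : ∀ N → N₀ r ℕ.≤ N → near r (approximant N P) (approximant N f)
            close N le = approximant-near r N le P f (λ {x} x∈ → P-f x x∈)
        in M ℕ.⊔ N₀ r , λ m l m≥ l≥ →
          ℂ.v-trans (approximant m f) (approximant m P) (approximant l f)
            (ℂ.v-swap _ _ (close m (ℕ.m⊔n≤o⇒n≤o M _ m≥)))
            (ℂ.v-trans (approximant m P) (approximant l P) (approximant l f)
              (cauchy m l (ℕ.m⊔n≤o⇒m≤o M _ m≥) (ℕ.m⊔n≤o⇒m≤o M _ l≥)) (close l (ℕ.m⊔n≤o⇒n≤o M _ l≥)))

      ∫μ : 𝒞 → ℂ.Carrier
      ∫μ f = proj₁ (ℂ-complete (λ N → approximant N f) (approximant-cauchy f))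

      approximant⟶ : ∀ f → (λ N → approximant N f) ⟶ ∫μ f
      approximant⟶ f = proj₂ (ℂ-complete (λ N → approximant N f) (approximant-cauchy f))

      measure : 𝒟
      measure = record
        { ∫ = ∫μ
        ; integral = λ f → ℂP.⟶-bound 0 (λ N _ → cosetSum-≤v (N ℕ.+ N) λ x _ →
            ℂ.*-integral (𝒞.integral f _) (mass-integral N x)) (approximant⟶ f)
        ; linear = Limit.limit-linear em 𝒞-module {approximant} {∫μ} linear-N approximant⟶
        ; continuous = λ f r → Disc (N₀ r) , disc-compactOpen (N₀ r) , r , λ h h-f →
            ℂP.⟶-bound (N₀ r) (λ N le → approximant-near r N le h f h-f)
              (ℂP.⟶-+ (approximant⟶ h) (ℂP.⟶-neg (approximant⟶ f))) }

      measure-transform : ∀ ρ → 𝒟.∫ measure (χ ρ) ≈ G ρ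
      measure-transform ρ = ℂP.⟶-unique (approximant⟶ (χ ρ)) (approximant-χ ρ)

  -- The Haar integral as a limit of Riemann sums

  module HaarIntegral (c₀ : ℂ.Carrier) (c₀-integral : Integral c₀) where

    q^-integral : ∀ k → Integral (q^ k)
    q^-integral zero    = ℂ.1-integral
    q^-integral (suc k) = ℂ.*-integral (•-integral q) (q^-integral k)
      where
      •-integral : ∀ n → Integral (n ℂ.• 1#)
      •-integral zero    = ℂ.0-integral
      •-integral (suc n) = ℂ.+-integral ℂ.1-integral (•-integral n)

    -- The measure of π^n 𝔬.
    volume : ℕ → ℂ.Carrier
    volume n = q⁻^ n * c₀

    volume-integral : ∀ n → Integral (volume n)
    volume-integral n = ℂ.*-integral (q⁻^-integral n) c₀-integral

    volume-q^ : ∀ j n → volume (j ℕ.+ n) * q^ j ≈ volume n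
    volume-q^ j n = begin
      q⁻^ (j ℕ.+ n) * c₀ * q^ j        ≈⟨ ℂ.*-congʳ (ℂ.*-congʳ (Exp.^-homo-* ℂ.semiring q⁻¹ j n)) ⟩
      q⁻^ j * q⁻^ n * c₀ * q^ j        ≈⟨ ℂS.solve 4
          (λ a b c d → a ℂS.:* b ℂS.:* c ℂS.:* d ℂS.:= a ℂS.:* d ℂS.:* (b ℂS.:* c))
          ℂ.refl (q⁻^ j) (q⁻^ n) c₀ (q^ j) ⟩
      q⁻^ j * q^ j * (q⁻^ n * c₀)      ≈⟨ ℂ.*-congʳ (q⁻^q^≈1 j) ⟩
      1# * volume n                    ≈⟨ ℂ.*-identityˡ _ ⟩
      volume n                         ∎
      where open SetoidReasoning ℂ.setoid

    riemannSum : ℕ → 𝒞₀ → ℂ.Carrier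
    riemannSum N = weightedSum 𝒞₀-evaluation (N ℕ.+ N) (ϖ K.^ N) (λ _ → volume N)

    module _ (f : K.Carrier → ℂ.Carrier) (f-cong : ∀ {x y} → x K.≈ y → f x ≈ f y) where

      total : ℕ → ℂ.Carrier
      total N = S (N ℕ.+ N) (λ x → f (ϖ K.^ N K.* x))

      -- At level N = j + N₀ an index has j + 2N₀ + j digits. The lowest j must represent 0 modulo
      -- π^j, for otherwise the point lies outside the disc; the next 2N₀ reproduce level N₀; the
      -- last j stay within the mesh and only contribute the factor q^j.
      total-stable : ∀ {r N₀} → (∀ x → ¬ Disc N₀ x → r ≤∞ v (f x)) →
        (∀ x y → K.v (π K.^ N₀) ≤∞ K.v (x K.- y) → r ≤∞ v (f x - f y)) →
        ∀ j → r ≤∞ v (total (j ℕ.+ N₀) - q^ j * total N₀)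
      total-stable {r} {N₀} tail uniform j =
        ≡.subst (λ l → r ≤∞ v (S l (λ x → f (ϖ K.^ N K.* x)) - q^ j * total N₀)) (≡.sym N+N≡)
          (ℂP.≤v-cong (ℂ.+-congʳ (ℂ.sym (S-split j l {λ x → f (ϖ K.^ N K.* x)}
              (λ x≈y → f-cong (K.*-congˡ x≈y)))))
            (cosetSum-single j {K.0#} K.0-integral far near₀))
        where
        N l : ℕ
        N = j ℕ.+ N₀
        l = (N₀ ℕ.+ N₀) ℕ.+ j
        N+N≡ : N ℕ.+ N ≡ j ℕ.+ l
        N+N≡ = ≡.trans (ℕ.+-assoc j N₀ N) (≡.cong (j ℕ.+_)
            (≡.trans (≡.cong (N₀ ℕ.+_) (ℕ.+-comm j N₀)) (≡.sym (ℕ.+-assoc N₀ N₀ j))))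
        unscale : π K.^ N₀ K.* ϖ K.^ N K.≈ ϖ K.^ j
        unscale = begin
          π K.^ N₀ K.* ϖ K.^ N
              ≈⟨ K.*-congˡ (Exp.^-homo-* K.semiring ϖ j N₀) ⟩
          π K.^ N₀ K.* (ϖ K.^ j K.* ϖ K.^ N₀)
              ≈⟨ KS.solve 3 (λ a b c → a KS.:* (b KS.:* c) KS.:= b KS.:* (a KS.:* c))
              K.refl (π K.^ N₀) (ϖ K.^ j) (ϖ K.^ N₀) ⟩
          ϖ K.^ j K.* (π K.^ N₀ K.* ϖ K.^ N₀)          ≈⟨ K.*-congˡ (π^ϖ^≈1 N₀) ⟩
          ϖ K.^ j K.* K.1#                             ≈⟨ K.*-identityʳ _ ⟩
          ϖ K.^ j                                      ∎
          where open SetoidReasoning K.setoid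
        rescale : ∀ y → ϖ K.^ N K.* (π K.^ j K.* y) K.≈ ϖ K.^ N₀ K.* y
        rescale y = begin
          ϖ K.^ N K.* (π K.^ j K.* y)
              ≈⟨ K.*-congʳ (Exp.^-homo-* K.semiring ϖ j N₀) ⟩
          ϖ K.^ j K.* ϖ K.^ N₀ K.* (π K.^ j K.* y)
              ≈⟨ KS.solve 4 (λ a b c y → a KS.:* b KS.:* (c KS.:* y) KS.:=
              c KS.:* a KS.:* (b KS.:* y)) K.refl (ϖ K.^ j) (ϖ K.^ N₀) (π K.^ j) y ⟩
          π K.^ j K.* ϖ K.^ j K.* (ϖ K.^ N₀ K.* y)     ≈⟨ K.*-congʳ (π^ϖ^≈1 j) ⟩
          K.1# K.* (ϖ K.^ N₀ K.* y)                    ≈⟨ K.*-identityˡ _ ⟩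
          ϖ K.^ N₀ K.* y                               ∎
          where open SetoidReasoning K.setoid
        far : ∀ x → K.Integral x → ¬ K.v (π K.^ j) ≤∞ K.v (x K.- K.0#) →
          r ≤∞ v (S l (λ y → f (ϖ K.^ N K.* (x K.+ π K.^ j K.* y))))
        far x ix x≁0 = cosetSum-≤v l λ y iy → tail _ λ i →
            x≁0 (KP.≤v-cong (KS.solve 1 (λ x → x KS.:= x KS.:- KS.con (+ 0)) K.refl x)
          (Equivalence.to (ϖ^-integral⇔ j) (KP.≤v-cong (outer x y) (KP.v-+-neg _ y i iy))))
          where
          outer : ∀ x y → π K.^ N₀ K.* (ϖ K.^ N K.* (x K.+ π K.^ j K.* y)) K.- y K.≈ ϖ K.^ j K.* x
          outer x y = begin
            π K.^ N₀ K.* (ϖ K.^ N K.* (x K.+ π K.^ j K.* y)) K.- y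
                ≈⟨ K.+-congʳ (K.sym (K.*-assoc _ _ _)) ⟩
            π K.^ N₀ K.* ϖ K.^ N K.* (x K.+ π K.^ j K.* y) K.- y
                ≈⟨ K.+-congʳ (K.*-congʳ unscale) ⟩
            ϖ K.^ j K.* (x K.+ π K.^ j K.* y) K.- y
                ≈⟨ K.+-congʳ (K.distribˡ _ _ _) ⟩
            ϖ K.^ j K.* x K.+ ϖ K.^ j K.* (π K.^ j K.* y) K.- y
                ≈⟨ K.+-congʳ (K.+-congˡ (KP.inverse-cancelˡ y (ϖ^π^≈1 j))) ⟩
            ϖ K.^ j K.* x K.+ y K.- y
                ≈⟨ KS.solve 2 (λ x y → x KS.:+ y KS.:- y KS.:= x) K.refl (ϖ K.^ j K.* x) y ⟩
            ϖ K.^ j K.* x                                               ∎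
            where open SetoidReasoning K.setoid
        near₀ : ∀ x → K.Integral x → K.v (π K.^ j) ≤∞ K.v (x K.- K.0#) →
          r ≤∞ v (S l (λ y → f (ϖ K.^ N K.* (x K.+ π K.^ j K.* y))) - q^ j * total N₀)
        -- The representative x of the class of 0 need not be 0. With x = π^j z, the sum at level N₀
        -- appears translated by z, which approximate shift invariance undoes.
        near₀ x ix x~0 = at-multiple (π^-divides j
            (KP.≤v-cong (KS.solve 1 (λ x → x KS.:- KS.con (+ 0) KS.:= x) K.refl x) x~0))
          where
          f₀ : K.Carrier → ℂ.Carrier
          f₀ y = f (ϖ K.^ N₀ K.* y)
          f₀-cong : ∀ {x y} → x K.≈ y → f₀ x ≈ f₀ y
          f₀-cong x≈y = f-cong (K.*-congˡ x≈y)
          f₀-near : ∀ x y → K.v (π K.^ (N₀ ℕ.+ N₀)) ≤∞ K.v (x K.- y) → r ≤∞ v (f₀ x - f₀ y)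
          f₀-near x y x-y = uniform _ _ (≡.subst₂ _≤∞_ (K.v-cong (ϖ^π^-cancel N₀ N₀))
              (K.v-cong (K.x[y-z]≈xy-xz _ x y)) (KP.v-*-monoʳ (ϖ K.^ N₀) x-y))
          at-multiple : ∃[ z ] K.Integral z × x K.≈ π K.^ j K.* z →
            r ≤∞ v (S l (λ y → f (ϖ K.^ N K.* (x K.+ π K.^ j K.* y))) - q^ j * total N₀)
          at-multiple (z , iz , x≈) = ℂ.v-trans _ (S l (λ y → f₀ (y K.+ z))) _
            (ℂ.v-≈ _ _ (S-cong l λ y _ → f-cong
                (K.trans (K.*-congˡ (K.trans (K.+-congʳ x≈) (KS.solve 3 (λ p z y →
              p KS.:* z KS.:+ p KS.:* y KS.:= p KS.:* (y KS.:+ z)) K.refl (π K.^ j) z y)))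
                  (rescale (y K.+ z)))))
            (ℂ.v-trans _ (q^ j * S (N₀ ℕ.+ N₀) (λ y → f₀ (y K.+ z))) _ fine-sum
              (≡.subst (r ≤∞_) (ℂ.v-cong (ℂ.x[y-z]≈xy-xz (q^ j) _ _))
                (ℂ.v-*ˡ (q^ j) _ (q^-integral j)
                    (S-shift-near r (N₀ ℕ.+ N₀) {f₀} iz (λ _ _ → f₀-near _ _)))))
            where
            fine-sum : r ≤∞ v (S l (λ y → f₀ (y K.+ z)) - q^ j * S (N₀ ℕ.+ N₀) (λ y → f₀ (y K.+ z)))
            fine-sum = ℂP.≤v-cong
              (ℂ.+-cong (ℂ.sym (S-split (N₀ ℕ.+ N₀) j {λ y → f₀ (y K.+ z)}
                  (λ x≈y → f₀-cong (K.+-congʳ x≈y))))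
                (ℂ.-‿cong (ℂ.trans (S-cong (N₀ ℕ.+ N₀) λ y _ → S-const j _)
                    (ℂ.sym (cosetSum-*ˡ (N₀ ℕ.+ N₀) (q^ j))))))
              (cosetSum-near (N₀ ℕ.+ N₀) {λ y → S j
                  (λ u → f₀ (y K.+ π K.^ (N₀ ℕ.+ N₀) K.* u K.+ z))} {λ y → S j (λ u → f₀ (y K.+ z))}
                λ y iy → cosetSum-near j λ u iu → f₀-near _ _
                  (KP.≤v-cong (KS.solve 3 (λ y d z → d KS.:= y KS.:+ d KS.:+ z KS.:- (y KS.:+ z))
                      K.refl y (π K.^ (N₀ ℕ.+ N₀) K.* u) z)
                    (KP.v-*≥ˡ (π K.^ (N₀ ℕ.+ N₀)) iu)))

    riemannSum≈ : ∀ N (f : 𝒞₀) → riemannSum N f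
        ≈ volume N * total (𝒞₀.to f) (Func.cong (𝒞₀.fun f)) N
    riemannSum≈ N f = ℂ.trans (S-cong (N ℕ.+ N) λ x _ → ℂ.*-comm _ _)
        (ℂ.sym (cosetSum-*ˡ (N ℕ.+ N) (volume N)))

    disc-near : ∀ M n {x y} → Disc M y → K.v (π K.^ n) ≤∞ K.v (x K.- y) → Disc M x
    disc-near M n {x} {y} y∈ x-y = KP.≤v-cong
        (KS.solve 3 (λ p x y → p KS.:* y KS.:+ p KS.:* (x KS.:- y) KS.:= p KS.:* x)
        K.refl (π K.^ M) x y)
      (K.+-integral y∈ (K.*-integral (^-integral M π-integral)
          (≤∞-trans (^-integral n π-integral) x-y)))

    -- Two points closer than the mesh lie both in the disc or both outside it, and outside both
    -- values are small, hence close. Uniform continuity on one disc thus extends to K.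
    tail-and-mesh : ∀ (f : 𝒞₀) r → ∃[ N ] (∀ x → ¬ Disc N x → [ r ] ≤∞ v (𝒞₀.to f x)) ×
      (∀ x y → K.v (π K.^ N) ≤∞ K.v (x K.- y) → near r (𝒞₀.to f x) (𝒞₀.to f y))
    tail-and-mesh f r =
      let U , cU , small = 𝒞₀.vanishes f r
          M , U⊆ = compact-bounded cU
          n , uniform = uniform-on-disc (𝒞₀.fun f) (𝒞₀.continuous f) M r
          outside : ∀ x → ¬ Disc M x → [ r ] ≤∞ v (𝒞₀.to f x)
          outside x x∉ = ℂP.≤v-cong (ℂS.solve 1 (λ x → x ℂS.:- ℂS.con (+ 0) ℂS.:= x) ℂ.refl _)
              (small x (λ x∈ → x∉ (U⊆ x∈)))
          mesh : ∀ x y → K.v (π K.^ (M ℕ.+ n)) ≤∞ K.v (x K.- y) → Dec (Disc M x) →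
              near r (𝒞₀.to f x) (𝒞₀.to f y)
          mesh = λ { x y x-y (yes x∈) → uniform x y x∈ (≤∞-trans (π^-mono (ℕ.m≤n+m n M)) x-y)
                   ; x y x-y (no x∉) → ℂP.v-+-neg _ _ (outside x x∉)
                       (outside y (λ y∈ → x∉ (disc-near M (M ℕ.+ n) y∈ x-y))) }
      in M ℕ.+ n , (λ x x∉ → outside x (λ x∈ → x∉ (disc-weaken (ℕ.m≤m+n M n) x∈))) , λ x y x-y →
          mesh x y x-y em

    riemannSum-cauchy : ∀ f → Cauchy (λ N → riemannSum N f)
    riemannSum-cauchy f r =
      let N₀ , tail , mesh = tail-and-mesh f r in
      N₀ , λ m n N₀≤m N₀≤n → ℂ.v-trans _ (riemannSum N₀ f) _ (stable N₀ tail mesh m N₀≤m)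
        (ℂ.v-swap (riemannSum n f) (riemannSum N₀ f) (stable N₀ tail mesh n N₀≤n))
      where
      stable : ∀ N₀ → (∀ x → ¬ Disc N₀ x → [ r ] ≤∞ v (𝒞₀.to f x)) →
        (∀ x y → K.v (π K.^ N₀) ≤∞ K.v (x K.- y) → near r (𝒞₀.to f x) (𝒞₀.to f y)) →
        ∀ N → N₀ ℕ.≤ N → near r (riemannSum N f) (riemannSum N₀ f)
      stable N₀ tail mesh N N₀≤N = ≡.subst (λ N → near r (riemannSum N f) (riemannSum N₀ f))
          (ℕ.m∸n+n≡m N₀≤N)
        (ℂP.≤v-cong (ℂ.trans (ℂ.x[y-z]≈xy-xz (volume (j ℕ.+ N₀)) _ _)
            (ℂ.+-cong (ℂ.sym (riemannSum≈ (j ℕ.+ N₀) f))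
            (ℂ.-‿cong (ℂ.trans (ℂ.sym (ℂ.*-assoc _ _ _))
                (ℂ.trans (ℂ.*-congʳ (volume-q^ j N₀)) (ℂ.sym (riemannSum≈ N₀ f)))))))
          (ℂ.v-*ˡ (volume (j ℕ.+ N₀)) _ (volume-integral (j ℕ.+ N₀))
            (total-stable (𝒞₀.to f) (Func.cong (𝒞₀.fun f)) tail mesh j)))
        where
        j : ℕ
        j = N ℕ.∸ N₀

    opaque
      ∫dx : 𝒞₀ → ℂ.Carrier
      ∫dx f = proj₁ (ℂ-complete (λ N → riemannSum N f) (riemannSum-cauchy f))

      riemannSum⟶ : ∀ f → (λ N → riemannSum N f) ⟶ ∫dx f
      riemannSum⟶ f = proj₂ (ℂ-complete (λ N → riemannSum N f) (riemannSum-cauchy f))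

    riemannSum-linear : ∀ N → IsLeftModuleHomomorphism 𝒞₀-module ℂ-module (riemannSum N)
    riemannSum-linear N = weightedSum-linear 𝒞₀-evaluation (N ℕ.+ N) (ϖ K.^ N) (λ _ → volume N)

    ∫dx-linear : IsLeftModuleHomomorphism 𝒞₀-module ℂ-module ∫dx
    ∫dx-linear = Limit.limit-linear em 𝒞₀-module {riemannSum} {∫dx} riemannSum-linear riemannSum⟶

    private
      module I = IsLeftModuleHomomorphism ∫dx-linear
      module C₀M = RawLeftModule 𝒞₀-module

    ∫dx-cong : ∀ f g → (∀ x → 𝒞₀.to f x ≈ 𝒞₀.to g x) → ∫dx f ≈ ∫dx g
    ∫dx-cong f g f≗g = I.⟦⟧-cong {f} {g} f≗g

    ∫dx-+ : ∀ f g h → (∀ x → 𝒞₀.to h x ≈ 𝒞₀.to f x + 𝒞₀.to g x) → ∫dx h ≈ ∫dx f + ∫dx g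
    ∫dx-+ f g h eq = ℂ.trans (∫dx-cong h (f C₀M.+ᴹ g) eq) (I.+ᴹ-homo f g)

    ∫dx-0 : ∀ f → (∀ x → 𝒞₀.to f x ≈ 0#) → ∫dx f ≈ 0#
    ∫dx-0 f eq = ℂ.trans (∫dx-cong f C₀M.0ᴹ eq) I.0ᴹ-homo

    ∫dx-neg : ∀ f g → (∀ x → 𝒞₀.to g x ≈ ℂ.- 𝒞₀.to f x) → ∫dx g ≈ ℂ.- ∫dx f
    ∫dx-neg f g eq = ℂ.trans (∫dx-cong g (C₀M.-ᴹ f) eq) (I.-ᴹ-homo f)

    ∫dx-* : ∀ c f g → (∀ x → 𝒞₀.to g x ≈ proj₁ c * 𝒞₀.to f x) → ∫dx g ≈ proj₁ c * ∫dx f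
    ∫dx-* c f g eq = ℂ.trans (∫dx-cong g (c C₀M.*ₗ f) eq) (I.*ₗ-homo c f)

    -- Volumes are integral, so Riemann sums do not increase sup-norm distances, and neither does
    -- their limit.
    ∫dx-near : ∀ f g {r} → (∀ x → near r (𝒞₀.to f x) (𝒞₀.to g x)) → near r (∫dx f) (∫dx g)
    ∫dx-near f g {r} f-g = ℂP.⟶-bound 0 (λ N _ → cosetSum-near (N ℕ.+ N) λ x _ →
        ≡.subst ([ r ] ≤∞_) (ℂ.v-cong (ℂ.trans (ℂ.x[y-z]≈xy-xz (volume N) _ _)
            (ℂ.+-cong (ℂ.*-comm _ _) (ℂ.-‿cong (ℂ.*-comm _ _)))))
          (ℂ.v-*ˡ (volume N) _ (volume-integral N) (f-g (ϖ K.^ N K.* x))))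
      (ℂP.⟶-+ (riemannSum⟶ f) (ℂP.⟶-neg (riemannSum⟶ g)))

    ∫dx-integral : ∀ f → Integral (∫dx f)
    ∫dx-integral f = ℂP.⟶-bound 0 (λ N _ → cosetSum-≤v (N ℕ.+ N) λ x _ →
      ℂ.*-integral (𝒞₀.integral f _) (volume-integral N)) (riemannSum⟶ f)

    eventually⟶ : ∀ {u : ℕ → ℂ.Carrier} {a} N → (∀ n → N ℕ.≤ n → u n ≈ a) → u ⟶ a
    eventually⟶ N eq r = N , λ n N≤n → ℂ.v-≈ _ _ (eq n N≤n)

    module _ (h : 𝒞₀) (a c : K.Carrier) (ind : IsIndicator (𝒞₀.fun h)
        (λ x → K.v c ≤∞ K.v (x K.- a))) where

      -- In the grid at level N the ball a + c𝔬 consists of the points whose index is congruent to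
      -- π^N a modulo π^k, which leaves i digits free. Small balls correspond to k = N + m, large
      -- ones to k = N - m.
      riemannSum-ball : ∀ N k i → N ℕ.+ N ≡ k ℕ.+ i → c K.≈ ϖ K.^ N K.* π K.^ k → Disc N a →
        riemannSum N h ≈ volume N * q^ i
      riemannSum-ball N k i N+N≡ c≈ a∈ = ℂ.trans (riemannSum≈ N h) (ℂ.*-congˡ (begin
        S (N ℕ.+ N) H                                     ≡⟨ ≡.cong (λ l → S l H) N+N≡ ⟩
        S (k ℕ.+ i) H
            ≈⟨ S-split k i {H} (λ x≈y → Func.cong (𝒞₀.fun h) (K.*-congˡ x≈y)) ⟩
        S k (λ x → S i (λ y → H (x K.+ π K.^ k K.* y)))
            ≈⟨ ℂP.-‿≈0⇒≈ (λ r → cosetSum-single k {t} a∈ outside inside) ⟩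
        q^ i                                              ∎))
        where
        open SetoidReasoning ℂ.setoid
        H : K.Carrier → ℂ.Carrier
        H x = 𝒞₀.to h (ϖ K.^ N K.* x)
        t : K.Carrier
        t = π K.^ N K.* a
        offset : ∀ x y → ϖ K.^ N K.* (x K.+ y) K.- a K.≈ ϖ K.^ N K.* (x K.- t K.+ y)
        offset x y = K.trans (K.+-congˡ (K.-‿cong (K.sym (KP.inverse-cancelˡ a (ϖ^π^≈1 N)))))
          (KS.solve 4 (λ w x y t → w KS.:* (x KS.:+ y) KS.:- w KS.:* t KS.:=
              w KS.:* (x KS.:- t KS.:+ y)) K.refl (ϖ K.^ N) x y t)
        inside : ∀ {r} x → K.Integral x → K.v (π K.^ k) ≤∞ K.v (x K.- t) →
            r ≤∞ v (S i (λ y → H (x K.+ π K.^ k K.* y)) - q^ i)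
        inside x ix x~t = ℂ.v-≈ _ _ (ℂ.trans (S-cong i λ y iy →
            proj₁ ind _ (≡.subst₂ _≤∞_ (K.v-cong (K.sym c≈))
            (K.v-cong (K.sym (offset x (π K.^ k K.* y))))
                (KP.v-*-monoʳ (ϖ K.^ N) (K.v-+-min _ _ x~t (KP.v-*≥ˡ (π K.^ k) iy)))))
          (ℂ.trans (S-const i 1#) (ℂ.*-identityʳ _)))
        outside : ∀ {r} x → K.Integral x → ¬ K.v (π K.^ k) ≤∞ K.v (x K.- t) →
            r ≤∞ v (S i (λ y → H (x K.+ π K.^ k K.* y)))
        outside x ix x≁t = cosetSum-≤v i λ y iy → ℂP.≈0⇒≤v (proj₂ ind _ λ le → x≁t
          (KP.≤v-cong (KS.solve 2 (λ x y → x KS.:+ y KS.:- y KS.:= x)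
              K.refl (x K.- t) (π K.^ k K.* y))
            (KP.v-+-neg _ _ (KP.v-*-cancel (π K.^ k) (x K.- t K.+ π K.^ k K.* y) (ϖ^π^≈1 N)
              (≡.subst₂ _≤∞_ (K.v-cong c≈) (K.v-cong (offset x (π K.^ k K.* y))) le))
                  (KP.v-*≥ˡ (π K.^ k) iy))))

    ∫dx-small-ball : ∀ h a m → IsIndicator (𝒞₀.fun h) (λ x → K.v (π K.^ m) ≤∞ K.v (x K.- a)) →
        ∫dx h ≈ volume m
    ∫dx-small-ball h a m ind =
      let M , a∈ = bounded a in
      ℂP.⟶-unique (riemannSum⟶ h) (eventually⟶ (M ℕ.+ m) λ N le →
        let m≤N = ℕ.≤-trans (ℕ.m≤n+m m M) le ; i = N ℕ.∸ m ; N≡ = ℕ.m∸n+n≡m m≤N in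
        ℂ.trans (riemannSum-ball h a (π K.^ m) ind N (N ℕ.+ m) i
            (≡.trans (≡.cong (N ℕ.+_) (≡.trans (≡.sym N≡) (ℕ.+-comm i m)))
                (≡.sym (ℕ.+-assoc N m i)))
            (K.sym (ϖ^π^-cancel N m)) (a∈ N (ℕ.≤-trans (ℕ.m≤m+n M m) le)))
          (≡.subst (λ N → volume N * q^ i ≈ volume m) N≡ (volume-q^ i m)))

    ∫dx-large-ball : ∀ h a m → IsIndicator (𝒞₀.fun h) (λ x → K.v (ϖ K.^ m) ≤∞ K.v (x K.- a)) →
        ∫dx h ≈ c₀ * q^ m
    ∫dx-large-ball h a m ind =
      let M , a∈ = bounded a in
      ℂP.⟶-unique (riemannSum⟶ h) (eventually⟶ (M ℕ.+ m) λ N le →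
        let m≤N = ℕ.≤-trans (ℕ.m≤n+m m M) le ; k = N ℕ.∸ m ; N≡ = ℕ.m+[n∸m]≡n m≤N in
        ℂ.trans (riemannSum-ball h a (ϖ K.^ m) ind N k (m ℕ.+ N)
            (≡.trans (≡.cong (ℕ._+ N) (≡.trans (≡.sym N≡) (ℕ.+-comm m k))) (ℕ.+-assoc k m N))
            (≡.subst (λ N → ϖ K.^ m K.≈ ϖ K.^ N K.* π K.^ k) N≡ (split-ϖ m k))
                (a∈ N (ℕ.≤-trans (ℕ.m≤m+n M m) le)))
          (volume-large N m))
      where
      split-ϖ : ∀ m k → ϖ K.^ m K.≈ ϖ K.^ (m ℕ.+ k) K.* π K.^ k
      split-ϖ m k = K.sym (K.trans (K.*-congʳ (Exp.^-homo-* K.semiring ϖ m k))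
          (K.trans (K.*-assoc _ _ _)
        (K.trans (K.*-congˡ (ϖ^π^≈1 k)) (K.*-identityʳ _))))
      volume-large : ∀ N m → volume N * q^ (m ℕ.+ N) ≈ c₀ * q^ m
      volume-large N m = begin
        q⁻^ N * c₀ * q^ (m ℕ.+ N)          ≈⟨ ℂ.*-congˡ (Exp.^-homo-* ℂ.semiring (q ℂ.• 1#) m N) ⟩
        q⁻^ N * c₀ * (q^ m * q^ N)         ≈⟨ ℂS.solve 4
            (λ a b c d → a ℂS.:* b ℂS.:* (c ℂS.:* d) ℂS.:= a ℂS.:* d ℂS.:* (b ℂS.:* c))
            ℂ.refl (q⁻^ N) c₀ (q^ m) (q^ N) ⟩
        q⁻^ N * q^ N * (c₀ * q^ m)         ≈⟨ ℂ.*-congʳ (q⁻^q^≈1 N) ⟩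
        1# * (c₀ * q^ m)                   ≈⟨ ℂ.*-identityˡ _ ⟩
        c₀ * q^ m                          ∎
        where open SetoidReasoning ℂ.setoid

    module 𝟙 (a : K.Carrier) (n : ℕ) where
      to : K.Carrier → ℂ.Carrier
      to x = if does (em {K.v (π K.^ n) ≤∞ K.v (x K.- a)}) then 1# else 0#

      to-1 : ∀ x → K.v (π K.^ n) ≤∞ K.v (x K.- a) → to x ≈ 1#
      to-1 x x∈ = ℂ.reflexive (≡.cong (if_then 1# else 0#) (dec-true em x∈))

      to-0 : ∀ x → ¬ K.v (π K.^ n) ≤∞ K.v (x K.- a) → to x ≈ 0#
      to-0 x x∉ = ℂ.reflexive (≡.cong (if_then 1# else 0#) (dec-false em x∉))

      to-near : ∀ x y → K.v (π K.^ n) ≤∞ K.v (y K.- x) → to y ≈ to x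
      to-near x y y-x = ℂ.reflexive (≡.cong (if_then 1# else 0#) (does-⇔ (mk⇔
        (K.v-trans x y a (K.v-swap y x y-x)) (K.v-trans y x a y-x)) em em))

      to-integral : ∀ x → Integral (to x)
      to-integral x with does (em {K.v (π K.^ n) ≤∞ K.v (x K.- a)})
      ... | true  = ℂ.1-integral
      ... | false = ℂ.0-integral

      indicator : LCc
      indicator = record
        { fun = record { to = to ; cong = λ {x} {y} x≈y → to-near y x (K.v-≈ x y x≈y) }
        ; integral = to-integral
        ; locallyConstant = λ x → proj₁ (π^n-finite n) , λ y y-x →
            to-near x y (≡.subst (_≤∞ K.v (y K.- x)) (≡.sym (proj₂ (π^n-finite n))) y-x)
        ; compactlySupported = let M , a∈ = bounded a in
            Disc M , proj₁ (disc-compactOpen M) , λ x x∉ → to-0 x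
                (λ x-a → x∉ (disc-near M n (a∈ M ℕ.≤-refl) x-a)) }
        where
        π^n-finite : ∀ n → ∃[ s ] K.v (π K.^ n) ≡ [ s ]
        π^n-finite n = KP.v-finite (KP.invertible⇒≉0 (π^ϖ^≈1 n))

    private
      module LM = RawLeftModule LCc-module

    module Step (f : Fun) (f-integral : IntegralValued f) (M n : ℕ) where
      private
        k : ℕ
        k = M ℕ.+ n
        F′ : K.Carrier → ℂ.Carrier
        F′ = Func.to f

      piece : K.Carrier → LCc
      piece x = (F′ (ϖ K.^ M K.* x) , f-integral _) LM.*ₗ 𝟙.indicator (ϖ K.^ M K.* x) n

      step : LCc
      step = cosetSum LM.+ᴹ-rawMonoid k piece

      step≈ : ∀ z → LCc.to step z ≈ S k (λ x → F′ (ϖ K.^ M K.* x) * 𝟙.to (ϖ K.^ M K.* x) n z)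
      step≈ z = cosetSum-rel LM.+ᴹ-rawMonoid ℂ.+-rawMonoid (λ f a → LCc.to f z ≈ a) ℂ.refl
        (λ p q → ℂ.+-cong p q) k {piece} (λ _ _ → ℂ.refl)

      -- Inside the disc only the ball containing z contributes, with the value of f at its sample
      -- point; outside, no ball contains z and f itself is small.
      step-near : ∀ {r} → (∀ x y → Disc M x → K.v (π K.^ n) ≤∞ K.v (x K.- y) →
          r ≤∞ v (F′ x - F′ y)) →
        (∀ x → ¬ Disc M x → r ≤∞ v (F′ x)) → ∀ z → r ≤∞ v (LCc.to step z - F′ z)
      step-near {r} uniform tail z = ℂP.≤v-cong (ℂ.+-congʳ (ℂ.sym (step≈ z))) (case em)
        where
        case : Dec (Disc M z) → r ≤∞ v (S k (λ x →
            F′ (ϖ K.^ M K.* x) * 𝟙.to (ϖ K.^ M K.* x) n z) - F′ z)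
        case (yes z∈) = cosetSum-single k {t} z∈
            (λ x ix x≁t → ℂP.≈0⇒≤v (ℂ.trans (ℂ.*-congˡ
                (𝟙.to-0 (ϖ K.^ M K.* x) n z (λ le → x≁t (K.v-swap t x
              (KP.v-*-cancel (π K.^ k) (t K.- x) (ϖ^π^≈1 M)
                  (≡.subst₂ _≤∞_ (K.v-cong (K.sym (ϖ^π^-cancel M n))) (K.v-cong (z-x x)) le))))))
                  (ℂ.zeroʳ _)))
            (λ x ix x~t → inside x (≡.subst₂ _≤∞_ (K.v-cong (ϖ^π^-cancel M n))
                (K.v-cong (K.sym (z-x x))) (KP.v-*-monoʳ (ϖ K.^ M) (K.v-swap x t x~t))))
          where
          t : K.Carrier
          t = π K.^ M K.* z
          z-x : ∀ x → z K.- ϖ K.^ M K.* x K.≈ ϖ K.^ M K.* (t K.- x)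
          z-x x = K.trans (K.+-congʳ (K.sym (KP.inverse-cancelˡ z (ϖ^π^≈1 M))))
              (K.sym (K.x[y-z]≈xy-xz _ t x))
          inside : ∀ x → K.v (π K.^ n) ≤∞ K.v (z K.- ϖ K.^ M K.* x) →
              r ≤∞ v (F′ (ϖ K.^ M K.* x) * 𝟙.to (ϖ K.^ M K.* x) n z - F′ z)
          inside x z-x = ℂP.≤v-cong (ℂ.+-congʳ
              (ℂ.sym (ℂ.trans (ℂ.*-congˡ (𝟙.to-1 (ϖ K.^ M K.* x) n z z-x)) (ℂ.*-identityʳ _))))
            (ℂ.v-swap _ _ (uniform z (ϖ K.^ M K.* x) z∈ z-x))
        case (no z∉) = ℂP.v-+-neg _ _ (cosetSum-≤v k λ x ix → ℂP.≈0⇒≤v (ℂ.trans (ℂ.*-congˡ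
            (𝟙.to-0 (ϖ K.^ M K.* x) n z (λ le →
                z∉ (disc-near M n (KP.≤v-cong (K.sym (KP.inverse-cancelˡ x (π^ϖ^≈1 M))) ix) le))))
                (ℂ.zeroʳ _)))
          (tail z z∉)

    open Step using (step; step-near)

    agree-on-step : ∀ {φ ψ : LCc → ℂ.Carrier} → IsLeftModuleHomomorphism LCc-module ℂ-module φ →
      IsLeftModuleHomomorphism LCc-module ℂ-module ψ →
          (∀ a n → φ (𝟙.indicator a n) ≈ ψ (𝟙.indicator a n)) →
      ∀ f if M n → φ (step f if M n) ≈ ψ (step f if M n)
    agree-on-step {φ} {ψ} φ-lin ψ-lin eq f if M n =
      cosetSum-rel LM.+ᴹ-rawMonoid LM.+ᴹ-rawMonoid (λ h _ → φ h ≈ ψ h)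
        (ℂ.trans (Φ.0ᴹ-homo) (ℂ.sym Ψ.0ᴹ-homo))
        (λ {g} {_} {h} p q → ℂ.trans (Φ.+ᴹ-homo g h)
            (ℂ.trans (ℂ.+-cong p q) (ℂ.sym (Ψ.+ᴹ-homo g h))))
        (M ℕ.+ n) {Step.piece f if M n} {Step.piece f if M n}
        (λ x _ → ℂ.trans (Φ.*ₗ-homo _ _) (ℂ.trans (ℂ.*-congˡ (eq _ n)) (ℂ.sym (Ψ.*ₗ-homo _ _))))
      where
      module Φ = IsLeftModuleHomomorphism φ-lin
      module Ψ = IsLeftModuleHomomorphism ψ-lin

    -- Local constancy is uniform on the disc, so the approximation by `step` holds to every
    -- precision and is an equality.
    LCc-step : ∀ (h : LCc) → ∃[ M ] ∃[ n ] (∀ x → LCc.to (step (LCc.fun h) (LCc.integral h) M n) x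
        ≈ LCc.to h x)
    LCc-step h =
      let U , cU , zero-outside = LCc.compactlySupported h
          M , U⊆ = compact-bounded cU
          s , uniform = compact-uniform (LCc.to h) _≈_
              (λ p q → ℂ.trans p (ℂ.sym q)) (LCc.locallyConstant h) (proj₁ (disc-compactOpen M))
          n , s≤ = π^-deep s
      in M , n , λ x → exact M n
           (λ x y x∈ x-y → uniform x y x∈ (≤∞-trans s≤ x-y))
           (λ x x∉ → zero-outside x (λ x∈ → x∉ (U⊆ x∈))) x
      where
      exact : ∀ M n → (∀ x y → Disc M x → K.v (π K.^ n) ≤∞ K.v (x K.- y) → LCc.to h x
          ≈ LCc.to h y) →
        (∀ x → ¬ Disc M x → LCc.to h x ≈ 0#) → ∀ x →
            LCc.to (step (LCc.fun h) (LCc.integral h) M n) x ≈ LCc.to h x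
      exact M n uniform zero-outside x = ℂP.-‿≈0⇒≈
          {LCc.to (step (LCc.fun h) (LCc.integral h) M n) x} {LCc.to h x} λ r →
        step-near (LCc.fun h) (LCc.integral h) M n {[ r ]}
            (λ x y x∈ x-y → ℂ.v-≈ _ _ (uniform x y x∈ x-y))
          (λ x x∉ → ℂP.≈0⇒≤v (zero-outside x x∉)) x

    agree-on-LCc : ∀ {φ ψ : LCc → ℂ.Carrier} → IsLeftModuleHomomorphism LCc-module ℂ-module φ →
      IsLeftModuleHomomorphism LCc-module ℂ-module ψ →
          (∀ a n → φ (𝟙.indicator a n) ≈ ψ (𝟙.indicator a n)) →
      ∀ h → φ h ≈ ψ h
    agree-on-LCc {φ} {ψ} φ-lin ψ-lin eq h = via (LCc-step h)
      where
      module Φ = IsLeftModuleHomomorphism φ-lin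
      module Ψ = IsLeftModuleHomomorphism ψ-lin
      via : ∃[ M ] ∃[ n ] (∀ x → LCc.to (step (LCc.fun h) (LCc.integral h) M n) x
          ≈ LCc.to h x) → φ h ≈ ψ h
      via (M , n , step≗h) = ℂ.trans (Φ.⟦⟧-cong {h} {h′} (λ x → ℂ.sym (step≗h x)))
          (ℂ.trans (agree-on-step φ-lin ψ-lin eq (LCc.fun h) (LCc.integral h) M n)
              (Ψ.⟦⟧-cong {h′} {h} step≗h))
        where
        h′ : LCc
        h′ = step (LCc.fun h) (LCc.integral h) M n

    LCc-dense : ∀ (f : 𝒞₀) r → ∃[ h ] (∀ x → near r (LCc.to h x) (𝒞₀.to f x))
    LCc-dense f r = let N , tail , mesh = tail-and-mesh f r in
      step (𝒞₀.fun f) (𝒞₀.integral f) N N , step-near (𝒞₀.fun f) (𝒞₀.integral f) N N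
          (λ x y _ → mesh x y) tail

    agree-on-𝒞₀ : ∀ {I J : 𝒞₀ → ℂ.Carrier} → SupNormContinuous I → SupNormContinuous J →
      (∀ h → I (LCc⇒𝒞₀ h) ≈ J (LCc⇒𝒞₀ h)) → ∀ f → I f ≈ J f
    agree-on-𝒞₀ {I} {J} I-cont J-cont eq f = ℂP.-‿≈0⇒≈ λ r →
      let s , I-near = I-cont f r
          t , J-near = J-cont f r
          h , h-f = LCc-dense f (s ℚ.⊔ t)
      in ℂ.v-trans (I f) (I (LCc⇒𝒞₀ h)) (J f)
          (ℂ.v-swap _ _ (I-near (LCc⇒𝒞₀ h) (λ x → ⊔-≤∞ˡ {s} {t} (h-f x))))
           (ℂ.v-trans (I (LCc⇒𝒞₀ h)) (J (LCc⇒𝒞₀ h)) (J f) (ℂ.v-≈ _ _ (eq h))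
               (J-near (LCc⇒𝒞₀ h) (λ x → ⊔-≤∞ʳ {s} {t} (h-f x))))

    module Density (f : 𝒞₀) where
      private
        module CM = RawLeftModule 𝒞-module
        F′ : K.Carrier → ℂ.Carrier
        F′ = 𝒞₀.to f

      opaque
        ∫fdx : 𝒞 → ℂ.Carrier
        ∫fdx g = ∫dx (f ⊛ g)

        ∫fdx≈ : ∀ g → ∫fdx g ≈ ∫dx (f ⊛ g)
        ∫fdx≈ g = ℂ.refl

        ∫fdx-integral : ∀ g → Integral (∫fdx g)
        ∫fdx-integral g = ∫dx-integral (f ⊛ g)

        ∫fdx-near : ∀ g h {r} → (∀ x → near r (F′ x * 𝒞.to g x) (F′ x * 𝒞.to h x)) →
            near r (∫fdx g) (∫fdx h)
        ∫fdx-near g h = ∫dx-near (f ⊛ g) (f ⊛ h)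

        ∫fdx-cong : ∀ g h → 𝒞.fun g ≗ 𝒞.fun h → ∫fdx g ≈ ∫fdx h
        ∫fdx-cong g h g≗h = ∫dx-cong (f ⊛ g) (f ⊛ h) (λ x → ℂ.*-congˡ (g≗h x))

        ∫fdx-+ : ∀ g h → ∫fdx (g CM.+ᴹ h) ≈ ∫fdx g + ∫fdx h
        ∫fdx-+ g h = ∫dx-+ (f ⊛ g) (f ⊛ h) (f ⊛ (g CM.+ᴹ h))
            (λ x → ℂ.distribˡ (F′ x) (𝒞.to g x) (𝒞.to h x))

        ∫fdx-0 : ∫fdx CM.0ᴹ ≈ 0#
        ∫fdx-0 = ∫dx-0 (f ⊛ CM.0ᴹ) (λ x → ℂ.zeroʳ (F′ x))

        ∫fdx-neg : ∀ g → ∫fdx (CM.-ᴹ g) ≈ ℂ.- ∫fdx g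
        ∫fdx-neg g = ∫dx-neg (f ⊛ g) (f ⊛ (CM.-ᴹ g))
            (λ x → ℂ.sym (RingProperties.-‿distribʳ-* ℂ.ring (F′ x) (𝒞.to g x)))

        ∫fdx-* : ∀ c g → ∫fdx (c CM.*ₗ g) ≈ proj₁ c * ∫fdx g
        ∫fdx-* c g = ∫dx-* c (f ⊛ g) (f ⊛ (c CM.*ₗ g))
          (λ x → ℂS.solve 3 (λ f c g → f ℂS.:* (c ℂS.:* g) ℂS.:= c ℂS.:* (f ℂS.:* g))
              ℂ.refl (F′ x) (proj₁ c) (𝒞.to g x))

      -- Off the disc f is small and multiplication by the integral values of g and h keeps it so;
      -- on the disc f is integral and preserves the closeness of g and h.
      product-near : ∀ g h {N r} → (∀ x → ¬ Disc N x → [ r ] ≤∞ v (F′ x)) →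
        (∀ {x} → Disc N x → near r (𝒞.to h x) (𝒞.to g x)) → ∀ x → Dec (Disc N x) →
        near r (F′ x * 𝒞.to h x) (F′ x * 𝒞.to g x)
      product-near g h {N} {r} tail h-g x (yes x∈) = ≡.subst ([ r ] ≤∞_)
          (ℂ.v-cong (ℂ.x[y-z]≈xy-xz (F′ x) (𝒞.to h x) (𝒞.to g x)))
        (ℂ.v-*ˡ (F′ x) _ (𝒞₀.integral f x) (h-g x∈))
      product-near g h {N} {r} tail h-g x (no x∉) = ℂP.v-+-neg (F′ x * 𝒞.to h x) (F′ x * 𝒞.to g x)
          (small h) (small g)
        where
        small : ∀ g → [ r ] ≤∞ v (F′ x * 𝒞.to g x)
        small g = ℂP.≤v-cong (ℂ.*-comm (𝒞.to g x) (F′ x))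
            (ℂ.v-*ˡ (𝒞.to g x) (F′ x) (𝒞.integral g x) (tail x x∉))

      ∫fdx-continuous : FréchetContinuous ∫fdx
      ∫fdx-continuous g r = let N , tail , _ = tail-and-mesh f r in
        Disc N , disc-compactOpen N , r , λ h h-g → ∫fdx-near h g
            (λ x → product-near g h {N} tail h-g x em)

      density : 𝒟
      density = record
        { ∫ = ∫fdx
        ; integral = ∫fdx-integral
        ; linear = linear {M = 𝒞-module} {φ = ∫fdx}
            (λ {g} {h} → ∫fdx-cong g h) ∫fdx-+ ∫fdx-0 ∫fdx-neg ∫fdx-*
        ; continuous = ∫fdx-continuous }

-- Half-integral powers of q

module IntegerPowers (ℂ : ValuedField) {x : ValuedField.Carrier ℂ} (root : InvertibleRoot ℂ x) where
  open ValuedField ℂ hiding (zero)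
  open InvertibleRoot root
  open IntegerSolver commutativeRing
  open SetoidReasoning setoid

  power-neg : ∀ n → √x^ (ℤ.- (+ n)) ≈ √x⁻¹ ^ n
  power-neg zero    = refl
  power-neg (suc n) = refl

  power-⊖ : ∀ m n → √x^ (m ℤ.⊖ n) ≈ √x ^ m * √x⁻¹ ^ n
  power-⊖ m zero = sym (*-identityʳ _)
  power-⊖ zero (suc n) = sym (*-identityˡ _)
  power-⊖ (suc m) (suc n) = begin
    √x^ (suc m ℤ.⊖ suc n)                      ≡⟨ ≡.cong √x^_ (ℤ.[1+m]⊖[1+n]≡m⊖n m n) ⟩
    √x^ (m ℤ.⊖ n)                              ≈⟨ power-⊖ m n ⟩
    √x ^ m * √x⁻¹ ^ n                          ≈⟨ *-identityˡ _ ⟨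
    1# * (√x ^ m * √x⁻¹ ^ n)                   ≈⟨ *-congʳ inverse ⟨
    √x * √x⁻¹ * (√x ^ m * √x⁻¹ ^ n)
        ≈⟨ solve 4 (λ a b c d → a :* b :* (c :* d) := a :* c :* (b :* d))
        refl √x √x⁻¹ (√x ^ m) (√x⁻¹ ^ n) ⟩
    √x ^ suc m * √x⁻¹ ^ suc n                  ∎

  square-^ : ∀ {y z} m → y * y ≈ z → y ^ (2 ℕ.* m) ≈ z ^ m
  square-^ {y} {z} m yy≈z = begin
    y ^ (2 ℕ.* m)      ≈⟨ Exp.^-assocʳ semiring y 2 m ⟨
    (y ^ 2) ^ m        ≈⟨ Exp.^-congˡ semiring m (trans (*-congˡ (*-identityʳ y)) yy≈z) ⟩
    z ^ m              ∎

  -- With q⁻¹ = √x⁻¹ * √x⁻¹ and c₀ = √x⁻¹ ^ d the right side is `volume m`, so q^(-d/2-m) appears in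
  -- the form produced by Riemann sums.
  power-small : ∀ d m → √x^ (ℤ.- (+ d) ℤ.- + 2 ℤ.* (+ m)) ≈ (√x⁻¹ * √x⁻¹) ^ m * √x⁻¹ ^ d
  power-small d m = begin
    √x^ (ℤ.- (+ d) ℤ.- + 2 ℤ.* (+ m))       ≡⟨ ≡.cong √x^_
        (≡.trans (≡.cong (λ i → ℤ.- (+ d) ℤ.- i) (≡.sym (ℤ.pos-* 2 m)))
        (≡.sym (ℤ.neg-distrib-+ (+ d) (+ (2 ℕ.* m))))) ⟩
    √x^ (ℤ.- (+ (d ℕ.+ 2 ℕ.* m)))           ≈⟨ power-neg (d ℕ.+ 2 ℕ.* m) ⟩
    √x⁻¹ ^ (d ℕ.+ 2 ℕ.* m)                  ≈⟨ Exp.^-homo-* semiring √x⁻¹ d (2 ℕ.* m) ⟩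
    √x⁻¹ ^ d * √x⁻¹ ^ (2 ℕ.* m)             ≈⟨ *-congˡ (square-^ m refl) ⟩
    √x⁻¹ ^ d * (√x⁻¹ * √x⁻¹) ^ m            ≈⟨ *-comm _ _ ⟩
    (√x⁻¹ * √x⁻¹) ^ m * √x⁻¹ ^ d            ∎

  power-large : ∀ d m → √x^ (ℤ.- (+ d) ℤ.- + 2 ℤ.* -[1+ m ]) ≈ √x⁻¹ ^ d * x ^ suc m
  power-large d m = begin
    √x^ (ℤ.- (+ d) ℤ.- + 2 ℤ.* -[1+ m ])    ≡⟨ ≡.cong √x^_
        (≡.trans (ℤ.+-comm (ℤ.- (+ d)) (+ (2 ℕ.* suc m))) (ℤ.m-n≡m⊖n (2 ℕ.* suc m) d)) ⟩
    √x^ ((2 ℕ.* suc m) ℤ.⊖ d)               ≈⟨ power-⊖ (2 ℕ.* suc m) d ⟩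
    √x ^ (2 ℕ.* suc m) * √x⁻¹ ^ d           ≈⟨ *-congʳ (square-^ (suc m) square) ⟩
    x ^ suc m * √x⁻¹ ^ d                    ≈⟨ *-comm _ _ ⟩
    √x⁻¹ ^ d * x ^ suc m                    ∎

-- The transform over ℚ_ℓ with values in ℂ_p

module FourierTransform (em : Classical) {ℓ p : ℕ} (ℓ-prime : Prime ℓ) (p-prime : Prime p)
    (ℓ≢p : ℓ ≢ p)
  (ℚₗ : PAdicNumbers ℓ)
  (K : FiniteExtension (PAdicNumbers.valuedField ℚₗ)) (localData : LocalData K)
  (ℂₚ : ComplexPAdics p)
  (√q : InvertibleRoot (ComplexPAdics.valuedField ℂₚ)
      (ValuedField._•_ (ComplexPAdics.valuedField ℂₚ) (LocalData.q localData)
      (ValuedField.1# (ComplexPAdics.valuedField ℂₚ))))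
  (ζ : CompatibleRoots ℓ (ComplexPAdics.valuedField ℂₚ)) where
  open Fourier ℚₗ K localData (ComplexPAdics.valuedField ℂₚ) ζ √q
  open LocalData localData using (π; q; different; codifferent; π-generates)
  open InvertibleRoot √q using (√x; √x⁻¹; square; inverse)
  private
    ℂ′ = ComplexPAdics.valuedField ℂₚ
    F = PAdicNumbers.valuedField ℚₗ
    module F = ValuedField F
    module KP = ValuedFieldProperties em (FiniteExtension.valuedField K)
    module ℂP = ValuedFieldProperties em ℂ′
    module KS = IntegerSolver K.commutativeRing
    module ℂS = IntegerSolver ℂ.commutativeRing
    module C = AdditiveCharacter em ℓ-prime ℚₗ ζ

  K-complete : K.Complete
  K-complete = FiniteExtensionComplete.extension-complete em
      (IsCompletion.complete (PAdicNumbers.isCompletion ℚₗ)) K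

  ℂ-complete : ℂ.Complete
  ℂ-complete = IsCompletion.complete (ComplexPAdics.isCompletion ℂₚ)

  vℓ≡1 : K.v (ℓ K.• K.1#) ≡ [ 1ℚ ]
  vℓ≡1 = ≡.trans (EmbeddingProperties.v-• (FiniteExtension.isEmbedding K) ℓ) C.vℓ≡1

  vℓ≰0 : ¬ K.v (ℓ K.• K.1#) ≤∞ 0∞
  vℓ≰0 le = contradiction (≡.subst (_≤∞ 0∞) vℓ≡1 le)
      (RationalResidues.1≰0 ℓ-prime (PAdicNumbers.rationals ℚₗ))

  -- As ℓ has positive valuation, ℓ = π y for some y; since ℓ is nonzero in K, the inverse of π is y
  -- / ℓ.
  uniformizer-inverse : ∃[ ϖ ] π K.* ϖ K.≈ K.1#
  uniformizer-inverse =
    let y , _ , ℓ≈πy = Equivalence.to (π-generates (ℓ K.• K.1#)) vℓ≰0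
        z , ℓz≈1 = KP.inverse {ℓ K.• K.1#} λ ℓ≈0 →
            contradiction (≡.trans (≡.sym vℓ≡1) (≡.trans (K.v-cong ℓ≈0) K.v-0)) λ ()
    in y K.* z , K.trans (K.sym (K.*-assoc π y z)) (K.trans (K.*-congʳ (K.sym ℓ≈πy)) ℓz≈1)

  ϖ : K.Carrier
  ϖ = proj₁ uniformizer-inverse

  πϖ≈1 : π K.* ϖ K.≈ K.1#
  πϖ≈1 = proj₂ uniformizer-inverse

  prime∣^⇒≡ : ∀ n → ¬ p ∣ ℓ ℕ.^ n
  prime∣^⇒≡ zero p∣1 = Primality.¬prime[1] (≡.subst Prime (∣.∣1⇒≡1 p∣1) p-prime)
  prime∣^⇒≡ (suc n) p∣ℓ^1+n with Primality.euclidsLemma ℓ (ℓ ℕ.^ n) p-prime p∣ℓ^1+n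
  ... | inj₂ p∣ℓ^n = prime∣^⇒≡ n p∣ℓ^n
  ... | inj₁ p∣ℓ with Primality.prime⇒irreducible ℓ-prime p∣ℓ
  ... | inj₁ p≡1 = Primality.¬prime[1] (≡.subst Prime p≡1 p-prime)
  ... | inj₂ p≡ℓ = ℓ≢p (≡.sym p≡ℓ)

  -- The additive group of the residue field is killed by ℓ, so q divides ℓ^q, and p is another
  -- prime.
  p∤q : ¬ p ∣ q
  p∤q p∣q = prime∣^⇒≡ q (∣.∣-trans p∣q (LocalField.q∣n^q em K K-complete localData ϖ πϖ≈1 ℓ
      {{Primality.prime⇒nonZero ℓ-prime}} vℓ≰0))

  vq≡0 : ℂ.v (q ℂ.• ℂ.1#) ≡ 0∞
  vq≡0 = ≡.trans (EmbeddingProperties.v-• (IsCompletion.isEmbedding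
      (ComplexPAdics.isCompletion ℂₚ)) q)
    (≡.trans (EmbeddingProperties.v-• (AlgebraicClosure.isEmbedding (ComplexPAdics.closure ℂₚ)) q)
    (≡.trans (EmbeddingProperties.v-• (IsCompletion.isEmbedding
        (PAdicNumbers.isCompletion (ComplexPAdics.ℚₚ ℂₚ))) q)
    (PAdicValuation.v-unit (PAdicNumbers.rationals (ComplexPAdics.ℚₚ ℂₚ)) q p∤q)))

  q⁻¹ : ℂ.Carrier
  q⁻¹ = √x⁻¹ ℂ.* √x⁻¹

  qq⁻¹≈1 : q ℂ.• ℂ.1# ℂ.* q⁻¹ ℂ.≈ ℂ.1#
  qq⁻¹≈1 = ℂ.trans (ℂ.*-congʳ (ℂ.sym square)) (ℂ.trans
    (ℂS.solve 2 (λ a b → a ℂS.:* a ℂS.:* (b ℂS.:* b) ℂS.:= a ℂS.:* b ℂS.:* (a ℂS.:* b))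
        ℂ.refl √x √x⁻¹)
    (ℂ.trans (ℂ.*-cong inverse inverse) (ℂ.*-identityˡ ℂ.1#)))

  q⁻¹-integral : ℂ.Integral q⁻¹
  q⁻¹-integral = ≡⇒≤∞ (≡.sym (≡.trans (≡.sym (0+ _))
      (≡.trans (≡.cong (_+∞ ℂ.v q⁻¹) (≡.sym vq≡0)) (ℂP.v-inverse qq⁻¹≈1))))
    where
    0+ : ∀ a → 0∞ +∞ a ≡ a
    0+ [ r ] = []-cong (ℚ.+-identityˡ r)
    0+ ⊤⁺    = ≡.refl

  -- Doubling a nonpositive valuation does not raise it, and the doubled valuation is that of the
  -- integral element q⁻¹.
  √x⁻¹-integral : ℂ.Integral √x⁻¹
  √x⁻¹-integral with ≤∞-total 0∞ (ℂ.v √x⁻¹)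
  ... | inj₁ 0≤v = 0≤v
  ... | inj₂ v≤0 = ≤∞-trans q⁻¹-integral (≡.subst (_≤∞ ℂ.v √x⁻¹) (≡.sym (ℂ.v-* √x⁻¹ √x⁻¹))
      (a≤0⇒2a≤a v≤0))

  c₀ : ℂ.Carrier
  c₀ = √x⁻¹ ℂ.^ δ

  c₀-integral : ℂ.Integral c₀
  c₀-integral = power δ
    where
    power : ∀ n → ℂ.Integral (√x⁻¹ ℂ.^ n)
    power zero    = ℂ.1-integral
    power (suc n) = ℂ.*-integral √x⁻¹-integral (power n)

  e : K.Carrier → ℂ.Carrier
  e x = ζ^ tr x

  open Exponential ℚₗ ζ using (ζ^-integral; ζ^-near)
  open FiniteExtension K using (tr-cong; tr--)

  e-cong : ∀ {x y} → x K.≈ y → e x ℂ.≈ e y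
  e-cong {x} {y} x≈y = ℂ.reflexive (ζ^-near (tr x) (tr y) (F.v-≈ _ _ (tr-cong x≈y)))

  -- Compatibility of the trace with differences is what is at hand, so the sum is written with
  -- differences only: x + y = x - ((x - x) - y).
  tr-+ : ∀ x y → tr (x K.+ y) F.≈ tr x F.+ tr y
  tr-+ x y = begin
    tr (x K.+ y)
        ≈⟨ tr-cong (KS.solve 2 (λ x y → x KS.:+ y KS.:= x KS.:- ((x KS.:- x) KS.:- y)) K.refl x y) ⟩
    tr (x K.- ((x K.- x) K.- y))                    ≈⟨ tr-- x ((x K.- x) K.- y) ⟩
    tr x F.- tr ((x K.- x) K.- y)
        ≈⟨ F.+-congˡ (F.-‿cong (F.trans (tr-- (x K.- x) y) (F.+-congʳ (tr-- x x)))) ⟩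
    tr x F.- ((tr x F.- tr x) F.- tr y)
        ≈⟨ FS.solve 2 (λ x y → x FS.:- ((x FS.:- x) FS.:- y) FS.:= x FS.:+ y) F.refl (tr x) (tr y) ⟩
    tr x F.+ tr y                                   ∎
    where
    open SetoidReasoning F.setoid
    module FS = IntegerSolver F.commutativeRing

  e-+ : ∀ x y → e (x K.+ y) ℂ.≈ e x ℂ.* e y
  e-+ x y = ℂ.trans (ℂ.reflexive (ζ^-near (tr (x K.+ y)) (tr x F.+ tr y) (F.v-≈ _ _ (tr-+ x y))))
      (C.ζ^-+ (tr x) (tr y))

  -- Triviality of e on b𝔬 means that tr (b y) is integral for all integral y, so that b lies in the
  -- codifferent; multiplication by π^δ carries the codifferent onto 𝔬. In the other direction π^δ
  -- is cancelled.
  e-conductor : ∀ b → (∀ y → K.Integral y → e (b K.* y) ℂ.≈ ℂ.1#) ⇔ K.Integral (π K.^ δ K.* b)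
  e-conductor b = mk⇔
    (λ trivial → Equivalence.from (different (π K.^ δ K.* b))
        (b , (λ y iy → C.ζ^≈1⇒integral (trivial y iy)) , K.refl))
    (λ i y iy → let d , d∈ , eq = Equivalence.to (different (π K.^ δ K.* b)) i in
      C.integral⇒ζ^≈1 (≡.subst (0∞ ≤∞_) (F.v-cong (tr-cong (K.*-congʳ (cancel d eq)))) (d∈ y iy)))
    where
    open LocalField em K K-complete localData ϖ πϖ≈1 using (π^ϖ^≈1)
    cancel : ∀ d → π K.^ δ K.* b K.≈ π K.^ δ K.* d → d K.≈ b
    cancel d eq = K.trans (K.sym (KP.inverse-cancelˡ d ϖπ))
        (K.trans (K.*-congˡ (K.sym eq)) (KP.inverse-cancelˡ b ϖπ))
      where
      ϖπ : ϖ K.^ δ K.* π K.^ δ K.≈ K.1#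
      ϖπ = K.trans (K.*-comm _ _) (π^ϖ^≈1 δ)

  open Analysis em K K-complete localData ϖ πϖ≈1 ℂ′ ℂ-complete q⁻¹ qq⁻¹≈1 q⁻¹-integral
  open Duality e e-cong e-+ (λ x → ζ^-integral (tr x)) e-conductor χ (λ r x → ℂ.refl)
  open HaarIntegral c₀ c₀-integral public
  open LocalField em K K-complete localData ϖ πϖ≈1 using (π^-divides; disc⇔ball)
  open Functionals (FiniteExtension.valuedField K) ℂ′ using (linear)
  open IntegerPowers ℂ′ √q using (power-small; power-large)

  transform : 𝒟 → 𝒞
  transform μ = record
    { fun = record { to = μ ^ ; cong = λ {x} {y} x≈y → L.⟦⟧-cong μ {χ x} {χ y}
        (λ z → e-cong (K.*-congʳ x≈y)) }
    ; integral = λ r → 𝒟.integral μ (χ r)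
    ; continuous = λ x r → let s , uniform = transform-uniform μ r in s , λ y y-x →
        uniform y x y-x }

  transform-mono : IsLeftModuleMonomorphism 𝒟-module 𝒞-module transform
  transform-mono = record
    { isLeftModuleHomomorphism = record
      { +ᴹ-isGroupHomomorphism = record
        { isMonoidHomomorphism = record
          { isMagmaHomomorphism = record
            { isRelHomomorphism = record { cong = λ μ≈ν r → μ≈ν (χ r) }
            ; homo = λ μ ν r → ℂ.refl }
          ; ε-homo = λ r → ℂ.refl }
        ; ⁻¹-homo = λ μ r → ℂ.refl }
      ; *ₗ-homo = λ c μ r → ℂ.refl }
    ; injective = λ {μ} {ν} → determined-by-characters μ ν }

  transform-image : ∀ f → UniformlyContinuous (𝒞.fun f) ⇔ (∃[ μ ] 𝒞.fun (transform μ) ≗ 𝒞.fun f)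
  transform-image f = mk⇔
    (λ uniform → Inverse.measure (𝒞.fun f) (𝒞.integral f) uniform ,
        Inverse.measure-transform (𝒞.fun f) (𝒞.integral f) uniform)
    (λ (μ , μ^≗f) r → let s , uniform = transform-uniform μ r in
      s , λ x y x-y → ℂP.≤v-cong (ℂ.+-cong (μ^≗f x) (ℂ.-‿cong (μ^≗f y))) (uniform x y x-y))

  dx : LCc → ℂ.Carrier
  dx h = ∫dx (LCc⇒𝒞₀ h)

  dx-linear : IsLeftModuleHomomorphism LCc-module ℂ-module dx
  dx-linear = linear {M = LCc-module} {φ = dx}
    (λ {f} {g} → ∫dx-cong (LCc⇒𝒞₀ f) (LCc⇒𝒞₀ g))
    (λ f g → ∫dx-+ (LCc⇒𝒞₀ f) (LCc⇒𝒞₀ g) (LCc⇒𝒞₀ (f LM.+ᴹ g)) (λ _ → ℂ.refl))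
    (∫dx-0 (LCc⇒𝒞₀ LM.0ᴹ) (λ _ → ℂ.refl))
    (λ f → ∫dx-neg (LCc⇒𝒞₀ f) (LCc⇒𝒞₀ (LM.-ᴹ f)) (λ _ → ℂ.refl))
    (λ c f → ∫dx-* c (LCc⇒𝒞₀ f) (LCc⇒𝒞₀ (c LM.*ₗ f)) (λ _ → ℂ.refl))
    where module LM = RawLeftModule LCc-module

  indicator-resp : ∀ (h : Fun) {E E′ : K.Carrier → Set} → (∀ x → E x ⇔ E′ x) → IsIndicator h E →
      IsIndicator h E′
  indicator-resp h E⇔E′ (h≈1 , h≈0) =
    (λ x x∈ → h≈1 x (Equivalence.from (E⇔E′ x) x∈)) ,
        (λ x x∉ → h≈0 x (λ x∈ → x∉ (Equivalence.to (E⇔E′ x) x∈)))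

  𝔩⇔ : ∀ n x → (𝔩^ (+ n)) x ⇔ (K.v (π K.^ n) ≤∞ K.v x)
  𝔩⇔ n x = mk⇔ (λ (y , iy , x≈) → KP.≤v-cong (K.sym x≈) (KP.v-*≥ˡ (π K.^ n) iy)) (π^-divides n)

  dx-isHaar : IsHaar dx
  dx-isHaar = record { linear = dx-linear ; value = value }
    where
    value : ∀ a n h → IsIndicator (LCc.fun h) (λ x → (𝔩^ n) (x K.- a)) →
      dx h ℂ.≈ InvertibleRoot.√x^_ √q (ℤ.- (+ δ) ℤ.- + 2 ℤ.* n)
    value a (+ m) h ind = ℂ.trans
      (∫dx-small-ball (LCc⇒𝒞₀ h) a m (indicator-resp (LCc.fun h) (λ x → 𝔩⇔ m (x K.- a)) ind))
      (ℂ.sym (power-small δ m))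
    value a -[1+ m ] h ind = ℂ.trans
      (∫dx-large-ball (LCc⇒𝒞₀ h) a (suc m) (indicator-resp (LCc.fun h)
          (λ x → disc⇔ball (suc m)) ind))
      (ℂ.sym (power-large δ m))

  dx-unique : ∀ dx′ → IsHaar dx′ → ∀ h → dx′ h ℂ.≈ dx h
  dx-unique dx′ haar = agree-on-LCc (IsHaar.linear haar) dx-linear λ a n →
    let ind = indicator-resp (LCc.fun (𝟙.indicator a n))
          (λ x → mk⇔ (Equivalence.from (𝔩⇔ n (x K.- a))) (Equivalence.to (𝔩⇔ n (x K.- a))))
                (𝟙.to-1 a n , 𝟙.to-0 a n)
    in ℂ.trans (IsHaar.value haar a (+ n) (𝟙.indicator a n) ind)
        (ℂ.sym (IsHaar.value dx-isHaar a (+ n) (𝟙.indicator a n) ind))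

  ∫dx-isExtension : IsExtension dx ∫dx
  ∫dx-isExtension = record
    { linear = ∫dx-linear
    ; continuous = λ f r → r , λ g → ∫dx-near g f
    ; extends = λ h → ℂ.refl }

  ∫dx-unique : ∀ ∫dx′ → IsExtension dx ∫dx′ → ∀ f → ∫dx′ f ℂ.≈ ∫dx f
  ∫dx-unique ∫dx′ ext = agree-on-𝒞₀ (IsExtension.continuous ext)
      (IsExtension.continuous ∫dx-isExtension)
    (IsExtension.extends ext)

  -- `χ ξ` and `χ′ ξ` differ only by the order of the factors under the trace.
  density-transform : ∀ f ξ → (Density.density f ^) ξ ℂ.≈ ∫dx (f ⊛ χ′ ξ)
  density-transform f ξ = ℂ.trans (Density.∫fdx-cong f (χ ξ) (χ′ ξ) (λ x → e-cong (K.*-comm ξ x)))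
      (Density.∫fdx≈ f (χ′ ξ))

mainTheorem1 : ExcludedMiddle (lsuc 0ℓ) →
    ∀ {ℓ p : ℕ} → Prime ℓ → Prime p → ℓ ≢ p →
    (ℚₗ : PAdicNumbers ℓ)
    (K : FiniteExtension (PAdicNumbers.valuedField ℚₗ)) (localData : LocalData K)
    (ℂₚ : ComplexPAdics p) →
    let ℂ = ComplexPAdics.valuedField ℂₚ in
    (√q : InvertibleRoot ℂ (ValuedField._•_ ℂ (LocalData.q localData) (ValuedField.1# ℂ)))
    (ζ : CompatibleRoots ℓ ℂ) →
    let open Fourier ℚₗ K localData ℂ ζ √q in
    (Σ[ 𝓕 ∈ (𝒟 → 𝒞) ]
    (∀ μ r → 𝒞.to (𝓕 μ) r ℂ.≈ (μ ^) r) ×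
    IsLeftModuleMonomorphism 𝒟-module 𝒞-module 𝓕 ×
    (∀ f → UniformlyContinuous (𝒞.fun f) ⇔ (∃[ μ ] 𝒞.fun (𝓕 μ) ≗ 𝒞.fun f)))
    ×
    (Σ[ dx ∈ (LCc → ℂ.Carrier) ]
    IsHaar dx ×
    (∀ dx′ → IsHaar dx′ → ∀ h → dx′ h ℂ.≈ dx h) ×
    (Σ[ ∫dx ∈ (𝒞₀ → ℂ.Carrier) ]
    IsExtension dx ∫dx ×
    (∀ ∫dx′ → IsExtension dx ∫dx′ → ∀ f → ∫dx′ f ℂ.≈ ∫dx f) ×
    (∀ (f : 𝒞₀) →
    Σ[ fdx ∈ 𝒟 ]
    (∀ g → 𝒟.∫ fdx g ℂ.≈ ∫dx (f ⊛ g)) ×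
    (∀ ξ → (fdx ^) ξ ℂ.≈ ∫dx (f ⊛ χ′ ξ)))))
mainTheorem1 em ℓ-prime p-prime ℓ≢p ℚₗ K localData ℂₚ √q ζ =
  (transform , (λ μ r → ℂ.refl) , transform-mono , transform-image) ,
  (dx , dx-isHaar , dx-unique , ∫dx , ∫dx-isExtension , ∫dx-unique ,
    λ f → Density.density f , Density.∫fdx≈ f , density-transform f)
  where
  open FourierTransform (classical em) ℓ-prime p-prime ℓ≢p ℚₗ K localData ℂₚ √q ζ
  module ℂ = ValuedField (ComplexPAdics.valuedField ℂₚ)
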